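{- Let $m\ge0$ and $\lambda,\mu$ partitions of $m$. There exists a unique $n_0\in N(m)$ such that $\langle\mathrm{ss}_{\lambda,n},\mathrm{ss}_{\mu,n}\rangle=0$ for all $n\in N(m)$ with $n<n_0$, and $\langle\mathrm{ss}_{\lambda,n},\mathrm{ss}_{\mu,n}\rangle>0$ for all $n\in N(m)$ with $n\ge n_0$.
   Context: $N(m)=\{n\ge m: n\equiv m\pmod 2\}$. $\langle\cdot,\cdot\rangle$ is the Hall inner product on homogeneous symmetric functions of degree $n$ (infinitely many variables), for which the Schur functions of degree $n$ are orthonormal. A skew shape is a horizontal strip if it has at most one box in each column. An SSOT of shape $\lambda$ is a sequence of partitions $S=(S^1,S'^2,S^2,S'^3,\dots)$ such that, with $S^0=S'^1=\emptyset$: for all $i\ge1$, $S'^i\subseteq S^{i-1}$, $S'^i\subseteq S^i$, and $S^{i-1}/S'^i$, $S^i/S'^i$ are horizontal strips (possibly empty); and $S^i=S'^{i+1}=\lambda$ for all large $i$. Put $m_i(S)=|S^{i-1}/S'^i|+|S^i/S'^i|$, length $n=\sum_i m_i(S)$, $x^S=\prod_ix_i^{m_i(S)}$. $\mathrm{ss}_{\lambda,n}(x)=\sum x^S$ over SSOTs of shape $\lambda$ and length $n$; it is a homogeneous symmetric function of degree $n$. -}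

module Defs where

open import Data.Nat using (ℕ; zero; suc; _+_; _∸_; _≤_; _<_; _≤ᵇ_; _≡ᵇ_; _⊓_)
open import Data.Nat.Properties using () renaming (_≟_ to _≟ℕ_)
open import Data.Integer using (ℤ; +_) renaming (_+_ to _+ℤ_; _*_ to _*ℤ_)
open import Data.Bool using (Bool; true; false; _∧_; if_then_else_)
open import Data.List using (List; []; _∷_; map; concatMap; filterᵇ; upTo; foldr)
open import Data.Nat.ListAction using (sum)
open import Data.List.Properties using (≡-dec)
open import Data.List.Relation.Unary.All using (All)
open import Data.List.Relation.Unary.Linked using (Linked)
open import Data.Product using (Σ; _×_; ∃)
open import Relation.Nullary using (does)
open import Relation.Binary.PropositionalEquality using (_≡_)

IsPartition : List ℕ → Set
IsPartition λ′ = All (λ x → 1 ≤ x) λ′ × Linked (λ a b → b ≤ a) λ′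

∣_∣ₚ : List ℕ → ℕ
∣ p ∣ₚ = sum p

-- parsF fuel n b : all partitions of n with every part ≤ b (fuel ≥ n).
parsF : ℕ → ℕ → ℕ → List (List ℕ)
parsF _ zero _ = [] ∷ []
parsF zero (suc n) _ = []
parsF (suc f) (suc n) b =
  concatMap (λ k → map (k ∷_) (parsF f (suc n ∸ k) k))
            (map suc (upTo (b ⊓ suc n)))

partitions : ℕ → List (List ℕ)
partitions n = parsF n n n

-- Horizontal strips.  hstrip κ σ = true iff κ ⊆ σ and σ/κ is a
-- horizontal strip, i.e. κᵢ ≤ σᵢ and σᵢ₊₁ ≤ κᵢ for all i.

hs : ℕ → List ℕ → List ℕ → Bool   -- first argument: upper bound κᵢ for σᵢ₊₁
hs b [] [] = true
hs b [] (s ∷ ss) = (s ≤ᵇ b) ∧ hs 0 [] ss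
hs b (k ∷ ks) [] = (k ≤ᵇ 0) ∧ hs k ks []
hs b (k ∷ ks) (s ∷ ss) = (k ≤ᵇ s) ∧ (s ≤ᵇ b) ∧ hs k ks ss

hstrip : List ℕ → List ℕ → Bool
hstrip [] [] = true
hstrip [] (s ∷ ss) = hs 0 [] ss
hstrip (k ∷ ks) [] = (k ≤ᵇ 0) ∧ hs k ks []
hstrip (k ∷ ks) (s ∷ ss) = (k ≤ᵇ s) ∧ hs k ks ss

eqᵇ : List ℕ → List ℕ → Bool
eqᵇ p q = does (≡-dec _≟ℕ_ p q)

ups : List ℕ → ℕ → List (List ℕ)
ups κ r = filterᵇ (hstrip κ) (partitions (∣ κ ∣ₚ + r))

downs : List ℕ → ℕ → List (List ℕ)
downs ρ a = filterᵇ (λ κ → hstrip κ ρ ∧ ((∣ ρ ∣ₚ ∸ ∣ κ ∣ₚ) ≤ᵇ a))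
                    (concatMap partitions (upTo (suc ∣ ρ ∣ₚ)))

-- Monomial coefficients.  A monomial x^α of the infinitely many
-- variables is given by a finite exponent list α = (α₁,…,αₖ)
-- (all later exponents 0).  A homogeneous symmetric function is
-- represented by its coefficient function.

SymFun : Set
SymFun = List ℕ → ℤ

-- Number of SSOTs of shape λ′, starting from S^{i-1} = ρ, whose
-- remaining weights m_i, m_{i+1}, … are given by α (then all 0).
-- One step: choose S'^i = κ ⊆ ρ (ρ/κ horizontal strip), then S^i = σ ⊇ κ
-- (σ/κ horizontal strip) with |ρ/κ| + |σ/κ| = a.
ssotCount : List ℕ → List ℕ → List ℕ → ℕ
ssotCount λ′ ρ [] = if eqᵇ ρ λ′ then 1 else 0
ssotCount λ′ ρ (a ∷ α) =
  sum (map (λ κ → sum (map (λ σ → ssotCount λ′ σ α)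
                           (ups κ (a ∸ (∣ ρ ∣ₚ ∸ ∣ κ ∣ₚ)))))
           (downs ρ a))

-- ss_{λ,n}: coefficient of x^α = number of SSOTs S of shape λ and length n
-- with m_i(S) = αᵢ (length of S is then |α|).
ss : List ℕ → ℕ → SymFun
ss λ′ n α = if ∣ α ∣ₚ ≡ᵇ n then + ssotCount λ′ [] α else + 0

-- Number of SSYT of shape ν, from current shape ρ, with content α
-- (chains of horizontal strips of sizes α₁, α₂, …).
kostka : List ℕ → List ℕ → List ℕ → ℕ
kostka ν ρ [] = if eqᵇ ρ ν then 1 else 0
kostka ν ρ (a ∷ α) = sum (map (λ σ → kostka ν σ α) (ups ρ a))

schur : List ℕ → SymFun
schur ν α = + kostka ν [] α

sumℤ : List ℤ → ℤ
sumℤ = foldr _+ℤ_ (+ 0)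

SchurExpansion : ℕ → SymFun → (List ℕ → ℤ) → Set
SchurExpansion n f c = ∀ α → f α ≡ sumℤ (map (λ ν → c ν *ℤ schur ν α) (partitions n))

-- Hall inner product on degree-n homogeneous symmetric functions
-- (Schur functions orthonormal):  HallIP n f g r  means  ⟨f,g⟩ = r.
HallIP : ℕ → SymFun → SymFun → ℤ → Set
HallIP n f g r =
  Σ (List ℕ → ℤ) λ c → Σ (List ℕ → ℤ) λ d →
    SchurExpansion n f c × SchurExpansion n g d ×
    (r ≡ sumℤ (map (λ ν → c ν *ℤ d ν) (partitions n)))

InN : ℕ → ℕ → Set
InN m n = ∃ λ k → n ≡ m + (k + k)

{-# OPTIONS --safe #-}
module Submission where

-- In terms of the operators h_a (add a horizontal strip of size a) and h_a^⊥ (remove one), an SSOT step is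
-- Σ h_i h_j^⊥. Let B be the sum of all s_β such that β has only columns of even length; then h_i^⊥ B = h_i B, and
-- h_k^⊥ (s_λ B) = Σ_j (h_j^⊥ s_λ) (h_{k−j}^⊥ B) shows, step by step, that the sum of the ss_{λ,n} over n is s_λ B.
-- So the coefficient of s_ν in ss_{λ,n} is Σ_β c^ν_{λ,β} ≥ 0 over the β ⊢ n − m with even columns, where c^ν_{λ,β}
-- counts the semistandard tableaux of shape λ whose reading word, acting on β by adding boxes, passes through
-- partitions only and ends at ν. Such a word also leads from β + (1,1) to ν + (1,1); hence positivity of the
-- inner product persists from n to n + 2. It does occur, because some ν/β consists of m boxes in distinct rows and
-- columns, which makes c^ν_{λ,β} > 0 for every λ ⊢ m. The n₀ is unique since the Schur functions are independent.
--
-- That these counts are structure constants of the Schur basis (lr-pieri) is row insertion, carried out on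
-- Gelfand–Tsetlin patterns with Fomin's local rule for horizontal strips.

open import Defs
open import Data.Nat
open import Data.Nat.Properties
open import Data.Nat.Induction using (<-wellFounded)
open import Data.Nat.ListAction using (sum)
open import Data.Nat.ListAction.Properties using (sum-++)
open import Data.Nat.Tactic.RingSolver using (solve-∀)
open import Data.Integer using (ℤ; +_; +<+) renaming (_+_ to _+ℤ_; _*_ to _*ℤ_; _<_ to _<ℤ_)
import Data.Integer.Properties as ℤ
import Algebra.Properties.AbelianGroup ℤ.+-0-abelianGroup as ℤᴳ
open import Data.Bool using (Bool; true; false; _∧_; if_then_else_; T)
open import Data.Bool.Properties using (T-∧; T?)
open import Data.Empty using (⊥; ⊥-elim)
open import Data.List using (List; []; _∷_; _++_; map; concatMap; filterᵇ; upTo; applyUpTo; length; reverse)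
open import Data.List.Properties
  using (≡-dec; ∷-injective; map-∘; map-cong-local; unfold-reverse; reverse-involutive)
open import Data.List.Relation.Unary.All as All using (All; []; _∷_)
import Data.List.Relation.Unary.All.Properties as All
open import Data.List.Relation.Unary.Linked using (Linked; []; [-]; _∷_)
open import Data.Product using (Σ; ∃; ∃!; _×_; _,_; proj₁; proj₂)
open import Data.Sum using (_⊎_; inj₁; inj₂)
open import Data.Unit using (⊤; tt)
open import Function using (_∘_; id; Equivalence)
open import Induction.WellFounded using (Acc; acc)
open import Relation.Binary.Definitions using (DecidableEquality; tri<; tri≈; tri>)
open import Relation.Binary.PropositionalEquality
open import Relation.Nullary
open import Relation.Nullary.Decidable using (map′)

-- The series B is infinite, so every identity is stated between coefficients, and all partitions
-- range over `partitions≤ M` with M large enough that nothing is cut off. Horizontal strips are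
-- mostly summed over all sizes at once, the form in which the local rule is a bijection without
-- bookkeeping; a fixed size is recovered afterwards, since `lr` vanishes unless its sizes add up.
--
-- The roles in `lr β λ′ ν` are not symmetric: β is the shape of the tableau, λ′ the partition on
-- which it acts. `lr-pieri` moves a horizontal strip from the second place to the first, and
-- iterating this makes `lr` a structure constant.
--
-- Insertion works on patterns because the lattice condition compares only three consecutive levels,
-- so that its preservation concerns just two adjacent squares of the local rule. The coproduct
-- rule, by contrast, comes from linear independence: summed against Kostka numbers it says how
-- h_k^⊥ moves past products of the h_a, and this is again the local rule.

private variable
  A B P Q : Set

-- Indicators and finite sums

⟦_⟧ : Dec P → ℕ
⟦ d ⟧ = if does d then 1 else 0

⟦⟧-yes : (d : Dec P) → P → ⟦ d ⟧ ≡ 1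
⟦⟧-yes (yes _) _ = refl
⟦⟧-yes (no ¬p) p = ⊥-elim (¬p p)

⟦⟧-no : (d : Dec P) → ¬ P → ⟦ d ⟧ ≡ 0
⟦⟧-no (yes p) ¬p = ⊥-elim (¬p p)
⟦⟧-no (no _) _ = refl

⟦⟧-cong : (d : Dec P) (e : Dec Q) → (P → Q) → (Q → P) → ⟦ d ⟧ ≡ ⟦ e ⟧
⟦⟧-cong (yes p) e f g = sym (⟦⟧-yes e (f p))
⟦⟧-cong (no ¬p) e f g = sym (⟦⟧-no e (¬p ∘ g))

⟦⟧-× : (d : Dec P) (e : Dec Q) → ⟦ d ×-dec e ⟧ ≡ ⟦ d ⟧ * ⟦ e ⟧
⟦⟧-× (yes _) (yes _) = refl
⟦⟧-× (yes _) (no _)  = refl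
⟦⟧-× (no _)  _       = refl

⟦⟧-×-* : (d : Dec P) (e : Dec Q) (x : ℕ) → ⟦ d ×-dec e ⟧ * x ≡ ⟦ d ⟧ * (⟦ e ⟧ * x)
⟦⟧-×-* d e x = trans (cong (_* x) (⟦⟧-× d e)) (*-assoc ⟦ d ⟧ ⟦ e ⟧ x)

⟦⟧-*-cong : (d : Dec P) {x y : ℕ} → (P → x ≡ y) → ⟦ d ⟧ * x ≡ ⟦ d ⟧ * y
⟦⟧-*-cong (yes p) h = cong (1 *_) (h p)
⟦⟧-*-cong (no _)  h = refl

⟦⟧-*-mono : (d : Dec P) (e : Dec Q) {x y : ℕ} → (P → Q) → (P → x ≤ y) → ⟦ d ⟧ * x ≤ ⟦ e ⟧ * y
⟦⟧-*-mono (yes p) e {x} {y} f h rewrite ⟦⟧-yes e (f p) = *-monoʳ-≤ 1 (h p)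
⟦⟧-*-mono (no _)  e f h = z≤n

⟦⟧-*-swap : (d : Dec P) (e : Dec Q) {x y : ℕ} → (P → Q) → (Q → P) → (P → x ≡ y) → ⟦ d ⟧ * x ≡ ⟦ e ⟧ * y
⟦⟧-*-swap d e {y = y} f g h = trans (⟦⟧-*-cong d h) (cong (_* y) (⟦⟧-cong d e f g))

-- The equivalence is demanded only where x does not vanish. With an `lr` number for x, x ≢ 0
-- supplies a size equation, which trades the size condition on a strip for one that does not
-- involve the summation variable.
⟦⟧-*-split : {A B C : Set} (A? : Dec A) (B? : Dec B) (C? : Dec C) (x : ℕ) →
  (x ≢ 0 → A → B × C) → (x ≢ 0 → B × C → A) → ⟦ A? ⟧ * x ≡ ⟦ B? ⟧ * (⟦ C? ⟧ * x)
⟦⟧-*-split A? B? C? x f g with x ≟ 0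
... | no ne    = trans (cong (_* x) (⟦⟧-cong A? (B? ×-dec C?) (f ne) (g ne))) (⟦⟧-×-* B? C? x)
... | yes refl = trans (*-zeroʳ ⟦ A? ⟧)
  (sym (trans (cong (⟦ B? ⟧ *_) (*-zeroʳ ⟦ C? ⟧)) (*-zeroʳ ⟦ B? ⟧)))

*-swap : ∀ a b c → a * (b * c) ≡ b * (a * c)
*-swap = solve-∀

∑ : List A → (A → ℕ) → ℕ
∑ xs f = sum (map f xs)

infix 5 ∑
syntax ∑ xs (λ x → e) = ∑[ x ∈ xs ] e

∑-cong-All : {P : A → Set} {xs : List A} {f g : A → ℕ} →
             All P xs → (∀ x → P x → f x ≡ g x) → ∑ xs f ≡ ∑ xs g
∑-cong-All []         h = refl
∑-cong-All (px ∷ pxs) h = cong₂ _+_ (h _ px) (∑-cong-All pxs h)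

∑-cong : (xs : List A) {f g : A → ℕ} → (∀ x → f x ≡ g x) → ∑ xs f ≡ ∑ xs g
∑-cong []       h = refl
∑-cong (x ∷ xs) h = cong₂ _+_ (h x) (∑-cong xs h)

∑-mono : (xs : List A) {f g : A → ℕ} → (∀ x → f x ≤ g x) → ∑ xs f ≤ ∑ xs g
∑-mono []       h = z≤n
∑-mono (x ∷ xs) h = +-mono-≤ (h x) (∑-mono xs h)

∑-zero : (xs : List A) {f : A → ℕ} → (∀ x → f x ≡ 0) → ∑ xs f ≡ 0
∑-zero []       h = refl
∑-zero (x ∷ xs) h = cong₂ _+_ (h x) (∑-zero xs h)

∑-+ : (xs : List A) (f g : A → ℕ) → ∑ xs (λ x → f x + g x) ≡ ∑ xs f + ∑ xs g
∑-+ []       f g = refl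
∑-+ (x ∷ xs) f g = trans (cong (λ z → f x + g x + z) (∑-+ xs f g)) (rearr (f x) (g x) (∑ xs f) (∑ xs g))
  where
  rearr : ∀ a b c d → a + b + (c + d) ≡ a + c + (b + d)
  rearr = solve-∀

∑-*ˡ : (c : ℕ) (xs : List A) (f : A → ℕ) → ∑ xs (λ x → c * f x) ≡ c * ∑ xs f
∑-*ˡ c []       f = sym (*-zeroʳ c)
∑-*ˡ c (x ∷ xs) f = trans (cong (λ z → c * f x + z) (∑-*ˡ c xs f)) (sym (*-distribˡ-+ c (f x) _))

∑-*ʳ : (c : ℕ) (xs : List A) (f : A → ℕ) → ∑ xs (λ x → f x * c) ≡ ∑ xs f * c
∑-*ʳ c xs f = trans (∑-cong xs (λ x → *-comm (f x) c)) (trans (∑-*ˡ c xs f) (*-comm c _))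

∑-swap : (xs : List A) (ys : List B) (f : A → B → ℕ) →
         ∑[ x ∈ xs ] ∑[ y ∈ ys ] f x y ≡ ∑[ y ∈ ys ] ∑[ x ∈ xs ] f x y
∑-swap []       ys f = sym (∑-zero ys (λ _ → refl))
∑-swap (x ∷ xs) ys f = trans (cong (λ z → ∑ ys (f x) + z) (∑-swap xs ys f))
                             (sym (∑-+ ys (f x) (λ y → ∑[ x′ ∈ xs ] f x′ y)))

∑-++ : (xs ys : List A) (f : A → ℕ) → ∑ (xs ++ ys) f ≡ ∑ xs f + ∑ ys f
∑-++ []       ys f = refl
∑-++ (x ∷ xs) ys f = trans (cong (λ z → f x + z) (∑-++ xs ys f)) (sym (+-assoc (f x) _ _))

∑-concatMap : (F : A → List B) (xs : List A) (f : B → ℕ) →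
              ∑ (concatMap F xs) f ≡ ∑[ x ∈ xs ] ∑ (F x) f
∑-concatMap F []       f = refl
∑-concatMap F (x ∷ xs) f = trans (∑-++ (F x) _ f) (cong (λ z → ∑ (F x) f + z) (∑-concatMap F xs f))

∑-filter : (p : A → Bool) (xs : List A) (f : A → ℕ) →
           ∑ (filterᵇ p xs) f ≡ ∑[ x ∈ xs ] (if p x then 1 else 0) * f x
∑-filter p []       f = refl
∑-filter p (x ∷ xs) f with p x
... | true  = cong₂ _+_ (sym (+-identityʳ (f x))) (∑-filter p xs f)
... | false = ∑-filter p xs f

-- Mere membership would not suffice: with repetitions, a Kronecker delta summed over the list would
-- not collapse to a single term as in `∑-single`.
data Once {A : Set} (x : A) : List A → Set where
  here  : ∀ {xs} → All (x ≢_) xs → Once x (x ∷ xs)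
  there : ∀ {y xs} → x ≢ y → Once x xs → Once x (y ∷ xs)

module _ {A : Set} (_≟ᴬ_ : DecidableEquality A) where

  ∑-none : {x : A} {xs : List A} (f : A → ℕ) → All (x ≢_) xs → ∑[ y ∈ xs ] ⟦ y ≟ᴬ x ⟧ * f y ≡ 0
  ∑-none f [] = refl
  ∑-none {x} f (_∷_ {x = y} x≢y r) rewrite ⟦⟧-no (y ≟ᴬ x) (x≢y ∘ sym) = ∑-none f r

  ∑-single : {x : A} {xs : List A} (f : A → ℕ) → Once x xs → ∑[ y ∈ xs ] ⟦ y ≟ᴬ x ⟧ * f y ≡ f x
  ∑-single {x} f (here r) rewrite ⟦⟧-yes (x ≟ᴬ x) refl =
    trans (cong₂ _+_ (+-identityʳ (f x)) (∑-none f r)) (+-identityʳ (f x))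
  ∑-single {x} f (there {y} x≢y o) rewrite ⟦⟧-no (y ≟ᴬ x) (x≢y ∘ sym) = ∑-single f o

∑-term : {x : A} {xs : List A} (f : A → ℕ) → Once x xs → f x ≤ ∑ xs f
∑-term {x = x} f (here _) = m≤m+n (f x) _
∑-term f (there _ o) = ≤-trans (∑-term f o) (m≤n+m _ _)

Once-++ˡ : {x : A} {xs ys : List A} → Once x xs → All (x ≢_) ys → Once x (xs ++ ys)
Once-++ˡ (here r)    n = here (All.++⁺ r n)
Once-++ˡ (there e o) n = there e (Once-++ˡ o n)

Once-++ʳ : {x : A} {xs ys : List A} → All (x ≢_) xs → Once x ys → Once x (xs ++ ys)
Once-++ʳ []      o = o
Once-++ʳ (e ∷ r) o = there e (Once-++ʳ r o)

Once-map : {x : A} {xs : List A} (f : A → B) → (∀ {y} → f x ≡ f y → x ≡ y) →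
           Once x xs → Once (f x) (map f xs)
Once-map f inj (here r)    = here (All.map⁺ (All.map (λ ne e → ne (inj e)) r))
Once-map f inj (there e o) = there (e ∘ inj) (Once-map f inj o)

All-concatMap : {P : B → Set} (F : A → List B) {xs : List A} →
                All (λ x → All P (F x)) xs → All P (concatMap F xs)
All-concatMap F []      = []
All-concatMap F (h ∷ r) = All.++⁺ h (All-concatMap F r)

Once-concatMap : (F : A → List B) {k : A} {x : B} {ks : List A} → Once k ks → Once x (F k) →
                 (∀ {k′} → k ≢ k′ → All (x ≢_) (F k′)) → Once x (concatMap F ks)
Once-concatMap F (here r)    o d = Once-++ˡ o (All-concatMap F (All.map d r))
Once-concatMap F (there e k) o d = Once-++ʳ (d e) (Once-concatMap F k o d)

Once-upTo : ∀ {n k} → k < n → Once k (upTo n)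
Once-upTo = go (λ x → x) (λ e → e)
  where
  go : (f : ℕ → ℕ) → (∀ {i j} → f i ≡ f j → i ≡ j) → ∀ {n k} → k < n → Once (f k) (applyUpTo f n)
  go f inj {suc n} {zero}  _         = here (All.applyUpTo⁺₂ (f ∘ suc) n (λ i e → 0≢1+n (inj e)))
  go f inj {suc n} {suc k} (s≤s k<n) = there (λ e → 1+n≢0 (inj e)) (go (f ∘ suc) (suc-injective ∘ inj) k<n)

-- Sums along a partial bijection: Σ_{y ∈ ys, φ x = y} is a single term, and so is Σ_{x ∈ xs, ψ y = x}.
∑-reindex : (_≟ᴬ_ : DecidableEquality A) (_≟ᴮ_ : DecidableEquality B)
  {xs : List A} {ys : List B} {X : A → Set} {Y : B → Set} →
  All X xs → All Y ys → (∀ {x} → X x → Once x xs) → (∀ {y} → Y y → Once y ys) →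
  {P : A → Set} {Q : B → Set} (P? : ∀ x → Dec (P x)) (Q? : ∀ y → Dec (Q y))
  (φ : A → B) (ψ : B → A) {f : A → ℕ} {g : B → ℕ} →
  (∀ x → X x → P x → Y (φ x) × Q (φ x) × ψ (φ x) ≡ x × f x ≡ g (φ x)) →
  (∀ y → Y y → Q y → X (ψ y) × P (ψ y) × φ (ψ y) ≡ y) →
  ∑[ x ∈ xs ] ⟦ P? x ⟧ * f x ≡ ∑[ y ∈ ys ] ⟦ Q? y ⟧ * g y
∑-reindex _≟ᴬ_ _≟ᴮ_ {xs} {ys} allX allY onceX onceY P? Q? φ ψ {f} {g} to from = begin
  ∑[ x ∈ xs ] ⟦ P? x ⟧ * f x
    ≡⟨ ∑-cong-All allX (λ x Xx → ⟦⟧-*-cong (P? x) (λ Px → let (Yφ , _ , _ , e) = to x Xx Px in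
         trans e (sym (∑-single _≟ᴮ_ g (onceY Yφ))))) ⟩
  ∑[ x ∈ xs ] ⟦ P? x ⟧ * (∑[ y ∈ ys ] ⟦ y ≟ᴮ φ x ⟧ * g y)
    ≡⟨ ∑-cong xs (λ x → sym (∑-*ˡ ⟦ P? x ⟧ ys _)) ⟩
  ∑[ x ∈ xs ] ∑[ y ∈ ys ] ⟦ P? x ⟧ * (⟦ y ≟ᴮ φ x ⟧ * g y)
    ≡⟨ ∑-swap xs ys _ ⟩
  ∑[ y ∈ ys ] ∑[ x ∈ xs ] ⟦ P? x ⟧ * (⟦ y ≟ᴮ φ x ⟧ * g y)
    ≡⟨ ∑-cong-All allY (λ y Yy → ∑-cong-All allX (λ x Xx → both x y Xx Yy)) ⟩
  ∑[ y ∈ ys ] ∑[ x ∈ xs ] ⟦ Q? y ⟧ * (⟦ x ≟ᴬ ψ y ⟧ * g y)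
    ≡⟨ ∑-cong ys (λ y → ∑-*ˡ ⟦ Q? y ⟧ xs _) ⟩
  ∑[ y ∈ ys ] ⟦ Q? y ⟧ * (∑[ x ∈ xs ] ⟦ x ≟ᴬ ψ y ⟧ * g y)
    ≡⟨ ∑-cong-All allY (λ y Yy → ⟦⟧-*-cong (Q? y) (λ Qy →
         ∑-single _≟ᴬ_ (λ _ → g y) (onceX (proj₁ (from y Yy Qy))))) ⟩
  ∑[ y ∈ ys ] ⟦ Q? y ⟧ * g y ∎
  where
  open ≡-Reasoning
  both : ∀ x y → _ → _ → ⟦ P? x ⟧ * (⟦ y ≟ᴮ φ x ⟧ * g y) ≡ ⟦ Q? y ⟧ * (⟦ x ≟ᴬ ψ y ⟧ * g y)
  both x y Xx Yy = begin
    ⟦ P? x ⟧ * (⟦ y ≟ᴮ φ x ⟧ * g y)  ≡⟨ ⟦⟧-×-* (P? x) (y ≟ᴮ φ x) (g y) ⟨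
    ⟦ P? x ×-dec y ≟ᴮ φ x ⟧ * g y    ≡⟨ cong (_* g y) (⟦⟧-cong (P? x ×-dec y ≟ᴮ φ x) (Q? y ×-dec x ≟ᴬ ψ y)
        (λ { (Px , refl) → let (_ , q , e , _) = to x Xx Px in q , sym e })
        (λ { (Qy , refl) → let (_ , p , e) = from y Yy Qy in p , sym e })) ⟩
    ⟦ Q? y ×-dec x ≟ᴬ ψ y ⟧ * g y    ≡⟨ ⟦⟧-×-* (Q? y) (x ≟ᴬ ψ y) (g y) ⟩
    ⟦ Q? y ⟧ * (⟦ x ≟ᴬ ψ y ⟧ * g y)  ∎

-- Certificates for linear inequalities: X ≤ Y is a sum of hypotheses and s a slack.
lin-≤ : ∀ s {A B X Y} → X ≤ Y → A + Y + s ≡ B + X → A ≤ B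
lin-≤ s {A} {B} {X} {Y} h e = +-cancelʳ-≤ Y A B (begin
  A + Y      ≤⟨ m≤m+n (A + Y) s ⟩
  A + Y + s  ≡⟨ e ⟩
  B + X      ≤⟨ +-monoʳ-≤ B h ⟩
  B + Y      ∎)
  where open ≤-Reasoning

lin-≡ : ∀ {A B X Y} → X ≡ Y → A + Y ≡ B + X → A ≡ B
lin-≡ {A} {B} {X} refl e = +-cancelʳ-≡ X A B e

infixr 4 _⊕_
_⊕_ : ∀ {a b c d} → a ≤ b → c ≤ d → a + c ≤ b + d
_⊕_ = +-mono-≤

-- Horizontal strips

infix 4 _≟ᴸ_
_≟ᴸ_ : DecidableEquality (List ℕ)
_≟ᴸ_ = ≡-dec _≟_

infixl 9 _!_
-- Padding with zeros allows partitions of different lengths to be compared row by row, without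
-- cases on the lengths.
_!_ : List ℕ → ℕ → ℕ
[]       ! i     = 0
(x ∷ xs) ! zero  = x
(x ∷ xs) ! suc i = xs ! i

!-beyond : ∀ p {i} → length p ≤ i → p ! i ≡ 0
!-beyond []      _       = refl
!-beyond (x ∷ p) (s≤s h) = !-beyond p h

Interlace : List ℕ → List ℕ → Set
Interlace κ σ = ∀ i → κ ! i ≤ σ ! i × σ ! suc i ≤ κ ! i

private
  ∧⁻ : ∀ {x y} → T (x ∧ y) → T x × T y
  ∧⁻ = Equivalence.to T-∧
  ∧⁺ : ∀ {x y} → T x → T y → T (x ∧ y)
  ∧⁺ p q = Equivalence.from T-∧ (p , q)

hs-sound : ∀ b κ σ → T (hs b κ σ) → σ ! 0 ≤ b × Interlace κ σ
hs-sound b []       []       _ = z≤n , λ i → z≤n , z≤n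
hs-sound b []       (s ∷ ss) h = ≤ᵇ⇒≤ s b (proj₁ (∧⁻ h)) , λ
  { zero    → z≤n , proj₁ rec
  ; (suc i) → z≤n , proj₂ (proj₂ rec i) }
  where rec = hs-sound 0 [] ss (proj₂ (∧⁻ {s ≤ᵇ b} h))
hs-sound b (k ∷ ks) []       h = z≤n , λ
  { zero    → ≤ᵇ⇒≤ k 0 (proj₁ (∧⁻ h)) , z≤n
  ; (suc i) → proj₂ (hs-sound k ks [] (proj₂ (∧⁻ {k ≤ᵇ 0} h))) i }
hs-sound b (k ∷ ks) (s ∷ ss) h = ≤ᵇ⇒≤ s b (proj₁ (∧⁻ h₂)) , λ
  { zero    → ≤ᵇ⇒≤ k s (proj₁ (∧⁻ h)) , proj₁ rec
  ; (suc i) → proj₂ rec i }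
  where
  h₂  = proj₂ (∧⁻ {k ≤ᵇ s} h)
  rec = hs-sound k ks ss (proj₂ (∧⁻ {s ≤ᵇ b} h₂))

hs-complete : ∀ b κ σ → σ ! 0 ≤ b → Interlace κ σ → T (hs b κ σ)
hs-complete b []       []       _ _ = tt
hs-complete b []       (s ∷ ss) l h = ∧⁺ (≤⇒≤ᵇ l) (hs-complete 0 [] ss (proj₂ (h 0)) (λ i → z≤n , proj₂ (h (suc i))))
hs-complete b (k ∷ ks) []       l h = ∧⁺ (≤⇒≤ᵇ (proj₁ (h 0))) (hs-complete k ks [] z≤n (h ∘ suc))
hs-complete b (k ∷ ks) (s ∷ ss) l h =
  ∧⁺ (≤⇒≤ᵇ (proj₁ (h 0))) (∧⁺ (≤⇒≤ᵇ l) (hs-complete k ks ss (proj₂ (h 0)) (h ∘ suc)))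

hstrip-sound : ∀ κ σ → T (hstrip κ σ) → Interlace κ σ
hstrip-sound []       []       h = λ i → z≤n , z≤n
-- `hstrip` leaves the first row of σ unbounded, whereas `hs` asks for a bound; the row s itself
-- serves.
hstrip-sound []       (s ∷ ss) h = proj₂ (hs-sound s [] (s ∷ ss) (∧⁺ (≤⇒≤ᵇ {s} ≤-refl) h))
hstrip-sound (k ∷ ks) []       h = proj₂ (hs-sound 0 (k ∷ ks) [] h)
hstrip-sound (k ∷ ks) (s ∷ ss) h = λ
  { zero    → ≤ᵇ⇒≤ k s (proj₁ (∧⁻ {k ≤ᵇ s} h)) , proj₁ rec
  ; (suc i) → proj₂ rec i }
  where rec = hs-sound k ks ss (proj₂ (∧⁻ {k ≤ᵇ s} h))

hstrip-complete : ∀ κ σ → Interlace κ σ → T (hstrip κ σ)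
hstrip-complete []       []       h = tt
hstrip-complete []       (s ∷ ss) h = hs-complete 0 [] ss (proj₂ (h 0)) (λ i → z≤n , proj₂ (h (suc i)))
hstrip-complete (k ∷ ks) []       h = hs-complete 0 (k ∷ ks) [] z≤n h
hstrip-complete (k ∷ ks) (s ∷ ss) h =
  ∧⁺ (≤⇒≤ᵇ (proj₁ (h 0))) (hs-complete k ks ss (proj₂ (h 0)) (h ∘ suc))

-- A record, so that κ and σ are inferred from the type.
record Strip (κ σ : List ℕ) : Set where
  constructor strip
  field at : Interlace κ σ
open Strip public

-- Built from `T?`, so that `does (strip? κ σ)` computes to `hstrip κ σ` and `⟦ strip? κ σ ⟧` is
-- literally the weight that `∑-filter` produces from `ups` and `downs`.
strip? : ∀ κ σ → Dec (Strip κ σ)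
strip? κ σ = map′ (strip ∘ hstrip-sound κ σ) (hstrip-complete κ σ ∘ at) (T? (hstrip κ σ))

Strip-refl : ∀ {p} → (∀ i → p ! suc i ≤ p ! i) → Strip p p
Strip-refl d = strip λ i → ≤-refl , d i

-- Partitions as decreasing sequences

decreasing : ∀ {p} → IsPartition p → ∀ i → p ! suc i ≤ p ! i
decreasing {[]}        _                  i       = z≤n
decreasing {x ∷ []}    _                  i       = z≤n
decreasing {x ∷ y ∷ p} (_ , r ∷ _)        zero    = r
decreasing {x ∷ y ∷ p} (_ ∷ a , _ ∷ l) (suc i)    = decreasing {y ∷ p} (a , l) i

cons-partition : ∀ {x p} → 1 ≤ x → p ! 0 ≤ x → IsPartition p → IsPartition (x ∷ p)
cons-partition {p = []}    h _ (a , l) = h ∷ a , [-]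
cons-partition {p = y ∷ p} h r (a , l) = h ∷ a , r ∷ l

tail-partition : ∀ {x p} → IsPartition (x ∷ p) → IsPartition p
tail-partition {p = []}    _               = [] , []
tail-partition {p = y ∷ p} (_ ∷ a , _ ∷ l) = a , l

[]-partition : IsPartition []
[]-partition = [] , []

partition-ext : ∀ {p q} → IsPartition p → IsPartition q → (∀ i → p ! i ≡ q ! i) → p ≡ q
partition-ext {[]}    {[]}    _ _ e = refl
partition-ext {[]}    {y ∷ q} _ (h ∷ _ , _) e = ⊥-elim (<⇒≢ h (e 0))
partition-ext {x ∷ p} {[]}    (h ∷ _ , _) _ e = ⊥-elim (<⇒≢ h (sym (e 0)))
partition-ext {x ∷ p} {y ∷ q} P Q e =
  cong₂ _∷_ (e 0) (partition-ext (tail-partition P) (tail-partition Q) (e ∘ suc))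

sum≡0 : ∀ {p} → IsPartition p → sum p ≡ 0 → p ≡ []
sum≡0 {[]}        _           _ = refl
sum≡0 {suc x ∷ p} (h ∷ _ , _) ()

length≤sum : ∀ {p} → IsPartition p → length p ≤ sum p
length≤sum {[]}    _ = z≤n
length≤sum {x ∷ p} P@(h ∷ _ , _) = +-mono-≤ h (length≤sum (tail-partition P))

-- The list of a decreasing sequence f with f R = 0.
fromSeq : (ℕ → ℕ) → ℕ → List ℕ
fromSeq f zero = []
fromSeq f (suc R) with f 0
... | zero  = []
... | suc x = suc x ∷ fromSeq (f ∘ suc) R

module _ where
  private
    vanish : (f : ℕ → ℕ) → (∀ i → f (suc i) ≤ f i) → f 0 ≡ 0 → ∀ i → f i ≡ 0
    vanish f d e zero    = e
    vanish f d e (suc i) = n≤0⇒n≡0 (≤-trans (d i) (≤-reflexive (vanish f d e i)))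

  fromSeq-! : ∀ f R → (∀ i → f (suc i) ≤ f i) → f R ≡ 0 → ∀ i → fromSeq f R ! i ≡ f i
  fromSeq-! f zero    d e i = sym (vanish f d e i)
  fromSeq-! f (suc R) d e i with f 0 in eq
  fromSeq-! f (suc R) d e i       | zero  = sym (vanish f d eq i)
  fromSeq-! f (suc R) d e zero    | suc x = sym eq
  fromSeq-! f (suc R) d e (suc i) | suc x = fromSeq-! (f ∘ suc) R (d ∘ suc) e i

  fromSeq-partition : ∀ f R → (∀ i → f (suc i) ≤ f i) → f R ≡ 0 → IsPartition (fromSeq f R)
  fromSeq-partition f zero    d e = []-partition
  fromSeq-partition f (suc R) d e with f 0 in eq
  ... | zero  = []-partition
  ... | suc x = cons-partition (s≤s z≤n)
    (≤-trans (≤-reflexive (fromSeq-! (f ∘ suc) R (d ∘ suc) e 0)) (≤-trans (d 0) (≤-reflexive eq)))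
    (fromSeq-partition (f ∘ suc) R (d ∘ suc) e)

-- Partial sums

psum : (ℕ → ℕ) → ℕ → ℕ
psum f zero    = 0
psum f (suc j) = psum f j + f j

psum-front : ∀ f j → psum f (suc j) ≡ f 0 + psum (f ∘ suc) j
psum-front f zero    = +-comm 0 (f 0)
psum-front f (suc j) = trans (cong (_+ f (suc j)) (psum-front f j)) (+-assoc (f 0) _ _)

psum-mono : ∀ {f g} j → (∀ i → f i ≤ g i) → psum f j ≤ psum g j
psum-mono zero    h = z≤n
psum-mono (suc j) h = +-mono-≤ (psum-mono j h) (h j)

psum-cong : ∀ {f g} j → (∀ i → f i ≡ g i) → psum f j ≡ psum g j
psum-cong zero    h = refl
psum-cong (suc j) h = cong₂ _+_ (psum-cong j h) (h j)

psum-zero : ∀ j → psum (λ _ → 0) j ≡ 0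
psum-zero zero    = refl
psum-zero (suc j) = trans (+-identityʳ _) (psum-zero j)

psum-sum : ∀ p {j} → length p ≤ j → psum (p !_) j ≡ sum p
psum-sum []      {j}     _       = psum-zero j
psum-sum (x ∷ p) {suc j} (s≤s h) = trans (psum-front ((x ∷ p) !_) j) (cong (λ z → x + z) (psum-sum p h))

psum≤sum : ∀ p j → psum (p !_) j ≤ sum p
psum≤sum []      j       = ≤-reflexive (psum-zero j)
psum≤sum (x ∷ p) zero    = z≤n
psum≤sum (x ∷ p) (suc j) = ≤-trans (≤-reflexive (psum-front ((x ∷ p) !_) j)) (+-monoʳ-≤ x (psum≤sum p j))

sum-mono : ∀ p q → (∀ i → p ! i ≤ q ! i) → sum p ≤ sum q
sum-mono p q h = begin
  sum p              ≡⟨ psum-sum p (m≤m+n (length p) (length q)) ⟨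
  psum (p !_) R      ≤⟨ psum-mono R h ⟩
  psum (q !_) R      ≡⟨ psum-sum q (m≤n+m (length q) (length p)) ⟩
  sum q              ∎
  where
  open ≤-Reasoning
  R = length p + length q

Strip⇒sum≤ : ∀ {κ σ} → Strip κ σ → sum κ ≤ sum σ
Strip⇒sum≤ {κ} {σ} h = sum-mono κ σ (proj₁ ∘ at h)

-- Enumerations

parsF-sound : ∀ f n b → All (λ p → IsPartition p × sum p ≡ n × p ! 0 ≤ b) (parsF f n b)
parsF-sound f       zero    b = ([]-partition , refl , z≤n) ∷ []
parsF-sound zero    (suc n) b = []
parsF-sound (suc f) (suc n) b = All-concatMap _ (All.map⁺ (All.applyUpTo⁺₁ id _ λ {j} j< →
  All.map⁺ (All.map (λ { {p} (P , s , l) →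
      cons-partition (s≤s z≤n) l P ,
      trans (cong (λ z → suc j + z) s) (m+[n∸m]≡n (≤-trans j< (m⊓n≤n b (suc n)))) ,
      ≤-trans j< (m⊓n≤m b (suc n)) })
    (parsF-sound f (suc n ∸ suc j) (suc j)))))

parsF-complete : ∀ f b p → IsPartition p → p ! 0 ≤ b → sum p ≤ f → Once p (parsF f (sum p) b)
parsF-complete f       b []          P l h = here []
parsF-complete (suc f) b (suc k ∷ p) P l (s≤s h) = Once-concatMap _
  (Once-map suc suc-injective (Once-upTo (⊓-glb l (s≤s (m≤m+n k (sum p))))))
  (Once-map (suc k ∷_) (λ { refl → refl })
    (subst (λ s → Once p (parsF f s (suc k))) (sym (m+n∸m≡n k (sum p)))
      (parsF-complete f (suc k) p (tail-partition P) (decreasing P 0) (≤-trans (m≤n+m (sum p) k) h))))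
  (λ ne → All.map⁺ (All.universal (λ _ → λ { refl → ne refl }) _))
parsF-complete f       b (zero ∷ p) (() ∷ _ , _) l h

first≤sum : ∀ p → p ! 0 ≤ sum p
first≤sum []      = z≤n
first≤sum (x ∷ p) = m≤m+n x (sum p)

partitions-sound : ∀ n → All (λ p → IsPartition p × sum p ≡ n) (partitions n)
partitions-sound n = All.map (λ (P , s , _) → P , s) (parsF-sound n n n)

partitions-complete : ∀ {p n} → IsPartition p → sum p ≡ n → Once p (partitions n)
partitions-complete {p} P refl = parsF-complete (sum p) (sum p) p P (first≤sum p) ≤-refl

partitions≤ : ℕ → List (List ℕ)
partitions≤ M = concatMap partitions (upTo (suc M))

Bounded : ℕ → List ℕ → Set
Bounded M p = IsPartition p × sum p ≤ M

partitions≤-sound : ∀ M → All (Bounded M) (partitions≤ M)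
partitions≤-sound M = All-concatMap partitions (All.applyUpTo⁺₁ id (suc M) λ { {n} (s≤s n≤M) →
  All.map (λ { (P , refl) → P , n≤M }) (partitions-sound n) })

partitions≤-complete : ∀ {M p} → Bounded M p → Once p (partitions≤ M)
partitions≤-complete {M} {p} (P , h) = Once-concatMap partitions (Once-upTo (s≤s h)) (partitions-complete P refl)
  (λ {n} ne → All.map (λ { (_ , e) refl → ne e }) (partitions-sound n))

-- Turns the degree of a sum into a factor, so that sums over different degrees run over one common
-- list and can be interchanged.
∑-partitions : ∀ {M t} → t ≤ M → (f : List ℕ → ℕ) →
               ∑ (partitions t) f ≡ ∑[ p ∈ partitions≤ M ] ⟦ sum p ≟ t ⟧ * f p
∑-partitions {M} {t} t≤M f = sym (begin
  ∑[ p ∈ partitions≤ M ] ⟦ sum p ≟ t ⟧ * f p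
    ≡⟨ ∑-concatMap partitions (upTo (suc M)) _ ⟩
  ∑[ n ∈ upTo (suc M) ] ∑[ p ∈ partitions n ] ⟦ sum p ≟ t ⟧ * f p
    ≡⟨ ∑-cong (upTo (suc M)) (λ n → trans
         (∑-cong-All (partitions-sound n) (λ { p (_ , refl) → refl }))
         (∑-*ˡ ⟦ n ≟ t ⟧ (partitions n) f)) ⟩
  ∑[ n ∈ upTo (suc M) ] ⟦ n ≟ t ⟧ * ∑ (partitions n) f
    ≡⟨ ∑-single _≟_ (λ n → ∑ (partitions n) f) (Once-upTo (s≤s t≤M)) ⟩
  ∑ (partitions t) f ∎)
  where open ≡-Reasoning

-- Fomin's local rule

-- The corner a ⊆ b′ of a square with horizontal strips a → a′, a → b, a′ → b′, b → b′;
-- row s receives d s boxes and bumps d (s + 1) of them.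
record Square (a b a′ b′ : List ℕ) (d : ℕ → ℕ) : Set where
  field
    upper : ∀ s → b′ ! s ≡ a′ ! s ⊔ b ! s + d s
    lower : ∀ s → a ! s + d (suc s) ≡ a′ ! s ⊓ b ! s

-- Solves the equations of `Square` for the corner a: the boxes that row s + 1 gained beyond the
-- maximum were bumped out of row s. Beyond the length of a′ the minimum is 0.
meet : List ℕ → List ℕ → List ℕ → List ℕ
meet a′ b b′ = fromSeq (λ s → a′ ! s ⊓ b ! s ∸ (b′ ! suc s ∸ (a′ ! suc s ⊔ b ! suc s))) (length a′)

bump : List ℕ → List ℕ → List ℕ → ℕ → ℕ → ℕ
bump a a′ b δ zero    = δ
bump a a′ b δ (suc s) = a′ ! s ⊓ b ! s ∸ a ! s

-- Solves the equations of `Square` for the corner b′. No row lies above row 0, so the number δ of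
-- boxes inserted there is free and has to be given. The bound contains a `suc` because the last
-- nonempty row may bump into the row below it.
join : List ℕ → List ℕ → List ℕ → ℕ → List ℕ
join a a′ b δ = fromSeq (λ s → a′ ! s ⊔ b ! s + bump a a′ b δ s) (suc (length a′ + length b))

excess : List ℕ → List ℕ → List ℕ → ℕ → ℕ
excess a′ b b′ s = b′ ! s ∸ (a′ ! s ⊔ b ! s)

module _ {a′ b b′ : List ℕ} (a′b′ : Strip a′ b′) (bb′ : Strip b b′) where
  private
    d = excess a′ b b′

    ⊔≤ : ∀ s → a′ ! s ⊔ b ! s ≤ b′ ! s
    ⊔≤ s = ⊔-lub (proj₁ (at a′b′ s)) (proj₁ (at bb′ s))

    ≤⊓ : ∀ s → b′ ! suc s ≤ a′ ! s ⊓ b ! s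
    ≤⊓ s = ⊓-glb (proj₂ (at a′b′ s)) (proj₂ (at bb′ s))

    seq : ℕ → ℕ
    seq s = a′ ! s ⊓ b ! s ∸ d (suc s)

    d≤ : ∀ s → d (suc s) ≤ a′ ! s ⊓ b ! s
    d≤ s = ≤-trans (m∸n≤m (b′ ! suc s) (a′ ! suc s ⊔ b ! suc s)) (≤⊓ s)

    seq-lower : ∀ s → seq s + d (suc s) ≡ a′ ! s ⊓ b ! s
    seq-lower s = m∸n+n≡m (d≤ s)

    ⊔≤seq : ∀ s → a′ ! suc s ⊔ b ! suc s ≤ seq s
    ⊔≤seq s = +-cancelʳ-≤ (d (suc s)) _ _ (begin
      a′ ! suc s ⊔ b ! suc s + d (suc s)  ≡⟨ m+[n∸m]≡n (⊔≤ (suc s)) ⟩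
      b′ ! suc s                          ≤⟨ ≤⊓ s ⟩
      a′ ! s ⊓ b ! s                      ≡⟨ seq-lower s ⟨
      seq s + d (suc s)                   ∎)
      where open ≤-Reasoning

    seq≤ : ∀ s → seq s ≤ a′ ! s ⊓ b ! s
    seq≤ s = m∸n≤m (a′ ! s ⊓ b ! s) (d (suc s))

    seq-dec : ∀ s → seq (suc s) ≤ seq s
    seq-dec s = ≤-trans (seq≤ (suc s)) (≤-trans (m⊓n≤m⊔n _ _) (⊔≤seq s))

    seq-end : seq (length a′) ≡ 0
    seq-end = n≤0⇒n≡0 (≤-trans (seq≤ _) (≤-trans (m⊓n≤m _ _) (≤-reflexive (!-beyond a′ ≤-refl))))

    meet-! : ∀ s → meet a′ b b′ ! s ≡ seq s
    meet-! = fromSeq-! seq (length a′) seq-dec seq-end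

  meet-partition : IsPartition (meet a′ b b′)
  meet-partition = fromSeq-partition seq (length a′) seq-dec seq-end

  meet-square : Square (meet a′ b b′) b a′ b′ (excess a′ b b′)
  meet-square = record
    { upper = λ s → sym (m+[n∸m]≡n (⊔≤ s))
    ; lower = λ s → trans (cong (_+ d (suc s)) (meet-! s)) (seq-lower s) }

  meet-strip₁ : Strip (meet a′ b b′) a′
  at meet-strip₁ s rewrite meet-! s = ≤-trans (seq≤ s) (m⊓n≤m _ _) , ≤-trans (m≤m⊔n _ _) (⊔≤seq s)

  meet-strip₂ : Strip (meet a′ b b′) b
  at meet-strip₂ s rewrite meet-! s = ≤-trans (seq≤ s) (m⊓n≤n _ _) , ≤-trans (m≤n⊔m (a′ ! suc s) _) (⊔≤seq s)

module _ {a a′ b : List ℕ} (aa′ : Strip a a′) (ab : Strip a b) (δ : ℕ) where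
  private
    d = bump a a′ b δ

    seq : ℕ → ℕ
    seq s = a′ ! s ⊔ b ! s + d s

    R = suc (length a′ + length b)

    ≤⊓ : ∀ s → a ! s ≤ a′ ! s ⊓ b ! s
    ≤⊓ s = ⊓-glb (proj₁ (at aa′ s)) (proj₁ (at ab s))

    ⊔≤ : ∀ s → a′ ! suc s ⊔ b ! suc s ≤ a ! s
    ⊔≤ s = ⊔-lub (proj₂ (at aa′ s)) (proj₂ (at ab s))

    seq≤⊓ : ∀ s → seq (suc s) ≤ a′ ! s ⊓ b ! s
    seq≤⊓ s = ≤-trans (+-monoˡ-≤ (d (suc s)) (⊔≤ s)) (≤-reflexive (m+[n∸m]≡n (≤⊓ s)))

    seq-dec : ∀ s → seq (suc s) ≤ seq s
    seq-dec s = ≤-trans (seq≤⊓ s) (≤-trans (m⊓n≤m⊔n _ _) (m≤m+n _ (d s)))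

    seq-end : seq R ≡ 0
    seq-end = n≤0⇒n≡0 (≤-trans (seq≤⊓ (length a′ + length b))
      (≤-trans (m⊓n≤m _ _) (≤-reflexive (!-beyond a′ (m≤m+n _ _)))))

    join-! : ∀ s → join a a′ b δ ! s ≡ seq s
    join-! = fromSeq-! seq R seq-dec seq-end

  join-partition : IsPartition (join a a′ b δ)
  join-partition = fromSeq-partition seq R seq-dec seq-end

  join-square : Square a b a′ (join a a′ b δ) (bump a a′ b δ)
  join-square = record { upper = join-! ; lower = λ s → m+[n∸m]≡n (≤⊓ s) }

  join-strip₁ : Strip a′ (join a a′ b δ)
  at join-strip₁ s rewrite join-! s | join-! (suc s) =
    ≤-trans (m≤m⊔n _ _) (m≤m+n _ (d s)) , ≤-trans (seq≤⊓ s) (m⊓n≤m _ _)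

  join-strip₂ : Strip b (join a a′ b δ)
  at join-strip₂ s rewrite join-! s | join-! (suc s) =
    ≤-trans (m≤n⊔m (a′ ! s) _) (m≤m+n _ (d s)) , ≤-trans (seq≤⊓ s) (m⊓n≤n _ _)

module _ {a b a′ b′ : List ℕ} {d : ℕ → ℕ} (□ : Square a b a′ b′ d) where
  open Square □

  -- Either of the corners a and b′, apart from `d 0` in the case of a, determines d; hence `meet`
  -- and `join` are inverse to each other.
  square-excess : ∀ s → excess a′ b b′ s ≡ d s
  square-excess s rewrite upper s = m+n∸m≡n (a′ ! s ⊔ b ! s) (d s)

  square-bump : ∀ s → bump a a′ b (d 0) s ≡ d s
  square-bump zero    = refl
  square-bump (suc s) rewrite sym (lower s) = m+n∸m≡n (a ! s) (d (suc s))

  -- Since maximum and minimum add up to the sum, the equations of `Square` telescope: boxes bumped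
  -- out of one row enter the next, and after j rows only the `d 0` inserted and the `d j` passed on
  -- remain.
  square-psum : ∀ j → psum (b′ !_) j + psum (a !_) j + d j ≡ d 0 + psum (a′ !_) j + psum (b !_) j
  square-psum zero    = refl′ (d 0)
    where
    refl′ : ∀ x → x ≡ x + 0 + 0
    refl′ = solve-∀
  square-psum (suc j) = lin-≡ (cong₂ _+_ (square-psum j) (cong₂ _+_ (cong₂ _+_ (upper j) (lower j))
                                          (⊓+⊔ (a′ ! j) (b ! j))))
    (arith (psum (b′ !_) j) (b′ ! j) (psum (a !_) j) (a ! j) (d (suc j)) (d 0) (psum (a′ !_) j) (a′ ! j)
           (psum (b !_) j) (b ! j) (d j) (a′ ! j ⊔ b ! j) (a′ ! j ⊓ b ! j))
    where
    ⊓+⊔ : ∀ m n → m ⊓ n + (m ⊔ n) ≡ m + n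
    ⊓+⊔ m n with ≤-total m n
    ... | inj₁ h rewrite m≤n⇒m⊔n≡n h | m≤n⇒m⊓n≡m h = refl
    ... | inj₂ h rewrite m≥n⇒m⊔n≡m h | m≥n⇒m⊓n≡n h = +-comm n m
    arith : ∀ B′ b′ A a e d₀ A′ a′ B b d x y →
      B′ + b′ + (A + a) + e + (d₀ + A′ + B + (x + d + y + (a′ + b))) ≡
      d₀ + (A′ + a′) + (B + b) + (B′ + A + d + (b′ + (a + e) + (y + x)))
    arith = solve-∀

  square-sum : sum b′ + sum a ≡ d 0 + sum a′ + sum b
  square-sum = begin
    sum b′ + sum a                              ≡⟨ +-identityʳ _ ⟨
    sum b′ + sum a + 0                          ≡⟨ cong₂ _+_ (cong₂ _+_ (psum-sum b′ ≤b′) (psum-sum a ≤a)) d≡0 ⟨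
    psum (b′ !_) R + psum (a !_) R + d R        ≡⟨ square-psum R ⟩
    d 0 + psum (a′ !_) R + psum (b !_) R        ≡⟨ cong₂ _+_ (cong (λ z → d 0 + z) (psum-sum a′ ≤a′)) (psum-sum b ≤b) ⟩
    d 0 + sum a′ + sum b                        ∎
    where
    open ≡-Reasoning
    R = length a + length b + length a′ + length b′
    ≤b′ = m≤n+m (length b′) (length a + length b + length a′)
    ≤a′ = ≤-trans (m≤n+m (length a′) (length a + length b)) (m≤m+n _ (length b′))
    ≤b  = ≤-trans (m≤n+m (length b) (length a)) (≤-trans (m≤m+n _ (length a′)) (m≤m+n _ (length b′)))
    ≤a  = ≤-trans (m≤m+n (length a) (length b)) (≤-trans (m≤m+n _ (length a′)) (m≤m+n _ (length b′)))
    d≡0 : d R ≡ 0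
    d≡0 = m+n≡0⇒n≡0 (a′ ! R ⊔ b ! R) (trans (sym (upper R)) (!-beyond b′ ≤b′))

meet-join : ∀ {a a′ b} → IsPartition a → Strip a a′ → Strip a b → ∀ δ → meet a′ b (join a a′ b δ) ≡ a
meet-join {a} {a′} {b} aP aa′ ab δ =
  partition-ext (meet-partition j₁ j₂) aP λ s → +-cancelʳ-≡ (d (suc s)) _ _ (begin
    meet a′ b b′ ! s + d (suc s)                  ≡⟨ cong (λ z → meet a′ b b′ ! s + z) (square-excess □ (suc s)) ⟨
    meet a′ b b′ ! s + excess a′ b b′ (suc s)     ≡⟨ Square.lower (meet-square j₁ j₂) s ⟩
    a′ ! s ⊓ b ! s                                ≡⟨ Square.lower □ s ⟨
    a ! s + d (suc s)                             ∎)
  where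
  open ≡-Reasoning
  b′ = join a a′ b δ
  d  = bump a a′ b δ
  □  = join-square aa′ ab δ
  j₁ = join-strip₁ aa′ ab δ
  j₂ = join-strip₂ aa′ ab δ

join-meet : ∀ {a′ b b′} → IsPartition b′ → Strip a′ b′ → Strip b b′ →
            join (meet a′ b b′) a′ b (excess a′ b b′ 0) ≡ b′
join-meet {a′} {b} {b′} b′P a′b′ bb′ =
  partition-ext (join-partition m₁ m₂ δ) b′P λ s → begin
    join a a′ b δ ! s                      ≡⟨ Square.upper (join-square m₁ m₂ δ) s ⟩
    a′ ! s ⊔ b ! s + bump a a′ b δ s       ≡⟨ cong (λ z → a′ ! s ⊔ b ! s + z) (square-bump (meet-square a′b′ bb′) s) ⟩
    a′ ! s ⊔ b ! s + excess a′ b b′ s      ≡⟨ Square.upper (meet-square a′b′ bb′) s ⟨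
    b′ ! s                                 ∎
  where
  open ≡-Reasoning
  a  = meet a′ b b′
  δ  = excess a′ b b′ 0
  m₁ = meet-strip₁ a′b′ bb′
  m₂ = meet-strip₂ a′b′ bb′

∑-unique : {A : Set} (_≟ᴬ_ : DecidableEquality A) {xs : List A} {P : A → Set} (P? : ∀ x → Dec (P x))
           (x₀ : A) {f : A → ℕ} → (∀ x → P x → x ≡ x₀) → (P x₀ → Once x₀ xs) →
           ∑[ x ∈ xs ] ⟦ P? x ⟧ * f x ≡ ⟦ P? x₀ ⟧ * f x₀
∑-unique _≟ᴬ_ {xs} P? x₀ {f} uniq once with P? x₀
... | no ¬p = ∑-zero xs λ x → cong (_* f x) (⟦⟧-no (P? x) λ p → ¬p (subst _ (uniq x p) p))
... | yes p = trans
  (∑-cong xs λ x → cong (_* f x) (⟦⟧-cong (P? x) (x ≟ᴬ x₀) (uniq x) (λ { refl → p })))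
  (trans (∑-single _≟ᴬ_ f (once p)) (sym (*-identityˡ (f x₀))))

-- Littlewood–Richardson patterns

infix 8 _∥_
_∥_ : List ℕ → ℕ → ℕ
p ∥ j = psum (p !_) j

-- For levels a ⊆ b ⊆ c (entries ≤ i − 1, ≤ i, ≤ i + 1) of a tableau: reading rows from the top down,
-- l′ + #(i + 1) never exceeds l + #i.
record Good (l′ l : ℕ) (a b c : List ℕ) : Set where
  constructor good
  field bound : ∀ j → l′ + (c ∥ suc j + a ∥ j) ≤ l + (b ∥ suc j + b ∥ j)
open Good

-- Beyond the lengths of the three partitions all partial sums are constant, so finitely many j
-- decide.
good? : ∀ l′ l a b c → Dec (Good l′ l a b c)
good? l′ l a b c = map′ (λ (h : Initial) → good (extend h)) (λ g {j} _ → bound g j)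
  (allUpTo? (λ j → l′ + (c ∥ suc j + a ∥ j) ≤? l + (b ∥ suc j + b ∥ j)) (suc R))
  where
  R = length a + length b + length c
  ≤a = ≤-trans (m≤m+n (length a) (length b)) (m≤m+n _ (length c))
  ≤b = ≤-trans (m≤n+m (length b) (length a)) (m≤m+n _ (length c))
  ≤c = m≤n+m (length c) (length a + length b)
  Initial : Set
  Initial = ∀ {j} → j < suc R → l′ + (c ∥ suc j + a ∥ j) ≤ l + (b ∥ suc j + b ∥ j)
  extend : Initial → ∀ j → l′ + (c ∥ suc j + a ∥ j) ≤ l + (b ∥ suc j + b ∥ j)
  extend h j with j ≤? R
  ... | yes j≤R = h (s≤s j≤R)
  ... | no  j≰R = subst₂ (λ x y → l′ + x ≤ l + y)
    (cong₂ _+_ (settled c (m≤n⇒m≤1+n ≤c) (m≤n⇒m≤1+n (≤-trans ≤c R≤j))) (settled a ≤a (≤-trans ≤a R≤j)))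
    (cong₂ _+_ (settled b (m≤n⇒m≤1+n ≤b) (m≤n⇒m≤1+n (≤-trans ≤b R≤j))) (settled b ≤b (≤-trans ≤b R≤j)))
    (h ≤-refl)
    where
    R≤j = ≰⇒≥ j≰R
    settled : ∀ p {m n} → length p ≤ m → length p ≤ n → p ∥ m ≡ p ∥ n
    settled p h₁ h₂ = trans (psum-sum p h₁) (sym (psum-sum p h₂))

-- Insertion transforms the largest excess of (i + 1)'s over i's like concatenation of words does.
module _ {a b c a′ b′ c′ : List ℕ} {d e : ℕ → ℕ}
         (□₁ : Square a b a′ b′ d) (□₂ : Square b c b′ c′ e) (l′ l : ℕ) where
  private
    module S = Square □₁
    module T = Square □₂
    -- `Good` before insertion compares x with y, after insertion u with v. Thus x j - y j is the
    -- number of letters i + 1 in rows 0 to j minus the number of letters i in rows 0 to j - 1: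
    -- within a row the larger letter is read first.
    x y u v : ℕ → ℕ
    x j = c ∥ suc j + a ∥ j
    y j = b ∥ suc j + b ∥ j
    u j = c′ ∥ suc j + a′ ∥ j
    v j = b′ ∥ suc j + b′ ∥ j

    balance : ∀ j → u j + (y j + d 0 + e (suc j)) ≡ v j + (x j + e 0 + d j)
    balance j = lin-≡ (cong₂ _+_ (square-psum □₂ (suc j)) (sym (square-psum □₁ j)))
      (arith (c′ ∥ suc j) (a′ ∥ j) (b ∥ suc j) (b ∥ j) (d 0) (e (suc j))
             (b′ ∥ suc j) (b′ ∥ j) (c ∥ suc j) (a ∥ j) (e 0) (d j))
      where
      arith : ∀ C′ A′ B₁ B d₀ e₁ B₁′ B′ C A e₀ d →
        C′ + A′ + (B₁ + B + d₀ + e₁) + (e₀ + B₁′ + C + (B′ + A + d)) ≡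
        B₁′ + B′ + (C + A + e₀ + d) + (C′ + B₁ + e₁ + (d₀ + A′ + B))
      arith = solve-∀

    bumped₁ : ∀ s → a ! s + d (suc s) ≤ b ! s
    bumped₁ s = ≤-trans (≤-reflexive (S.lower s)) (m⊓n≤n _ _)

    bumped₂ : ∀ s → b ! s + e (suc s) ≤ c ! s
    bumped₂ s = ≤-trans (≤-reflexive (T.lower s)) (m⊓n≤n _ _)

    -- Fewer letters are bumped out than b′ could account for, so the minimum in `lower` must be c:
    -- row s of c beyond b is bumped entirely.
    small : ∀ s → e (suc s) < d s → c ! s ≤ b ! s + e (suc s)
    small s h with ≤-total (b′ ! s) (c ! s)
    ... | inj₂ q = ≤-reflexive (sym (trans (T.lower s) (m≥n⇒m⊓n≡n q)))
    ... | inj₁ q = ⊥-elim (<⇒≱ (+-monoʳ-< (b ! s) h) (begin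
      b ! s + d s                 ≤⟨ +-monoˡ-≤ (d s) (m≤n⊔m (a′ ! s) (b ! s)) ⟩
      a′ ! s ⊔ b ! s + d s        ≡⟨ S.upper s ⟨
      b′ ! s                      ≡⟨ m≤n⇒m⊓n≡m q ⟨
      b′ ! s ⊓ c ! s              ≡⟨ T.lower s ⟨
      b ! s + e (suc s)           ∎))
      where open ≤-Reasoning

    -- More is bumped out than the d s newly inserted boxes allow, so b′ exceeds b + d in row s; the
    -- maximum in `upper` is then a′, and b is the minimum in `lower`.
    large : ∀ s → d s < e (suc s) → b ! s ≤ a ! s + d (suc s)
    large s h with ≤-total (a′ ! s) (b ! s)
    ... | inj₂ q = ≤-reflexive (sym (trans (S.lower s) (m≥n⇒m⊓n≡n q)))
    ... | inj₁ q = ⊥-elim (<⇒≱ (+-monoʳ-< (b ! s) h) (begin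
      b ! s + e (suc s)           ≡⟨ T.lower s ⟩
      b′ ! s ⊓ c ! s              ≤⟨ m⊓n≤m _ _ ⟩
      b′ ! s                      ≡⟨ S.upper s ⟩
      a′ ! s ⊔ b ! s + d s        ≡⟨ cong (_+ d s) (m≤n⇒m⊔n≡n q) ⟩
      b ! s + d s                 ∎))
      where open ≤-Reasoning

  -- Where d j ≤ e (j + 1), `balance` carries the old inequality at j to the new one. Otherwise
  -- `small` applies, and the new inequality at j follows from the old one at j - 1, or for j = 0
  -- from the condition that the rows l and l′ gain a horizontal strip.
  good-insert : l′ + e 0 ≤ l → Good (l′ + e 0) (l + d 0) a b c → Good l′ l a′ b′ c′
  good-insert h₀ g = good λ j → step j (<-≤-connex (e (suc j)) (d j))
    where
    same : ∀ j → d j ≤ e (suc j) → l′ + u j ≤ l + v j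
    same j h = lin-≤ 0 (bound g j ⊕ ≤-reflexive (balance j) ⊕ h)
      (arith l′ l (u j) (v j) (x j) (y j) (d 0) (e 0) (d j) (e (suc j)))
      where
      arith : ∀ l′ l u v x y d₀ e₀ d e →
        l′ + u + (l + d₀ + y + (v + (x + e₀ + d) + e)) + 0 ≡
        l + v + (l′ + e₀ + x + (u + (y + d₀ + e) + d))
      arith = solve-∀
    step : ∀ j → e (suc j) < d j ⊎ d j ≤ e (suc j) → l′ + u j ≤ l + v j
    step j       (inj₂ h) = same j h
    step zero    (inj₁ h) = lin-≤ 0 (h₀ ⊕ ≤-reflexive (balance 0) ⊕ small 0 h)
      (arith l′ l (u 0) (v 0) (c ! 0) (b ! 0) (d 0) (e 0) (e 1))
      where
      arith : ∀ l′ l u v c b d₀ e₀ e →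
        l′ + u + (l + (v + (c + 0 + e₀ + d₀) + (b + e))) + 0 ≡
        l + v + (l′ + e₀ + (u + (b + 0 + d₀ + e) + c))
      arith = solve-∀
    step (suc k) (inj₁ h) = lin-≤ 0
      (bound g k ⊕ ≤-reflexive (balance (suc k)) ⊕ small (suc k) h ⊕ bumped₁ k)
      (arith l′ l (u (suc k)) (v (suc k)) (c ∥ suc k) (a ∥ k) (b ∥ k)
        (c ! suc k) (a ! k) (b ! suc k) (b ! k) (d 0) (e 0) (d (suc k)) (e (suc (suc k))))
      where
      arith : ∀ l′ l u v C A B c a b₁ b d₀ e₀ d e →
        l′ + u + (l + d₀ + (B + b + B) + (v + (C + c + (A + a) + e₀ + d) + (b₁ + e + b))) + 0 ≡
        l + v + (l′ + e₀ + (C + A) + (u + (B + b + b₁ + (B + b) + d₀ + e) + (c + (a + d))))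
      arith = solve-∀

  -- The mirror image: the old inequality at j comes from the new one at j, or by `large` from the
  -- new one at j + 1. The strip condition is the new inequality at 0, because the letters bumped
  -- out of row 0 fit into c.
  good-extract : Good l′ l a′ b′ c′ → l′ + e 0 ≤ l × Good (l′ + e 0) (l + d 0) a b c
  good-extract g = first , good λ j → step j (<-≤-connex (d j) (e (suc j)))
    where
    first : l′ + e 0 ≤ l
    first = lin-≤ 0 (bound g 0 ⊕ ≤-reflexive (sym (balance 0)) ⊕ bumped₂ 0)
      (arith l′ l (u 0) (v 0) (c ! 0) (b ! 0) (d 0) (e 0) (e 1))
      where
      arith : ∀ l′ l u v c b d₀ e₀ e →
        l′ + e₀ + (l + v + (u + (b + 0 + d₀ + e) + c)) + 0 ≡
        l + (l′ + u + (v + (c + 0 + e₀ + d₀) + (b + e)))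
      arith = solve-∀
    step : ∀ j → d j < e (suc j) ⊎ e (suc j) ≤ d j → l′ + e 0 + x j ≤ l + d 0 + y j
    step j (inj₂ h) = lin-≤ 0 (bound g j ⊕ ≤-reflexive (sym (balance j)) ⊕ h)
      (arith l′ l (u j) (v j) (x j) (y j) (d 0) (e 0) (d j) (e (suc j)))
      where
      arith : ∀ l′ l u v x y d₀ e₀ d e →
        l′ + e₀ + x + (l + v + (u + (y + d₀ + e) + d)) + 0 ≡
        l + d₀ + y + (l′ + u + (v + (x + e₀ + d) + e))
      arith = solve-∀
    step j (inj₁ h) = lin-≤ 0
      (bound g (suc j) ⊕ ≤-reflexive (sym (balance (suc j))) ⊕ large j h ⊕ bumped₂ (suc j))
      (arith l′ l (u (suc j)) (v (suc j)) (c ∥ suc j) (a ∥ j) (b ∥ j)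
        (c ! suc j) (a ! j) (b ! suc j) (b ! j) (d 0) (e 0) (d (suc j)) (e (suc (suc j))))
      where
      arith : ∀ l′ l u v C A B c a b₁ b d₀ e₀ d e →
        l′ + e₀ + (C + A) + (l + v + (u + (B + b + b₁ + (B + b) + d₀ + e) + (a + d + c))) + 0 ≡
        l + d₀ + (B + b + B) + (l′ + u + (v + (C + c + (A + a) + e₀ + d) + (b + (b₁ + e))))
      arith = solve-∀

-- Sums over patterns, and row insertion

module Patterns (M : ℕ) (ν : List ℕ) where

  𝒫 = partitions≤ M

  -- The rows λ₀, …, λᵢ₋₁ are kept in reverse order; the row before λ₀ counts as M.
  previous : List ℕ → ℕ
  previous []       = M
  previous (s ∷ ss) = s

  -- The size equation says that the letter i + 1 occurs ν ! i - s times, so that row i grows from s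
  -- to exactly ν ! i.
  Step : ℕ → ℕ → ℕ → List ℕ → List ℕ → List ℕ → Set
  Step i s s₋ a b c = Strip b c × sum c + s ≡ sum b + ν ! i × Good s s₋ a b c

  step? : ∀ i s s₋ a b c → Dec (Step i s s₋ a b c)
  step? i s s₋ a b c = strip? b c ×-dec sum c + s ≟ sum b + ν ! i ×-dec good? s s₋ a b c

  -- Sum of F over the last two levels of all Gelfand–Tsetlin patterns that, acting on the rows ss,
  -- stay a partition at each stage and end at the first rows of ν.
  patterns : List ℕ → (List ℕ → List ℕ → ℕ) → ℕ
  patterns []       F = F [] []
  patterns (s ∷ ss) F = patterns ss λ a b →
    ∑[ c ∈ 𝒫 ] ⟦ step? (length ss) s (previous ss) a b c ⟧ * F b c

  record Levels (ss a b : List ℕ) : Set where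
    field
      bounded₁ : Bounded M a
      bounded₂ : Bounded M b
      strip₁₂  : Strip a b
      size     : sum b + sum ss ≡ psum (ν !_) (length ss)

  step-size : ∀ ss b c s → sum b + sum ss ≡ psum (ν !_) (length ss) →
              sum c + s ≡ sum b + ν ! length ss → sum c + (s + sum ss) ≡ psum (ν !_) (suc (length ss))
  step-size ss b c s h e = lin-≡ (cong₂ _+_ h e)
    (arith (sum b) (sum ss) (sum c) s (ν ! length ss) (psum (ν !_) (length ss)))
    where
    arith : ∀ b S c s n N → c + (s + S) + (N + (b + n)) ≡ N + n + (b + S + (c + s))
    arith = solve-∀

  patterns-cong : ∀ ss {F G} → (∀ a b → Levels ss a b → F a b ≡ G a b) → patterns ss F ≡ patterns ss G
  patterns-cong []       h = h [] [] (record
    { bounded₁ = []-partition , z≤n ; bounded₂ = []-partition , z≤n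
    ; strip₁₂ = strip (λ i → z≤n , z≤n) ; size = refl })
  patterns-cong (s ∷ ss) h = patterns-cong ss λ a b L → let open Levels L in
    ∑-cong-All (partitions≤-sound M) λ c c≤ → ⟦⟧-*-cong (step? (length ss) s (previous ss) a b c)
      λ (bc , e , _) → h b c (record
        { bounded₁ = bounded₂ ; bounded₂ = c≤ ; strip₁₂ = bc ; size = step-size ss b c s size e })

  patterns-∑ : ∀ {A : Set} ss (ys : List A) (F : A → List ℕ → List ℕ → ℕ) →
               patterns ss (λ a b → ∑[ y ∈ ys ] F y a b) ≡ ∑[ y ∈ ys ] patterns ss (F y)
  patterns-∑ []       ys F = refl
  patterns-∑ (s ∷ ss) ys F = trans
    (patterns-cong ss λ a b _ → trans
      (∑-cong 𝒫 λ c → sym (∑-*ˡ ⟦ step? (length ss) s (previous ss) a b c ⟧ ys (λ y → F y b c)))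
      (∑-swap 𝒫 ys _))
    (patterns-∑ ss ys _)

  patterns-* : ∀ ss k (F : List ℕ → List ℕ → ℕ) → patterns ss (λ a b → k * F a b) ≡ k * patterns ss F
  patterns-* []       k F = refl
  patterns-* (s ∷ ss) k F = trans
    (patterns-cong ss λ a b _ → trans
      (∑-cong 𝒫 λ c → *-swap ⟦ step? (length ss) s (previous ss) a b c ⟧ k (F b c))
      (∑-*ˡ k 𝒫 _))
    (patterns-* ss k _)

  patterns-size : ∀ ss {F} → (∀ a b → sum b + sum ss ≡ psum (ν !_) (length ss) → F a b ≡ 0) → patterns ss F ≡ 0
  patterns-size ss {F} h = trans
    (patterns-cong ss {G = λ a b → 0 * F a b} (λ a b L → h a b (Levels.size L)))
    (patterns-* ss 0 F)

  rows : List ℕ → ℕ → List ℕ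
  rows p zero    = []
  rows p (suc i) = p ! i ∷ rows p i

  length-rows : ∀ p i → length (rows p i) ≡ i
  length-rows p zero    = refl
  length-rows p (suc i) = cong suc (length-rows p i)

  sum-rows : ∀ p i → sum (rows p i) ≡ psum (p !_) i
  sum-rows p zero    = refl
  sum-rows p (suc i) = trans (+-comm (p ! i) _) (cong (_+ p ! i) (sum-rows p i))

  previous-rows≤ : ∀ {p} → sum p ≤ M → ∀ i → previous (rows p i) ≤ M
  previous-rows≤         h zero    = ≤-refl
  previous-rows≤ {p}     h (suc i) = ≤-trans (!≤sum p i) h
    where
    !≤sum : ∀ p i → p ! i ≤ sum p
    !≤sum []      i       = z≤n
    !≤sum (x ∷ p) zero    = m≤m+n x (sum p)
    !≤sum (x ∷ p) (suc i) = ≤-trans (!≤sum p i) (m≤n+m (sum p) x)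

  vecs : ℕ → List (List ℕ)
  vecs zero    = [] ∷ []
  vecs (suc i) = concatMap (λ ss → map (_∷ ss) (upTo (suc M))) (vecs i)

  ∑-vecs : ∀ i f → ∑ (vecs (suc i)) f ≡ ∑[ ss ∈ vecs i ] ∑[ s ∈ upTo (suc M) ] f (s ∷ ss)
  ∑-vecs i f = trans (∑-concatMap _ (vecs i) f)
    (∑-cong (vecs i) λ ss → cong sum (sym (map-∘ (upTo (suc M)))))

  Vector : ℕ → List ℕ → Set
  Vector i ss = length ss ≡ i × All (_≤ M) ss

  vecs-sound : ∀ i → All (Vector i) (vecs i)
  vecs-sound zero    = (refl , []) ∷ []
  vecs-sound (suc i) = All-concatMap _ (All.map (λ (l , a) → All.map⁺ (All.applyUpTo⁺₁ id _ λ { (s≤s h) →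
    cong suc l , h ∷ a })) (vecs-sound i))

  vecs-complete : ∀ {i ss} → Vector i ss → Once ss (vecs i)
  vecs-complete {zero}  {[]}     _ = here []
  vecs-complete {suc i} {s ∷ ss} (l , h ∷ a) = Once-concatMap _ (vecs-complete (suc-injective l , a))
    (Once-map (_∷ ss) (λ { refl → refl }) (Once-upTo (s≤s h)))
    (λ ne → All.map⁺ (All.universal (λ _ → λ { refl → ne refl }) _))

  RowBounds : List ℕ → ℕ → ℕ → Set
  RowBounds λ′ i s = λ′ ! i ≤ s × s ≤ previous (rows λ′ i)

  rowBounds? : ∀ λ′ i s → Dec (RowBounds λ′ i s)
  rowBounds? λ′ i s = λ′ ! i ≤? s ×-dec s ≤? previous (rows λ′ i)

  RowStrip : List ℕ → List ℕ → Set
  RowStrip λ′ []       = ⊤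
  RowStrip λ′ (s ∷ ss) = RowBounds λ′ (length ss) s × RowStrip λ′ ss

  rowStrip? : ∀ λ′ ss → Dec (RowStrip λ′ ss)
  rowStrip? λ′ []       = yes tt
  rowStrip? λ′ (s ∷ ss) = rowBounds? λ′ (length ss) s ×-dec rowStrip? λ′ ss

  module _ {λ′ : List ℕ} (λ≤ : sum λ′ ≤ M) (ν≤ : sum ν ≤ M) where

    -- The bijection (b , s) ↔ c′ of a single step, for fixed a′, b′ and c.
    module _ (i : ℕ) {a′ b′ c : List ℕ} (L : Levels (rows λ′ i) a′ b′) (c≤ : Bounded M c) where
      open Levels L
      private
        l′ = λ′ ! i
        l  = previous (rows λ′ i)

        -- Once b and c are fixed, the size equation of `Step` leaves this as the only candidate for
        -- the row s.
        s₀ : List ℕ → ℕ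
        s₀ b = sum b + ν ! i ∸ sum c

        Before : List ℕ → Set
        Before b = Strip b b′ × RowBounds λ′ i (s₀ b) ×
                   Step i (s₀ b) (l + excess a′ b b′ 0) (meet a′ b b′) b c

        After : List ℕ → Set
        After c′ = Step i l′ l a′ b′ c′ × Strip c c′

        before? : ∀ b → Dec (Before b)
        before? b = strip? b b′ ×-dec rowBounds? λ′ i (s₀ b) ×-dec
                    step? i (s₀ b) (l + excess a′ b b′ 0) (meet a′ b b′) b c

        after? : ∀ c′ → Dec (After c′)
        after? c′ = step? i l′ l a′ b′ c′ ×-dec strip? c c′

        φ : List ℕ → List ℕ
        φ b = join b b′ c (s₀ b ∸ l′)

        ψ : List ℕ → List ℕ
        ψ c′ = meet b′ c c′

      step-reindex : (F : ℕ → List ℕ → List ℕ → ℕ) →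
        ∑[ b ∈ 𝒫 ] ⟦ before? b ⟧ * F (s₀ b) b c ≡
        ∑[ c′ ∈ 𝒫 ] ⟦ after? c′ ⟧ * F (l′ + excess b′ c c′ 0) (meet b′ c c′) c
      step-reindex F = ∑-reindex _≟ᴸ_ _≟ᴸ_ (partitions≤-sound M) (partitions≤-sound M)
        partitions≤-complete partitions≤-complete before? after? φ ψ to from
        where
        to : ∀ b → Bounded M b → Before b →
             Bounded M (φ b) × After (φ b) × ψ (φ b) ≡ b ×
             F (s₀ b) b c ≡ F (l′ + excess b′ c (φ b) 0) (meet b′ c (φ b)) c
        to b (bP , _) (bb′ , (l′≤s , s≤l) , bc , e , g) =
          (join-partition bb′ bc δ , bounded) ,
          ((join-strip₁ bb′ bc δ , size′ , good-insert □₁ □₂ l′ l (subst (_≤ l) (sym s≡) s≤l)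
              (subst (λ s → Good s (l + excess a′ b b′ 0) (meet a′ b b′) b c) (sym s≡) g)) ,
            join-strip₂ bb′ bc δ) ,
          meet-join bP bb′ bc δ ,
          sym (cong₂ (λ s p → F s p c)
            (trans (cong (λ z → l′ + z) (square-excess □₂ 0)) s≡) (meet-join bP bb′ bc δ))
          where
          δ  = s₀ b ∸ l′
          s≡ : l′ + δ ≡ s₀ b
          s≡ = m+[n∸m]≡n l′≤s
          □₁ = meet-square strip₁₂ bb′
          □₂ = join-square bb′ bc δ
          size′ : sum (φ b) + l′ ≡ sum b′ + ν ! i
          size′ = lin-≡ (cong₂ _+_ (square-sum □₂) (cong₂ _+_ e s≡))
            (arith (sum (φ b)) l′ δ (sum b) (sum c) (s₀ b) (sum b′) (ν ! i))
            where
            arith : ∀ c′ l′ δ b c s b′ n →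
              c′ + l′ + (δ + b′ + c + (b + n + s)) ≡ b′ + n + (c′ + b + (c + s + (l′ + δ)))
            arith = solve-∀
          -- The new level must stay in `𝒫`: together with the rows of λ′ it adds up to a partial
          -- sum of ν.
          bounded : sum (φ b) ≤ M
          bounded = begin
            sum (φ b)                                        ≤⟨ m≤m+n _ _ ⟩
            sum (φ b) + (l′ + sum (rows λ′ i))               ≡⟨ step-size (rows λ′ i) b′ (φ b) l′ size
              (trans size′ (cong (λ k → sum b′ + ν ! k) (sym (length-rows λ′ i)))) ⟩
            psum (ν !_) (suc (length (rows λ′ i)))           ≤⟨ psum≤sum ν _ ⟩
            sum ν                                            ≤⟨ ν≤ ⟩
            M                                                ∎
            where open ≤-Reasoning
        from : ∀ c′ → Bounded M c′ → After c′ → Bounded M (ψ c′) × Before (ψ c′) × φ (ψ c′) ≡ c′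
        from c′ (c′P , _) ((b′c′ , e , g) , cc′) =
          (meet-partition b′c′ cc′ , ≤-trans (Strip⇒sum≤ bb′) (proj₂ bounded₂)) ,
          (bb′ , (≤-trans (m≤m+n l′ δ) (≤-reflexive s≡) , subst (_≤ l) s≡ (proj₁ ext)) ,
            (bc , trans (cong (λ z → sum c + z) (sym s≡)) size′ ,
             subst (λ s → Good s (l + excess a′ b b′ 0) (meet a′ b b′) b c) s≡ (proj₂ ext))) ,
          trans (cong (join b b′ c) (trans (cong (_∸ l′) (sym s≡)) (m+n∸m≡n l′ δ))) (join-meet c′P b′c′ cc′)
          where
          b   = meet b′ c c′
          δ   = excess b′ c c′ 0
          bb′ = meet-strip₁ b′c′ cc′
          bc  = meet-strip₂ b′c′ cc′
          □₁  = meet-square strip₁₂ bb′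
          □₂  = meet-square b′c′ cc′
          ext = good-extract □₁ □₂ l′ l g
          size′ : sum c + (l′ + δ) ≡ sum b + ν ! i
          size′ = lin-≡ (cong₂ _+_ (sym (square-sum □₂)) e)
            (arith (sum c′) l′ δ (sum b) (sum c) (sum b′) (ν ! i))
            where
            arith : ∀ c′ l′ δ b c b′ n →
              c + (l′ + δ) + (c′ + b + (b′ + n)) ≡ b + n + (δ + b′ + c + (c′ + l′))
            arith = solve-∀
          s≡ : l′ + δ ≡ s₀ b
          s≡ = sym (trans (cong (_∸ sum c) (sym size′)) (m+n∸m≡n (sum c) (l′ + δ)))

      step-sum : (F : ℕ → List ℕ → List ℕ → ℕ) →
        ∑[ b ∈ 𝒫 ] ⟦ strip? b b′ ⟧ * (∑[ s ∈ upTo (suc M) ] ⟦ rowBounds? λ′ i s ⟧ *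
          (⟦ step? i s (l + excess a′ b b′ 0) (meet a′ b b′) b c ⟧ * F s b c)) ≡
        ∑[ c′ ∈ 𝒫 ] ⟦ step? i l′ l a′ b′ c′ ⟧ *
          (⟦ strip? c c′ ⟧ * F (l′ + excess b′ c c′ 0) (meet b′ c c′) c)
      step-sum F = trans (∑-cong 𝒫 left) (trans (step-reindex F) (∑-cong 𝒫 λ c′ →
        ⟦⟧-×-* (step? i l′ l a′ b′ c′) (strip? c c′) _))
        where
        left : ∀ b → _
        left b = trans (cong (⟦ strip? b b′ ⟧ *_) (trans
            (∑-cong (upTo (suc M)) λ s → sym (⟦⟧-×-* (rowBounds? λ′ i s) (st s) (F s b c)))
            (∑-unique _≟_ (λ s → rowBounds? λ′ i s ×-dec st s) (s₀ b)
              (λ s (_ , _ , e , _) → trans (sym (m+n∸m≡n (sum c) s)) (cong (_∸ sum c) e))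
              (λ ((_ , h) , _) → Once-upTo (s≤s (≤-trans h (previous-rows≤ λ≤ i)))))))
          (sym (⟦⟧-×-* (strip? b b′) (rowBounds? λ′ i (s₀ b) ×-dec st (s₀ b)) (F (s₀ b) b c)))
          where
          st = λ s → step? i s (l + excess a′ b b′ 0) (meet a′ b b′) b c

    -- Inserting the strip row by row: after i rows, its part inside those rows is encoded
    -- by the horizontal strip b ⊆ b′ between the two patterns.
    insertion : ∀ i (F : ℕ → List ℕ → List ℕ → ℕ) →
      ∑[ ss ∈ vecs i ] ⟦ rowStrip? λ′ ss ⟧ * patterns ss (F (previous ss)) ≡
      patterns (rows λ′ i) (λ a′ b′ → ∑[ b ∈ 𝒫 ] ⟦ strip? b b′ ⟧ *
        F (previous (rows λ′ i) + excess a′ b b′ 0) (meet a′ b b′) b)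
    -- Without rows the pattern is empty, so the strip b ⊆ [] is empty too; the fictitious row M
    -- gains nothing.
    insertion zero F = begin
      F M [] [] + 0 + 0
        ≡⟨ trans (+-identityʳ _) (+-identityʳ _) ⟩
      F M [] []
        ≡⟨ cong (λ k → F k [] []) (+-identityʳ M) ⟨
      F (M + 0) [] []
        ≡⟨ ∑-single _≟ᴸ_ (λ b → F (M + excess [] b [] 0) (meet [] b []) b)
             (partitions≤-complete {M} ([]-partition , z≤n)) ⟨
      ∑[ b ∈ 𝒫 ] ⟦ b ≟ᴸ [] ⟧ * F (M + excess [] b [] 0) (meet [] b []) b
        ≡⟨ ∑-cong-All (partitions≤-sound M) (λ b (bP , _) → cong (_* F (M + excess [] b [] 0) (meet [] b []) b)
             (⟦⟧-cong (b ≟ᴸ []) (strip? b []) (λ { refl → strip (λ _ → z≤n , z≤n) })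
               (λ h → sum≡0 bP (n≤0⇒n≡0 (Strip⇒sum≤ h))))) ⟩
      ∑[ b ∈ 𝒫 ] ⟦ strip? b [] ⟧ * F (M + excess [] b [] 0) (meet [] b []) b ∎
      where open ≡-Reasoning
    insertion (suc i) F = begin
      ∑[ ss ∈ vecs (suc i) ] ⟦ rowStrip? λ′ ss ⟧ * patterns ss (F (previous ss))
        ≡⟨ ∑-vecs i _ ⟩
      ∑[ ss ∈ vecs i ] ∑[ s ∈ upTo (suc M) ] ⟦ rowStrip? λ′ (s ∷ ss) ⟧ * patterns (s ∷ ss) (F s)
        ≡⟨ ∑-cong-All (vecs-sound i) (λ { ss (refl , _) → peel ss }) ⟩
      ∑[ ss ∈ vecs i ] ⟦ rowStrip? λ′ ss ⟧ * patterns ss (G (previous ss))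
        ≡⟨ insertion i G ⟩
      patterns (rows λ′ i) (λ a′ b′ → ∑[ b ∈ 𝒫 ] ⟦ strip? b b′ ⟧ *
        G (l + excess a′ b b′ 0) (meet a′ b b′) b)
        ≡⟨ patterns-cong (rows λ′ i) (λ a′ b′ L → square L) ⟩
      patterns (rows λ′ i) (λ a′ b′ → ∑[ c′ ∈ 𝒫 ] ⟦ step? i l′ l a′ b′ c′ ⟧ * H b′ c′)
        ≡⟨ cong (λ k → patterns (rows λ′ i) (λ a′ b′ → ∑[ c′ ∈ 𝒫 ] ⟦ step? k l′ l a′ b′ c′ ⟧ * H b′ c′))
             (length-rows λ′ i) ⟨
      patterns (rows λ′ (suc i)) H ∎
      where
      open ≡-Reasoning
      l′ = λ′ ! i
      l  = previous (rows λ′ i)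
      H : List ℕ → List ℕ → ℕ
      H b′ c′ = ∑[ c ∈ 𝒫 ] ⟦ strip? c c′ ⟧ * F (l′ + excess b′ c c′ 0) (meet b′ c c′) c
      -- The new row s and the new level c are summed inside a function of the preceding row and
      -- levels, so that the induction hypothesis applies to `G`. This is why `F` also takes the
      -- preceding row as an argument.
      G : ℕ → List ℕ → List ℕ → ℕ
      G s₋ a b = ∑[ s ∈ upTo (suc M) ] ⟦ rowBounds? λ′ i s ⟧ * (∑[ c ∈ 𝒫 ] ⟦ step? i s s₋ a b c ⟧ * F s b c)
      peel : ∀ ss → ∑[ s ∈ upTo (suc M) ] ⟦ rowStrip? λ′ (s ∷ ss) ⟧ * patterns (s ∷ ss) (F s) ≡
        ⟦ rowStrip? λ′ ss ⟧ * patterns ss (λ a b → ∑[ s ∈ upTo (suc M) ] ⟦ rowBounds? λ′ (length ss) s ⟧ *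
          (∑[ c ∈ 𝒫 ] ⟦ step? (length ss) s (previous ss) a b c ⟧ * F s b c))
      peel ss = begin
        ∑[ s ∈ upTo (suc M) ] ⟦ rowStrip? λ′ (s ∷ ss) ⟧ * patterns (s ∷ ss) (F s)
          ≡⟨ ∑-cong (upTo (suc M)) (λ s → trans
               (cong (_* patterns (s ∷ ss) (F s)) (trans (⟦⟧-× (rowBounds? λ′ (length ss) s) (rowStrip? λ′ ss))
                 (*-comm ⟦ rowBounds? λ′ (length ss) s ⟧ _)))
               (trans (*-assoc ⟦ rowStrip? λ′ ss ⟧ _ _)
                 (cong (⟦ rowStrip? λ′ ss ⟧ *_) (sym (patterns-* ss ⟦ rowBounds? λ′ (length ss) s ⟧ _))))) ⟩
        ∑[ s ∈ upTo (suc M) ] ⟦ rowStrip? λ′ ss ⟧ * patterns ss (λ a b → ⟦ rowBounds? λ′ (length ss) s ⟧ *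
          (∑[ c ∈ 𝒫 ] ⟦ step? (length ss) s (previous ss) a b c ⟧ * F s b c))
          ≡⟨ ∑-*ˡ ⟦ rowStrip? λ′ ss ⟧ (upTo (suc M)) _ ⟩
        ⟦ rowStrip? λ′ ss ⟧ * (∑[ s ∈ upTo (suc M) ] patterns ss (λ a b → ⟦ rowBounds? λ′ (length ss) s ⟧ *
          (∑[ c ∈ 𝒫 ] ⟦ step? (length ss) s (previous ss) a b c ⟧ * F s b c)))
          ≡⟨ cong (⟦ rowStrip? λ′ ss ⟧ *_) (patterns-∑ ss (upTo (suc M)) _) ⟨
        _ ∎
      square : ∀ {a′ b′} → Levels (rows λ′ i) a′ b′ →
        ∑[ b ∈ 𝒫 ] ⟦ strip? b b′ ⟧ * G (l + excess a′ b b′ 0) (meet a′ b b′) b ≡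
        ∑[ c′ ∈ 𝒫 ] ⟦ step? i l′ l a′ b′ c′ ⟧ * H b′ c′
      square {a′} {b′} L = begin
        ∑[ b ∈ 𝒫 ] ⟦ strip? b b′ ⟧ * G (l + excess a′ b b′ 0) (meet a′ b b′) b
          ≡⟨ ∑-cong 𝒫 (λ b → trans (cong (⟦ strip? b b′ ⟧ *_) (out b)) (sym (∑-*ˡ ⟦ strip? b b′ ⟧ 𝒫 _))) ⟩
        ∑[ b ∈ 𝒫 ] ∑[ c ∈ 𝒫 ] ⟦ strip? b b′ ⟧ * (∑[ s ∈ upTo (suc M) ] ⟦ rowBounds? λ′ i s ⟧ *
          (⟦ step? i s (l + excess a′ b b′ 0) (meet a′ b b′) b c ⟧ * F s b c))
          ≡⟨ ∑-swap 𝒫 𝒫 _ ⟩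
        ∑[ c ∈ 𝒫 ] ∑[ b ∈ 𝒫 ] ⟦ strip? b b′ ⟧ * (∑[ s ∈ upTo (suc M) ] ⟦ rowBounds? λ′ i s ⟧ *
          (⟦ step? i s (l + excess a′ b b′ 0) (meet a′ b b′) b c ⟧ * F s b c))
          ≡⟨ ∑-cong-All (partitions≤-sound M) (λ c c≤ → step-sum i L c≤ F) ⟩
        ∑[ c ∈ 𝒫 ] ∑[ c′ ∈ 𝒫 ] ⟦ step? i l′ l a′ b′ c′ ⟧ *
          (⟦ strip? c c′ ⟧ * F (l′ + excess b′ c c′ 0) (meet b′ c c′) c)
          ≡⟨ ∑-swap 𝒫 𝒫 _ ⟩
        ∑[ c′ ∈ 𝒫 ] ∑[ c ∈ 𝒫 ] ⟦ step? i l′ l a′ b′ c′ ⟧ *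
          (⟦ strip? c c′ ⟧ * F (l′ + excess b′ c c′ 0) (meet b′ c c′) c)
          ≡⟨ ∑-cong 𝒫 (λ c′ → ∑-*ˡ ⟦ step? i l′ l a′ b′ c′ ⟧ 𝒫 _) ⟩
        ∑[ c′ ∈ 𝒫 ] ⟦ step? i l′ l a′ b′ c′ ⟧ * H b′ c′ ∎
        where
        out : ∀ b → G (l + excess a′ b b′ 0) (meet a′ b b′) b ≡
          ∑[ c ∈ 𝒫 ] ∑[ s ∈ upTo (suc M) ] ⟦ rowBounds? λ′ i s ⟧ *
            (⟦ step? i s (l + excess a′ b b′ 0) (meet a′ b b′) b c ⟧ * F s b c)
        out b = trans
          (∑-cong (upTo (suc M)) (λ s → sym (∑-*ˡ ⟦ rowBounds? λ′ i s ⟧ 𝒫 _)))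
          (∑-swap (upTo (suc M)) 𝒫 _)

-- Littlewood-Richardson numbers and the Pieri rule

module _ (M : ℕ) where

  private 𝒫 = partitions≤ M

  -- The Littlewood–Richardson number c^ν_{λ,β}.
  lr : List ℕ → List ℕ → List ℕ → ℕ
  lr β λ′ ν = patterns (rows λ′ M) (λ a b → ⟦ b ≟ᴸ β ⟧)
    where open Patterns M ν

  module _ {λ′ ν : List ℕ} (λ≤ : Bounded M λ′) (ν≤ : sum ν ≤ M) where
    open Patterns M ν hiding (𝒫)
    private
      rowAt : List ℕ → ℕ → ℕ
      rowAt []       i = 0
      rowAt (s ∷ ss) i with i ≟ length ss
      ... | yes _ = s
      ... | no _  = rowAt ss i

      rowAt-beyond : ∀ ss {i} → length ss ≤ i → rowAt ss i ≡ 0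
      rowAt-beyond []       _ = refl
      rowAt-beyond (s ∷ ss) {i} h with i ≟ length ss
      ... | yes refl = ⊥-elim (<-irrefl refl h)
      ... | no _     = rowAt-beyond ss (<⇒≤ h)

      rowAt-length : ∀ s ss → rowAt (s ∷ ss) (length ss) ≡ s
      rowAt-length s ss with length ss ≟ length ss
      ... | yes _ = refl
      ... | no ne = ⊥-elim (ne refl)

      rowAt-< : ∀ s ss {i} → i < length ss → rowAt (s ∷ ss) i ≡ rowAt ss i
      rowAt-< s ss {i} h with i ≟ length ss
      ... | yes refl = ⊥-elim (<-irrefl refl h)
      ... | no _     = refl

      rowAt-bounds : ∀ ss → RowStrip λ′ ss → ∀ i → i < length ss → RowBounds λ′ i (rowAt ss i)
      rowAt-bounds (s ∷ ss) (h , r) i i< with i ≟ length ss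
      ... | yes refl = h
      ... | no ne    = rowAt-bounds ss r i (≤∧≢⇒< (s≤s⁻¹ i<) ne)

      psum-rowAt : ∀ ss → psum (rowAt ss) (length ss) ≡ sum ss
      psum-rowAt []       = refl
      psum-rowAt (s ∷ ss) = trans
        (cong₂ _+_ (trans (psum-cong< (length ss) (λ i → rowAt-< s ss)) (psum-rowAt ss)) (rowAt-length s ss))
        (+-comm (sum ss) s)
        where
        psum-cong< : ∀ {f g} j → (∀ i → i < j → f i ≡ g i) → psum f j ≡ psum g j
        psum-cong< zero    h = refl
        psum-cong< (suc j) h = cong₂ _+_ (psum-cong< j (λ i l → h i (m≤n⇒m≤1+n l))) (h j ≤-refl)

      rows-rowAt : ∀ p ss → (∀ i → i < length ss → p ! i ≡ rowAt ss i) → rows p (length ss) ≡ ss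
      rows-rowAt p []       h = refl
      rows-rowAt p (s ∷ ss) h = cong₂ _∷_ (trans (h (length ss) ≤-refl) (rowAt-length s ss))
        (rows-rowAt p ss (λ i l → trans (h i (m≤n⇒m≤1+n l)) (rowAt-< s ss l)))

      rowAt-rows : ∀ p k i → i < k → rowAt (rows p k) i ≡ p ! i
      rowAt-rows p (suc k) i i<k with i ≟ length (rows p k)
      ... | yes e = cong (p !_) (sym (trans e (length-rows p k)))
      ... | no ne = rowAt-rows p k i (≤∧≢⇒< (s≤s⁻¹ i<k) (λ e → ne (trans e (sym (length-rows p k)))))

      !-vanish : ∀ {p} → Bounded M p → ∀ {i} → M ≤ i → p ! i ≡ 0
      !-vanish {p} (P , h) l = !-beyond p (≤-trans (length≤sum P) (≤-trans h l))

      unrows : List ℕ → List ℕ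
      unrows ss = fromSeq (rowAt ss) M

    module _ {ss : List ℕ} (len : length ss ≡ M) (rs : RowStrip λ′ ss) where
      private
        lower : ∀ i → λ′ ! i ≤ rowAt ss i
        lower i with <-≤-connex i M
        ... | inj₁ h = proj₁ (rowAt-bounds ss rs i (subst (i <_) (sym len) h))
        ... | inj₂ h = ≤-trans (≤-reflexive (!-vanish λ≤ h)) z≤n

        upper : ∀ i → rowAt ss (suc i) ≤ λ′ ! i
        upper i with <-≤-connex (suc i) M
        ... | inj₁ h = proj₂ (rowAt-bounds ss rs (suc i) (subst (suc i <_) (sym len) h))
        ... | inj₂ h = ≤-trans (≤-reflexive (rowAt-beyond ss (subst (_≤ suc i) (sym len) h))) z≤n

        dec : ∀ i → rowAt ss (suc i) ≤ rowAt ss i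
        dec i = ≤-trans (upper i) (lower i)

        end : rowAt ss M ≡ 0
        end = rowAt-beyond ss (≤-reflexive len)

      unrows-! : ∀ i → unrows ss ! i ≡ rowAt ss i
      unrows-! = fromSeq-! (rowAt ss) M dec end

      unrows-partition : IsPartition (unrows ss)
      unrows-partition = fromSeq-partition (rowAt ss) M dec end

      unrows-strip : Strip λ′ (unrows ss)
      at unrows-strip i rewrite unrows-! i | unrows-! (suc i) = lower i , upper i

      rows-unrows : rows (unrows ss) M ≡ ss
      rows-unrows = trans (cong (rows (unrows ss)) (sym len)) (rows-rowAt (unrows ss) ss (λ i _ → unrows-! i))

      sum-unrows : sum (unrows ss) ≡ sum ss
      sum-unrows = trans (sym (psum-sum (unrows ss) (length-fromSeq (rowAt ss) M)))
        (trans (psum-cong M unrows-!) (trans (cong (psum (rowAt ss)) (sym len)) (psum-rowAt ss)))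
        where
        length-fromSeq : ∀ f R → length (fromSeq f R) ≤ R
        length-fromSeq f zero = z≤n
        length-fromSeq f (suc R) with f 0
        ... | zero  = z≤n
        ... | suc _ = s≤s (length-fromSeq (f ∘ suc) R)

    unrows-rows : ∀ {p} → Bounded M p → RowStrip λ′ (rows p M) → unrows (rows p M) ≡ p
    unrows-rows {p} p≤ rs = partition-ext (unrows-partition (length-rows p M) rs) (proj₁ p≤) λ i →
      trans (unrows-! (length-rows p M) rs i) (entry i)
      where
      entry : ∀ i → rowAt (rows p M) i ≡ p ! i
      entry i with <-≤-connex i M
      ... | inj₁ h = rowAt-rows p M i h
      ... | inj₂ h = trans (rowAt-beyond (rows p M) (subst (_≤ i) (sym (length-rows p M)) h)) (sym (!-vanish p≤ h))

    rows-strip : ∀ {p} → sum p ≤ M → Strip λ′ p → ∀ i → RowStrip λ′ (rows p i)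
    rows-strip h s zero    = tt
    rows-strip {p} h s (suc i) rewrite length-rows p i = (proj₁ (at s i) , up i) , rows-strip h s i
      where
      up : ∀ i → p ! i ≤ previous (rows λ′ i)
      up zero    = ≤-trans (first≤sum p) h
      up (suc i) = proj₂ (at s i)

    -- A vector satisfying `RowStrip` is the row list of a partition σ with σ/λ′ a horizontal strip.
    -- If its entries add up to more than M, then σ is not in `𝒫`, but no pattern leads from it to ν
    -- either.
    ∑-strips : (F : List ℕ → List ℕ → ℕ) →
      ∑[ σ ∈ 𝒫 ] ⟦ strip? λ′ σ ⟧ * patterns (rows σ M) F ≡
      ∑[ ss ∈ vecs M ] ⟦ rowStrip? λ′ ss ⟧ * patterns ss F
    ∑-strips F = trans
      (∑-reindex _≟ᴸ_ _≟ᴸ_ (partitions≤-sound M) (vecs-sound M) partitions≤-complete vecs-complete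
        (strip? λ′) (λ ss → rowStrip? λ′ ss ×-dec sum ss ≤? M) (λ p → rows p M) unrows
        (λ p p≤ s → let rs = rows-strip (proj₂ p≤) s M in
          (length-rows p M , all≤ p (proj₂ p≤) M) , (rs , ≤-trans (≤-reflexive (sum-rows p M)) (≤-trans (psum≤sum p M) (proj₂ p≤))) ,
          unrows-rows p≤ rs , refl)
        (λ ss (len , _) (rs , h) → (unrows-partition len rs , ≤-trans (≤-reflexive (sum-unrows len rs)) h) ,
          unrows-strip len rs , rows-unrows len rs))
      (∑-cong (vecs M) λ ss → small ss (sum ss ≤? M))
      where
      all≤ : ∀ p → sum p ≤ M → ∀ i → All (_≤ M) (rows p i)
      all≤ p h zero    = []
      all≤ p h (suc i) = previous-rows≤ {p} h (suc i) ∷ all≤ p h i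
      small : ∀ ss → Dec (sum ss ≤ M) →
        ⟦ rowStrip? λ′ ss ×-dec sum ss ≤? M ⟧ * patterns ss F ≡ ⟦ rowStrip? λ′ ss ⟧ * patterns ss F
      small ss (yes h) = ⟦⟧-*-swap (rowStrip? λ′ ss ×-dec sum ss ≤? M) (rowStrip? λ′ ss) proj₁ (_, h) (λ _ → refl)
      small ss (no h)  = trans (cong (⟦ rowStrip? λ′ ss ×-dec sum ss ≤? M ⟧ *_) zero′)
        (trans (*-zeroʳ ⟦ rowStrip? λ′ ss ×-dec sum ss ≤? M ⟧)
          (sym (trans (cong (⟦ rowStrip? λ′ ss ⟧ *_) zero′) (*-zeroʳ ⟦ rowStrip? λ′ ss ⟧))))
        where
        zero′ : patterns ss F ≡ 0
        zero′ = patterns-size ss λ a b e → ⊥-elim (h (≤-trans (m≤n+m (sum ss) (sum b))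
          (≤-trans (≤-reflexive e) (≤-trans (psum≤sum ν (length ss)) ν≤))))

    -- Two readings of the coefficient of s_ν in s_λ s_β times the sum of all h_k: the strip joins
    -- λ′ on the left and β on the right. Insertion of the strip into the tableau passes from one to
    -- the other; `F` merely tests the final shape.
    lr-pieri : ∀ {β} → Bounded M β →
      ∑[ σ ∈ 𝒫 ] ⟦ strip? λ′ σ ⟧ * lr β σ ν ≡ ∑[ τ ∈ 𝒫 ] ⟦ strip? β τ ⟧ * lr τ λ′ ν
    lr-pieri {β} β≤ = begin
      ∑[ σ ∈ 𝒫 ] ⟦ strip? λ′ σ ⟧ * lr β σ ν
        ≡⟨ ∑-strips (λ a b → ⟦ b ≟ᴸ β ⟧) ⟩
      ∑[ ss ∈ vecs M ] ⟦ rowStrip? λ′ ss ⟧ * patterns ss (λ a b → ⟦ b ≟ᴸ β ⟧)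
        ≡⟨ insertion (proj₂ λ≤) ν≤ M (λ _ a b → ⟦ b ≟ᴸ β ⟧) ⟩
      patterns (rows λ′ M) (λ a′ b′ → ∑[ b ∈ 𝒫 ] ⟦ strip? b b′ ⟧ * ⟦ b ≟ᴸ β ⟧)
        ≡⟨ patterns-cong (rows λ′ M) (λ a′ b′ L → ends b′ (Patterns.Levels.bounded₂ L)) ⟩
      patterns (rows λ′ M) (λ a′ b′ → ∑[ τ ∈ 𝒫 ] ⟦ strip? β τ ⟧ * ⟦ b′ ≟ᴸ τ ⟧)
        ≡⟨ patterns-∑ (rows λ′ M) 𝒫 _ ⟩
      ∑[ τ ∈ 𝒫 ] patterns (rows λ′ M) (λ a′ b′ → ⟦ strip? β τ ⟧ * ⟦ b′ ≟ᴸ τ ⟧)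
        ≡⟨ ∑-cong 𝒫 (λ τ → patterns-* (rows λ′ M) ⟦ strip? β τ ⟧ _) ⟩
      ∑[ τ ∈ 𝒫 ] ⟦ strip? β τ ⟧ * lr τ λ′ ν ∎
      where
      open ≡-Reasoning
      ends : ∀ b′ → Bounded M b′ →
        ∑[ b ∈ 𝒫 ] ⟦ strip? b b′ ⟧ * ⟦ b ≟ᴸ β ⟧ ≡ ∑[ τ ∈ 𝒫 ] ⟦ strip? β τ ⟧ * ⟦ b′ ≟ᴸ τ ⟧
      ends b′ b′≤ = begin
        ∑[ b ∈ 𝒫 ] ⟦ strip? b b′ ⟧ * ⟦ b ≟ᴸ β ⟧
          ≡⟨ ∑-cong 𝒫 (λ b → *-comm ⟦ strip? b b′ ⟧ _) ⟩
        ∑[ b ∈ 𝒫 ] ⟦ b ≟ᴸ β ⟧ * ⟦ strip? b b′ ⟧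
          ≡⟨ ∑-single _≟ᴸ_ (λ b → ⟦ strip? b b′ ⟧) (partitions≤-complete β≤) ⟩
        ⟦ strip? β b′ ⟧
          ≡⟨ ∑-single _≟ᴸ_ (λ τ → ⟦ strip? β τ ⟧) (partitions≤-complete b′≤) ⟨
        ∑[ τ ∈ 𝒫 ] ⟦ τ ≟ᴸ b′ ⟧ * ⟦ strip? β τ ⟧
          ≡⟨ ∑-cong 𝒫 (λ τ → trans (*-comm _ ⟦ strip? β τ ⟧)
               (cong (⟦ strip? β τ ⟧ *_) (⟦⟧-cong (τ ≟ᴸ b′) (b′ ≟ᴸ τ) sym sym))) ⟩
        ∑[ τ ∈ 𝒫 ] ⟦ strip? β τ ⟧ * ⟦ b′ ≟ᴸ τ ⟧ ∎

    lr-size : IsPartition ν → ∀ β → sum β + sum λ′ ≢ sum ν → lr β λ′ ν ≡ 0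
    lr-size νP β ne = patterns-size (rows λ′ M) λ a b e → ⟦⟧-no (b ≟ᴸ β) λ { refl → ne (begin
      sum b + sum λ′                       ≡⟨ cong (λ z → sum b + z) (psum-sum λ′ (length≤ λ≤)) ⟨
      sum b + psum (λ′ !_) M               ≡⟨ cong (λ z → sum b + z) (sum-rows λ′ M) ⟨
      sum b + sum (rows λ′ M)              ≡⟨ e ⟩
      psum (ν !_) (length (rows λ′ M))     ≡⟨ cong (psum (ν !_)) (length-rows λ′ M) ⟩
      psum (ν !_) M                        ≡⟨ psum-sum ν (length≤ (νP , ν≤)) ⟩
      sum ν                                ∎) }
      where
      open ≡-Reasoning
      length≤ : ∀ {p} → Bounded M p → length p ≤ M
      length≤ (P , h) = ≤-trans (length≤sum P) h

    -- A pattern that ends in the empty shape is empty on all levels, so no letter occurs and every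
    -- row of λ′ must already equal that of ν.
    lr-[] : IsPartition ν → lr [] λ′ ν ≡ ⟦ λ′ ≟ᴸ ν ⟧
    lr-[] νP = trans (go M) (⟦⟧-cong (rows λ′ M ≟ᴸ rows ν M) (λ′ ≟ᴸ ν)
      (λ e → partition-ext (proj₁ λ≤) νP (entry e)) (λ { refl → refl }))
      where
      open ≡-Reasoning
      entry : rows λ′ M ≡ rows ν M → ∀ i → λ′ ! i ≡ ν ! i
      entry e i with <-≤-connex i M
      ... | inj₁ h = trans (sym (rowAt-rows λ′ M i h)) (trans (cong (λ r → rowAt r i) e) (rowAt-rows ν M i h))
      ... | inj₂ h = trans (!-vanish λ≤ h) (sym (!-vanish (νP , ν≤) h))
      empty : ∀ {b} → IsPartition b → Strip b [] → b ≡ []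
      empty bP h = sum≡0 bP (n≤0⇒n≡0 (Strip⇒sum≤ h))
      λ≤previous : ∀ i → λ′ ! i ≤ previous (rows λ′ i)
      λ≤previous zero    = ≤-trans (first≤sum λ′) (proj₂ λ≤)
      λ≤previous (suc i) = decreasing (proj₁ λ≤) i
      go : ∀ i → patterns (rows λ′ i) (λ a b → ⟦ b ≟ᴸ [] ⟧) ≡ ⟦ rows λ′ i ≟ᴸ rows ν i ⟧
      go zero    = refl
      go (suc i) = begin
        patterns (rows λ′ i) (λ a b → ∑[ c ∈ 𝒫 ] ⟦ step? (length (rows λ′ i)) l′ l a b c ⟧ * ⟦ c ≟ᴸ [] ⟧)
          ≡⟨ cong (λ k → patterns (rows λ′ i) (λ a b → ∑[ c ∈ 𝒫 ] ⟦ step? k l′ l a b c ⟧ * ⟦ c ≟ᴸ [] ⟧))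
               (length-rows λ′ i) ⟩
        patterns (rows λ′ i) (λ a b → ∑[ c ∈ 𝒫 ] ⟦ step? i l′ l a b c ⟧ * ⟦ c ≟ᴸ [] ⟧)
          ≡⟨ patterns-cong (rows λ′ i) (λ a b L → trans
               (trans (∑-cong 𝒫 (λ c → *-comm ⟦ step? i l′ l a b c ⟧ _))
                 (∑-single _≟ᴸ_ (λ c → ⟦ step? i l′ l a b c ⟧) (partitions≤-complete {M} ([]-partition , z≤n))))
               (trans (⟦⟧-cong (step? i l′ l a b []) (l′ ≟ ν ! i ×-dec b ≟ᴸ []) (last L) (first L))
                 (⟦⟧-× (l′ ≟ ν ! i) (b ≟ᴸ [])))) ⟩
        patterns (rows λ′ i) (λ a b → ⟦ l′ ≟ ν ! i ⟧ * ⟦ b ≟ᴸ [] ⟧)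
          ≡⟨ patterns-* (rows λ′ i) ⟦ l′ ≟ ν ! i ⟧ _ ⟩
        ⟦ l′ ≟ ν ! i ⟧ * patterns (rows λ′ i) (λ a b → ⟦ b ≟ᴸ [] ⟧)
          ≡⟨ cong (⟦ l′ ≟ ν ! i ⟧ *_) (go i) ⟩
        ⟦ l′ ≟ ν ! i ⟧ * ⟦ rows λ′ i ≟ᴸ rows ν i ⟧
          ≡⟨ ⟦⟧-× (l′ ≟ ν ! i) (rows λ′ i ≟ᴸ rows ν i) ⟨
        ⟦ l′ ≟ ν ! i ×-dec rows λ′ i ≟ᴸ rows ν i ⟧
          ≡⟨ ⟦⟧-cong (l′ ≟ ν ! i ×-dec rows λ′ i ≟ᴸ rows ν i) (rows λ′ (suc i) ≟ᴸ rows ν (suc i))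
               (λ (e , r) → cong₂ _∷_ e r) (λ e → ∷-injective e) ⟩
        ⟦ rows λ′ (suc i) ≟ᴸ rows ν (suc i) ⟧ ∎
        where
        l′ = λ′ ! i
        l  = previous (rows λ′ i)
        last : ∀ {a b} → Levels (rows λ′ i) a b → Step i l′ l a b [] → l′ ≡ ν ! i × b ≡ []
        last L (s , e , _) with empty (proj₁ (Levels.bounded₂ L)) s
        ... | refl = e , refl
        first : ∀ {a b} → Levels (rows λ′ i) a b → l′ ≡ ν ! i × b ≡ [] → Step i l′ l a b []
        first L (e , refl) with empty (proj₁ (Levels.bounded₁ L)) (Levels.strip₁₂ L)
        ... | refl = strip (λ _ → z≤n , z≤n) , e ,
          good λ j → +-monoˡ-≤ ([] ∥ suc j + [] ∥ j) (λ≤previous i)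

-- Rearranging double sums

∑-assoc : {A B : Set} (xs : List A) (ys : List B) (f : A → ℕ) (g : A → B → ℕ) (h : B → ℕ) →
          ∑[ x ∈ xs ] f x * (∑[ y ∈ ys ] g x y * h y) ≡ ∑[ y ∈ ys ] (∑[ x ∈ xs ] f x * g x y) * h y
∑-assoc xs ys f g h = begin
  ∑[ x ∈ xs ] f x * (∑[ y ∈ ys ] g x y * h y)
    ≡⟨ ∑-cong xs (λ x → trans (sym (∑-*ˡ (f x) ys _)) (∑-cong ys λ y → sym (*-assoc (f x) (g x y) (h y)))) ⟩
  ∑[ x ∈ xs ] ∑[ y ∈ ys ] f x * g x y * h y
    ≡⟨ ∑-swap xs ys _ ⟩
  ∑[ y ∈ ys ] ∑[ x ∈ xs ] f x * g x y * h y
    ≡⟨ ∑-cong ys (λ y → ∑-*ʳ (h y) xs _) ⟩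
  ∑[ y ∈ ys ] (∑[ x ∈ xs ] f x * g x y) * h y ∎
  where open ≡-Reasoning

∑-exchange : {A B : Set} (xs : List A) (ys : List B) (f : A → ℕ) (g : B → ℕ) (h : A → B → ℕ) →
             ∑[ x ∈ xs ] f x * (∑[ y ∈ ys ] g y * h x y) ≡ ∑[ y ∈ ys ] g y * (∑[ x ∈ xs ] f x * h x y)
∑-exchange xs ys f g h = begin
  ∑[ x ∈ xs ] f x * (∑[ y ∈ ys ] g y * h x y)
    ≡⟨ ∑-cong xs (λ x → sym (∑-*ˡ (f x) ys _)) ⟩
  ∑[ x ∈ xs ] ∑[ y ∈ ys ] f x * (g y * h x y)
    ≡⟨ ∑-swap xs ys _ ⟩
  ∑[ y ∈ ys ] ∑[ x ∈ xs ] f x * (g y * h x y)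
    ≡⟨ ∑-cong ys (λ y → trans (∑-cong xs λ x → *-swap (f x) (g y) (h x y)) (∑-*ˡ (g y) xs _)) ⟩
  ∑[ y ∈ ys ] g y * (∑[ x ∈ xs ] f x * h x y) ∎
  where open ≡-Reasoning

∑-positive : {A : Set} {P : A → Set} {xs : List A} {f : A → ℕ} → All P xs → ∑ xs f ≢ 0 →
             ∃ λ x → P x × f x ≢ 0
∑-positive []                       ne = ⊥-elim (ne refl)
∑-positive {f = f} (_∷_ {x = x} px pxs) ne with f x in eq
... | suc _ = x , px , λ e → 0≢1+n (trans (sym e) eq)
... | zero  = ∑-positive pxs ne

⟦⟧-*-≢0 : {P : Set} (d : Dec P) {x : ℕ} → ⟦ d ⟧ * x ≢ 0 → P × x ≢ 0
⟦⟧-*-≢0 (yes p) {x} ne = p , λ e → ne (trans (+-identityʳ x) e)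
⟦⟧-*-≢0 (no _)      ne = ⊥-elim (ne refl)

-- Kostka numbers

kostka-size : ∀ ν α ρ → sum ρ + sum α ≢ sum ν → kostka ν ρ α ≡ 0
kostka-size ν []      ρ ne = ⟦⟧-no (ρ ≟ᴸ ν) λ { refl → ne (+-identityʳ _) }
kostka-size ν (a ∷ α) ρ ne = trans (∑-filter (hstrip ρ) (partitions (sum ρ + a)) _) (trans
  (∑-cong-All (partitions-sound (sum ρ + a)) (λ σ (_ , e) → trans
    (cong ((if hstrip ρ σ then 1 else 0) *_) (kostka-size ν α σ λ h → ne (begin
      sum ρ + (a + sum α)  ≡⟨ +-assoc (sum ρ) a (sum α) ⟨
      sum ρ + a + sum α    ≡⟨ cong (_+ sum α) e ⟨
      sum σ + sum α        ≡⟨ h ⟩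
      sum ν                ∎)))
    (*-zeroʳ (if hstrip ρ σ then 1 else 0))))
  (∑-zero (partitions (sum ρ + a)) {f = λ _ → 0} (λ _ → refl)))
  where open ≡-Reasoning

-- The content is reversed so that removing the last strip of the tableau removes the first entry.
rkostka : List ℕ → List ℕ → ℕ
rkostka τ α = kostka τ [] (reverse α)

sum-reverse : ∀ α → sum (reverse α) ≡ sum α
sum-reverse []      = refl
sum-reverse (a ∷ α) = trans (cong sum (unfold-reverse a α)) (trans (sum-++ (reverse α) (a ∷ []))
  (trans (cong₂ _+_ (sum-reverse α) (+-identityʳ a)) (+-comm (sum α) a)))

rkostka-size : ∀ τ α → sum α ≢ sum τ → rkostka τ α ≡ 0
rkostka-size τ α ne = kostka-size τ (reverse α) [] (λ e → ne (trans (sym (sum-reverse α)) e))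

-- This is the sum of (i + 1) · p ! i, which decreases as a partition of fixed size goes up in
-- dominance order. It replaces that order in the triangularity of the Kostka numbers and provides
-- the induction measure.
weight : List ℕ → ℕ
weight []      = 0
weight (x ∷ p) = x + sum p + weight p

weight-mono : ∀ p q → (∀ i → p ! i ≤ q ! i) → weight p ≤ weight q
weight-mono []      q       h = z≤n
weight-mono (x ∷ p) []      h = +-mono-≤ (sum-mono (x ∷ p) [] h) (weight-mono p [] (h ∘ suc))
weight-mono (x ∷ p) (y ∷ q) h = +-mono-≤ (sum-mono (x ∷ p) (y ∷ q) h) (weight-mono p q (h ∘ suc))

+-tight : ∀ {a b c d} → a ≤ c → b ≤ d → a + b ≡ c + d → a ≡ c × b ≡ d
+-tight {a} {b} {c} {d} h k e = a≡c , +-cancelˡ-≡ a b d (trans e (cong (_+ d) (sym a≡c)))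
  where
  a≡c : a ≡ c
  a≡c = ≤-antisym h (+-cancelʳ-≤ b c a (≤-trans (+-monoʳ-≤ c k) (≤-reflexive (sym e))))

sum-tight : ∀ {p q} → IsPartition p → IsPartition q → (∀ i → p ! i ≤ q ! i) → sum p ≡ sum q → p ≡ q
sum-tight {[]}    {q}     P Q h e = sym (sum≡0 Q (sym e))
sum-tight {x ∷ p} {[]}    P Q h e = sum≡0 P e
sum-tight {x ∷ p} {y ∷ q} P Q h e = let (x≡y , s) = +-tight (h 0) (sum-mono p q (h ∘ suc)) e in
  cong₂ _∷_ x≡y (sum-tight (tail-partition P) (tail-partition Q) (h ∘ suc) s)

weight-tight : ∀ {p q} → IsPartition p → IsPartition q → (∀ i → p ! i ≤ q ! i) → weight p ≡ weight q → p ≡ q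
weight-tight {[]}    {[]}    P Q h e = refl
weight-tight {[]}    {suc y ∷ q} P Q h ()
weight-tight {[]}    {zero ∷ q} P (() ∷ _ , _) h e
weight-tight {x ∷ p} {[]}    (x>0 ∷ _ , _) Q h e = ⊥-elim (<⇒≱ x>0 (h 0))
weight-tight {x ∷ p} {y ∷ q} P Q h e =
  sum-tight P Q h (proj₁ (+-tight (sum-mono (x ∷ p) (y ∷ q) h) (weight-mono p q (h ∘ suc)) e))

sumℤ-cancel : ∀ {μ} {xs} (f g : List ℕ → ℤ) → Once μ xs → All (λ ν → ν ≢ μ → f ν ≡ g ν) xs →
              sumℤ (map f xs) ≡ sumℤ (map g xs) → f μ ≡ g μ
sumℤ-cancel f g (here r) (_ ∷ h) e = ℤᴳ.∙-cancelʳ _ _ _ (trans e (cong (g _ +ℤ_) (sym (rest r h))))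
  where
  rest : ∀ {μ xs} → All (μ ≢_) xs → All (λ ν → ν ≢ μ → f ν ≡ g ν) xs → sumℤ (map f xs) ≡ sumℤ (map g xs)
  rest []       []      = refl
  rest (n ∷ ns) (h ∷ k) = cong₂ _+ℤ_ (h (n ∘ sym)) (rest ns k)
sumℤ-cancel f g (there {y} {xs} n o) (h ∷ k) e = sumℤ-cancel f g o k
  (ℤᴳ.∙-cancelˡ (f y) _ _ (trans e (cong (_+ℤ sumℤ (map g xs)) (sym (h (n ∘ sym))))))

sumℤ-+ : ∀ (f g : List ℕ → ℕ) xs → sumℤ (map (λ x → + f x *ℤ + g x) xs) ≡ + (∑[ x ∈ xs ] f x * g x)
sumℤ-+ f g []       = refl
sumℤ-+ f g (x ∷ xs) = cong₂ _+ℤ_ (sym (ℤ.pos-* (f x) (g x))) (sumℤ-+ f g xs)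

module _ (M : ℕ) where

  private 𝒫 = partitions≤ M

  Adds : List ℕ → ℕ → List ℕ → Set
  Adds ρ a σ = Strip ρ σ × sum σ ≡ sum ρ + a

  adds? : ∀ ρ a σ → Dec (Adds ρ a σ)
  adds? ρ a σ = strip? ρ σ ×-dec sum σ ≟ sum ρ + a

  ∑-ups : ∀ ρ a → sum ρ + a ≤ M → (f : List ℕ → ℕ) → ∑ (ups ρ a) f ≡ ∑[ σ ∈ 𝒫 ] ⟦ adds? ρ a σ ⟧ * f σ
  ∑-ups ρ a h f = begin
    ∑ (ups ρ a) f
      ≡⟨ ∑-filter (hstrip ρ) (partitions (sum ρ + a)) f ⟩
    ∑[ σ ∈ partitions (sum ρ + a) ] ⟦ strip? ρ σ ⟧ * f σ
      ≡⟨ ∑-partitions h _ ⟩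
    ∑[ σ ∈ 𝒫 ] ⟦ sum σ ≟ sum ρ + a ⟧ * (⟦ strip? ρ σ ⟧ * f σ)
      ≡⟨ ∑-cong 𝒫 (λ σ → trans (*-swap ⟦ sum σ ≟ sum ρ + a ⟧ ⟦ strip? ρ σ ⟧ (f σ))
           (sym (⟦⟧-×-* (strip? ρ σ) (sum σ ≟ sum ρ + a) (f σ)))) ⟩
    ∑[ σ ∈ 𝒫 ] ⟦ adds? ρ a σ ⟧ * f σ ∎
    where open ≡-Reasoning

  kostka-cons : ∀ {ν} → Bounded M ν → ∀ ρ a α →
                kostka ν ρ (a ∷ α) ≡ ∑[ σ ∈ 𝒫 ] ⟦ adds? ρ a σ ⟧ * kostka ν σ α
  kostka-cons {ν} ν≤ ρ a α with sum ρ + a ≤? M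
  ... | yes h = ∑-ups ρ a h (λ σ → kostka ν σ α)
  ... | no h  = trans
    (kostka-size ν (a ∷ α) ρ (λ e → h (begin
      sum ρ + a            ≤⟨ +-monoʳ-≤ (sum ρ) (m≤m+n a (sum α)) ⟩
      sum ρ + (a + sum α)  ≡⟨ e ⟩
      sum ν                ≤⟨ proj₂ ν≤ ⟩
      M                    ∎)))
    (sym (trans (∑-cong-All (partitions≤-sound M) (λ σ (_ , σ≤) →
      cong (_* kostka ν σ α) (⟦⟧-no (adds? ρ a σ) (λ (_ , e) → h (≤-trans (≤-reflexive (sym e)) σ≤)))))
      (∑-zero 𝒫 {f = λ _ → 0} (λ _ → refl))))
    where open ≤-Reasoning

  kostka-snoc : ∀ {τ} → Bounded M τ → ∀ α {ρ} → Bounded M ρ → ∀ a →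
                kostka τ ρ (α ++ a ∷ []) ≡ ∑[ β ∈ 𝒫 ] kostka β ρ α * ⟦ adds? β a τ ⟧
  kostka-snoc {τ} τ≤ [] {ρ} ρ≤ a = begin
    kostka τ ρ (a ∷ [])
      ≡⟨ kostka-cons τ≤ ρ a [] ⟩
    ∑[ σ ∈ 𝒫 ] ⟦ adds? ρ a σ ⟧ * ⟦ σ ≟ᴸ τ ⟧
      ≡⟨ ∑-cong 𝒫 (λ σ → *-comm ⟦ adds? ρ a σ ⟧ _) ⟩
    ∑[ σ ∈ 𝒫 ] ⟦ σ ≟ᴸ τ ⟧ * ⟦ adds? ρ a σ ⟧
      ≡⟨ ∑-single _≟ᴸ_ (λ σ → ⟦ adds? ρ a σ ⟧) (partitions≤-complete τ≤) ⟩
    ⟦ adds? ρ a τ ⟧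
      ≡⟨ ∑-single _≟ᴸ_ (λ β → ⟦ adds? β a τ ⟧) (partitions≤-complete ρ≤) ⟨
    ∑[ β ∈ 𝒫 ] ⟦ β ≟ᴸ ρ ⟧ * ⟦ adds? β a τ ⟧
      ≡⟨ ∑-cong 𝒫 (λ β → cong (_* ⟦ adds? β a τ ⟧) (⟦⟧-cong (β ≟ᴸ ρ) (ρ ≟ᴸ β) sym sym)) ⟩
    ∑[ β ∈ 𝒫 ] ⟦ ρ ≟ᴸ β ⟧ * ⟦ adds? β a τ ⟧ ∎
    where open ≡-Reasoning
  kostka-snoc {τ} τ≤ (b ∷ α) {ρ} ρ≤ a = begin
    kostka τ ρ (b ∷ (α ++ a ∷ []))
      ≡⟨ kostka-cons τ≤ ρ b (α ++ a ∷ []) ⟩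
    ∑[ σ ∈ 𝒫 ] ⟦ adds? ρ b σ ⟧ * kostka τ σ (α ++ a ∷ [])
      ≡⟨ ∑-cong-All (partitions≤-sound M) (λ σ σ≤ → cong (⟦ adds? ρ b σ ⟧ *_) (kostka-snoc τ≤ α σ≤ a)) ⟩
    ∑[ σ ∈ 𝒫 ] ⟦ adds? ρ b σ ⟧ * (∑[ β ∈ 𝒫 ] kostka β σ α * ⟦ adds? β a τ ⟧)
      ≡⟨ ∑-assoc 𝒫 𝒫 (λ σ → ⟦ adds? ρ b σ ⟧) (λ σ β → kostka β σ α) (λ β → ⟦ adds? β a τ ⟧) ⟩
    ∑[ β ∈ 𝒫 ] (∑[ σ ∈ 𝒫 ] ⟦ adds? ρ b σ ⟧ * kostka β σ α) * ⟦ adds? β a τ ⟧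
      ≡⟨ ∑-cong-All (partitions≤-sound M) (λ β β≤ → cong (_* ⟦ adds? β a τ ⟧) (kostka-cons β≤ ρ b α)) ⟨
    ∑[ β ∈ 𝒫 ] kostka β ρ (b ∷ α) * ⟦ adds? β a τ ⟧ ∎
    where open ≡-Reasoning

  rkostka-cons : ∀ {τ} → Bounded M τ → ∀ a α →
                 rkostka τ (a ∷ α) ≡ ∑[ β ∈ 𝒫 ] rkostka β α * ⟦ adds? β a τ ⟧
  rkostka-cons {τ} τ≤ a α = trans (cong (kostka τ []) (unfold-reverse a α))
    (kostka-snoc τ≤ (reverse α) ([]-partition , z≤n) a)

  -- Let β be τ without its last strip. Interlacing puts the tail of τ inside β, and β has content
  -- the tail of μ, so weights compare along tail τ, β, tail μ. Equality of the weights forces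
  -- equality at both places.
  rkostka-support : ∀ {μ τ} → IsPartition μ → Bounded M τ → rkostka τ μ ≢ 0 →
                    weight τ ≤ weight μ × (weight τ ≡ weight μ → τ ≡ μ)
  rkostka-support {[]} {τ} _ τ≤ ne with [] ≟ᴸ τ
  ... | yes refl = z≤n , λ _ → refl
  ... | no _     = ⊥-elim (ne refl)
  rkostka-support {suc a ∷ μ} {[]} _ τ≤ ne = z≤n , λ ()
  rkostka-support {zero ∷ μ} (() ∷ _ , _) τ≤ ne
  rkostka-support {suc a ∷ μ} {x ∷ τ} μP τ≤ ne
    with ∑-positive (partitions≤-sound M) (λ e → ne (trans (rkostka-cons τ≤ (suc a) μ) e))
  ... | β , β≤ , ne′ with ⟦⟧-*-≢0 (adds? β (suc a) (x ∷ τ)) (λ e → ne′ (trans (*-comm (rkostka β μ) _) e))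
  ... | (s , size) , kβ with rkostka-support (tail-partition μP) β≤ kβ
  ... | βμ , tight = +-mono-≤ (≤-reflexive size′) (≤-trans τβ βμ) , λ e →
    let e′ = +-cancelˡ-≡ (suc a + sum μ) (weight τ) (weight μ) (trans (cong (_+ weight τ) (sym size′)) e)
        βμ≡ = tight (≤-antisym βμ (≤-trans (≤-reflexive (sym e′)) τβ))
        τβ≡ = weight-tight (tail-partition (proj₁ τ≤)) (proj₁ β≤) (λ i → proj₂ (at s i))
                           (trans e′ (cong weight (sym βμ≡)))
        τμ≡ = trans τβ≡ βμ≡
    in cong₂ _∷_ (+-cancelʳ-≡ (sum μ) x (suc a) (trans (cong (λ p → x + sum p) (sym τμ≡)) size′)) τμ≡
    where
    τβ : weight τ ≤ weight β
    τβ = weight-mono τ β (λ i → proj₂ (at s i))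
    size′ : x + sum τ ≡ suc a + sum μ
    size′ with sum μ ≟ sum β
    ... | yes e = trans size (trans (+-comm (sum β) (suc a)) (cong (λ k → suc a + k) (sym e)))
    ... | no e  = ⊥-elim (kβ (rkostka-size β μ e))

  rkostka-diagonal : ∀ {μ} → Bounded M μ → rkostka μ μ ≡ 1
  rkostka-diagonal {[]}    _ = refl
  rkostka-diagonal {a ∷ μ} μ≤@(μP , h) = begin
    rkostka (a ∷ μ) (a ∷ μ)
      ≡⟨ rkostka-cons μ≤ a μ ⟩
    ∑[ β ∈ 𝒫 ] rkostka β μ * ⟦ adds? β a (a ∷ μ) ⟧
      ≡⟨ ∑-cong-All (partitions≤-sound M) (λ β (βP , _) → trans (*-comm (rkostka β μ) _)
           (cong (_* rkostka β μ) (⟦⟧-cong (adds? β a (a ∷ μ)) (β ≟ᴸ μ)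
             (λ (s , e) → sym (sum-tight (tail-partition μP) βP (λ i → proj₂ (at s i))
               (+-cancelˡ-≡ a _ _ (trans e (+-comm (sum β) a)))))
             (λ { refl → strip (λ i → shift i , ≤-refl) , +-comm a (sum β) })))) ⟩
    ∑[ β ∈ 𝒫 ] ⟦ β ≟ᴸ μ ⟧ * rkostka β μ
      ≡⟨ ∑-single _≟ᴸ_ (λ β → rkostka β μ) (partitions≤-complete μ≤′) ⟩
    rkostka μ μ
      ≡⟨ rkostka-diagonal μ≤′ ⟩
    1 ∎
    where
    open ≡-Reasoning
    μ≤′ : Bounded M μ
    μ≤′ = tail-partition μP , ≤-trans (m≤n+m (sum μ) a) h
    shift : ∀ i → μ ! i ≤ (a ∷ μ) ! i
    shift i = decreasing μP i

  -- Schur functions are linearly independent.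
  kostka-independent : ∀ {n} → n ≤ M → (x y : List ℕ → ℤ) →
    (∀ α → sumℤ (map (λ ν → x ν *ℤ + rkostka ν α) (partitions n)) ≡
           sumℤ (map (λ ν → y ν *ℤ + rkostka ν α) (partitions n))) →
    ∀ {μ} → IsPartition μ → sum μ ≡ n → x μ ≡ y μ
  kostka-independent {n} n≤M x y h {μ} = go μ (<-wellFounded (weight μ))
    where
    go : ∀ μ → Acc _<_ (weight μ) → IsPartition μ → sum μ ≡ n → x μ ≡ y μ
    go μ (acc rec) μP refl = begin
      x μ                    ≡⟨ one x ⟨
      -- At content μ only partitions of weight at most that of μ contribute, and by induction those
      -- other than μ have equal coefficients.
      x μ *ℤ + rkostka μ μ   ≡⟨ sumℤ-cancel _ _ (partitions-complete μP refl) (All.map off (partitions-sound n)) (h μ) ⟩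
      y μ *ℤ + rkostka μ μ   ≡⟨ one y ⟩
      y μ                    ∎
      where
      open ≡-Reasoning
      one : ∀ z → z μ *ℤ + rkostka μ μ ≡ z μ
      one z = trans (cong (λ k → z μ *ℤ + k) (rkostka-diagonal (μP , n≤M))) (ℤ.*-identityʳ (z μ))
      off : ∀ {ν} → IsPartition ν × sum ν ≡ n → ν ≢ μ → x ν *ℤ + rkostka ν μ ≡ y ν *ℤ + rkostka ν μ
      off {ν} (νP , e) ne with rkostka ν μ ≟ 0
      ... | yes z rewrite z = trans (ℤ.*-zeroʳ (x ν)) (sym (ℤ.*-zeroʳ (y ν)))
      ... | no nz = let (le , tight) = rkostka-support μP (νP , ≤-trans (≤-reflexive e) n≤M) nz in
        cong (_*ℤ + rkostka ν μ) (go ν (rec (≤∧≢⇒< le (ne ∘ tight))) νP e)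

-- Skewing products of complete symmetric functions

below : List ℕ → List (List ℕ)
below []      = [] ∷ []
below (a ∷ α) = concatMap (λ d → map (d ∷_) (below α)) (upTo (suc a))

∑-below : ∀ a α f → ∑ (below (a ∷ α)) f ≡ ∑[ d ∈ upTo (suc a) ] ∑[ δ ∈ below α ] f (d ∷ δ)
∑-below a α f = trans (∑-concatMap (λ d → map (d ∷_) (below α)) (upTo (suc a)) f)
  (∑-cong (upTo (suc a)) λ d → cong sum (sym (map-∘ (below α))))

∑-below-snoc : ∀ α a f → ∑ (below (α ++ a ∷ [])) f ≡ ∑[ δ ∈ below α ] ∑[ d ∈ upTo (suc a) ] f (δ ++ d ∷ [])
∑-below-snoc []      a f = trans (∑-below a [] f) (trans (∑-cong (upTo (suc a)) λ d → +-identityʳ _) (sym (+-identityʳ _)))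
∑-below-snoc (b ∷ α) a f = begin
  ∑ (below (b ∷ (α ++ a ∷ []))) f
    ≡⟨ ∑-below b (α ++ a ∷ []) f ⟩
  ∑[ e ∈ upTo (suc b) ] ∑[ δ ∈ below (α ++ a ∷ []) ] f (e ∷ δ)
    ≡⟨ ∑-cong (upTo (suc b)) (λ e → ∑-below-snoc α a (f ∘ (e ∷_))) ⟩
  ∑[ e ∈ upTo (suc b) ] ∑[ δ ∈ below α ] ∑[ d ∈ upTo (suc a) ] f (e ∷ (δ ++ d ∷ []))
    ≡⟨ ∑-below b α (λ δ → ∑[ d ∈ upTo (suc a) ] f (δ ++ d ∷ [])) ⟨
  ∑[ δ ∈ below (b ∷ α) ] ∑[ d ∈ upTo (suc a) ] f (δ ++ d ∷ []) ∎
  where open ≡-Reasoning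

∑-below-reverse : ∀ α f → ∑ (below (reverse α)) f ≡ ∑[ δ ∈ below α ] f (reverse δ)
∑-below-reverse []      f = refl
∑-below-reverse (a ∷ α) f = begin
  ∑ (below (reverse (a ∷ α))) f
    ≡⟨ cong (λ β → ∑ (below β) f) (unfold-reverse a α) ⟩
  ∑ (below (reverse α ++ a ∷ [])) f
    ≡⟨ ∑-below-snoc (reverse α) a f ⟩
  ∑[ δ ∈ below (reverse α) ] ∑[ d ∈ upTo (suc a) ] f (δ ++ d ∷ [])
    ≡⟨ ∑-below-reverse α _ ⟩
  ∑[ δ ∈ below α ] ∑[ d ∈ upTo (suc a) ] f (reverse δ ++ d ∷ [])
    ≡⟨ ∑-swap (below α) (upTo (suc a)) _ ⟩
  ∑[ d ∈ upTo (suc a) ] ∑[ δ ∈ below α ] f (reverse δ ++ d ∷ [])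
    ≡⟨ ∑-cong (upTo (suc a)) (λ d → ∑-cong (below α) λ δ → cong f (sym (unfold-reverse d δ))) ⟩
  ∑[ d ∈ upTo (suc a) ] ∑[ δ ∈ below α ] f (reverse (d ∷ δ))
    ≡⟨ ∑-below a α (f ∘ reverse) ⟨
  ∑[ δ ∈ below (a ∷ α) ] f (reverse δ) ∎
  where open ≡-Reasoning

module _ (M : ℕ) where

  private 𝒫 = partitions≤ M

  -- h_k^⊥ h_a = Σ_i h_{a−i} h_{k−i}^⊥
  square-count : ∀ ρ σ {t} → t ≤ M →
    ∑[ τ ∈ 𝒫 ] ⟦ strip? ρ τ ×-dec strip? σ τ ×-dec sum τ ≟ t ⟧ ≡
    ∑[ κ ∈ 𝒫 ] ⟦ strip? κ ρ ×-dec strip? κ σ ×-dec sum ρ + sum σ ≤? sum κ + t ⟧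
  square-count ρ σ {t} t≤M = begin
    ∑[ τ ∈ 𝒫 ] ⟦ up? τ ⟧       ≡⟨ ∑-cong 𝒫 (λ τ → *-identityʳ ⟦ up? τ ⟧) ⟨
    ∑[ τ ∈ 𝒫 ] ⟦ up? τ ⟧ * 1   ≡⟨ ∑-reindex _≟ᴸ_ _≟ᴸ_ (partitions≤-sound M) (partitions≤-sound M)
      partitions≤-complete partitions≤-complete up? down? (meet ρ σ) (λ κ → join κ ρ σ (δ κ)) down up ⟩
    ∑[ κ ∈ 𝒫 ] ⟦ down? κ ⟧ * 1 ≡⟨ ∑-cong 𝒫 (λ κ → *-identityʳ ⟦ down? κ ⟧) ⟩
    ∑[ κ ∈ 𝒫 ] ⟦ down? κ ⟧     ∎
    where
    open ≡-Reasoning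
    up? : ∀ τ → Dec (Strip ρ τ × Strip σ τ × sum τ ≡ t)
    up? τ = strip? ρ τ ×-dec strip? σ τ ×-dec sum τ ≟ t
    down? : ∀ κ → Dec (Strip κ ρ × Strip κ σ × sum ρ + sum σ ≤ sum κ + t)
    down? κ = strip? κ ρ ×-dec strip? κ σ ×-dec sum ρ + sum σ ≤? sum κ + t
    -- The prescribed size t of τ fixes how many boxes enter the first row; the inequality in
    -- `down?` says that this number is not negative.
    δ : List ℕ → ℕ
    δ κ = sum κ + t ∸ (sum ρ + sum σ)
    down : ∀ τ → Bounded M τ → Strip ρ τ × Strip σ τ × sum τ ≡ t → _
    down τ (τP , τ≤) (ρτ , στ , refl) =
      (meet-partition ρτ στ , ≤-trans (Strip⇒sum≤ κρ) (≤-trans (Strip⇒sum≤ ρτ) τ≤)) ,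
      (κρ , meet-strip₂ ρτ στ , ≤-trans (m≤n+m _ e) (≤-reflexive size)) ,
      trans (cong (join κ ρ σ) (trans (cong (_∸ (sum ρ + sum σ)) (sym size)) (m+n∸n≡m e (sum ρ + sum σ)))) (join-meet τP ρτ στ) ,
      refl
      where
      κ  = meet ρ σ τ
      κρ = meet-strip₁ ρτ στ
      e  = excess ρ σ τ 0
      size : e + (sum ρ + sum σ) ≡ sum κ + sum τ
      size = trans (sym (+-assoc e (sum ρ) (sum σ)))
        (trans (sym (square-sum (meet-square ρτ στ))) (+-comm (sum τ) (sum κ)))
    up : ∀ κ → Bounded M κ → Strip κ ρ × Strip κ σ × sum ρ + sum σ ≤ sum κ + t → _
    up κ (κP , κ≤) (κρ , κσ , h) =
      (join-partition κρ κσ (δ κ) , ≤-trans (≤-reflexive size) t≤M) ,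
      (join-strip₁ κρ κσ (δ κ) , join-strip₂ κρ κσ (δ κ) , size) ,
      meet-join κP κρ κσ (δ κ)
      where
      size : sum (join κ ρ σ (δ κ)) ≡ t
      size = +-cancelʳ-≡ (sum κ) _ _ (trans (square-sum (join-square κρ κσ (δ κ)))
        (trans (+-assoc (δ κ) (sum ρ) (sum σ)) (trans (m∸n+n≡m h) (+-comm (sum κ) t))))

  ∑-sizes : ∀ κ γ a → ∑[ d ∈ upTo (suc a) ] ⟦ adds? M κ d γ ⟧ ≡ ⟦ strip? κ γ ×-dec sum γ ≤? sum κ + a ⟧
  ∑-sizes κ γ a = begin
    ∑[ d ∈ upTo (suc a) ] ⟦ adds? M κ d γ ⟧
      ≡⟨ ∑-cong-All (All.applyUpTo⁺₁ {P = _≤ a} id (suc a) s≤s⁻¹) (λ d d≤a → trans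
           (⟦⟧-cong (adds? M κ d γ) (adds? M κ d γ ×-dec d ≤? a) (_, d≤a) proj₁)
           (sym (*-identityʳ _))) ⟩
    ∑[ d ∈ upTo (suc a) ] ⟦ adds? M κ d γ ×-dec d ≤? a ⟧ * 1
      ≡⟨ ∑-unique _≟_ (λ d → adds? M κ d γ ×-dec d ≤? a) d₀
           (λ d ((_ , e) , _) → trans (sym (m+n∸m≡n (sum κ) d)) (cong (_∸ sum κ) (sym e)))
           (λ (_ , d≤a) → Once-upTo (s≤s d≤a)) ⟩
    ⟦ adds? M κ d₀ γ ×-dec d₀ ≤? a ⟧ * 1
      ≡⟨ *-identityʳ _ ⟩
    ⟦ adds? M κ d₀ γ ×-dec d₀ ≤? a ⟧
      ≡⟨ ⟦⟧-cong (adds? M κ d₀ γ ×-dec d₀ ≤? a) (strip? κ γ ×-dec sum γ ≤? sum κ + a)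
           (λ ((s , e) , h) → s , ≤-trans (≤-reflexive e) (+-monoʳ-≤ (sum κ) h))
           (λ (s , h) → (s , sym (m+[n∸m]≡n (Strip⇒sum≤ s))) , m≤n+o⇒m∸n≤o (sum γ) (sum κ) h) ⟩
    ⟦ strip? κ γ ×-dec sum γ ≤? sum κ + a ⟧ ∎
    where
    open ≡-Reasoning
    d₀ = sum γ ∸ sum κ

  -- Write H^⊥ for the sum of all h_k^⊥. The left side is the coefficient of s_ν in H^⊥ (s_β h_α),
  -- the right side that in (H^⊥ s_β) times the sum of the h_δ with δ ≤ α entrywise. Each step of
  -- the induction moves H^⊥ past one factor h_a by `square-count`.
  kostka-down : ∀ {ν} → Bounded M ν → ∀ α {β} → Bounded M β → sum β + sum α ≤ M →
    ∑[ τ ∈ 𝒫 ] ⟦ strip? ν τ ⟧ * kostka τ β α ≡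
    ∑[ γ ∈ 𝒫 ] ⟦ strip? γ β ⟧ * (∑[ δ ∈ below α ] kostka ν γ δ)
  kostka-down {ν} ν≤ [] {β} β≤ h = begin
    ∑[ τ ∈ 𝒫 ] ⟦ strip? ν τ ⟧ * ⟦ β ≟ᴸ τ ⟧
      ≡⟨ ∑-cong 𝒫 (λ τ → trans (*-comm ⟦ strip? ν τ ⟧ _)
           (cong (_* ⟦ strip? ν τ ⟧) (⟦⟧-cong (β ≟ᴸ τ) (τ ≟ᴸ β) sym sym))) ⟩
    ∑[ τ ∈ 𝒫 ] ⟦ τ ≟ᴸ β ⟧ * ⟦ strip? ν τ ⟧
      ≡⟨ ∑-single _≟ᴸ_ (λ τ → ⟦ strip? ν τ ⟧) (partitions≤-complete β≤) ⟩
    ⟦ strip? ν β ⟧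
      ≡⟨ ∑-single _≟ᴸ_ (λ γ → ⟦ strip? γ β ⟧) (partitions≤-complete ν≤) ⟨
    ∑[ γ ∈ 𝒫 ] ⟦ γ ≟ᴸ ν ⟧ * ⟦ strip? γ β ⟧
      ≡⟨ ∑-cong 𝒫 (λ γ → trans (*-comm _ ⟦ strip? γ β ⟧) (cong (⟦ strip? γ β ⟧ *_) (sym (+-identityʳ _)))) ⟩
    ∑[ γ ∈ 𝒫 ] ⟦ strip? γ β ⟧ * (⟦ γ ≟ᴸ ν ⟧ + 0) ∎
    where open ≡-Reasoning
  kostka-down {ν} ν≤ (a ∷ α) {β} β≤ h = begin
    ∑[ τ ∈ 𝒫 ] ⟦ strip? ν τ ⟧ * kostka τ β (a ∷ α)
      ≡⟨ ∑-cong-All (partitions≤-sound M) (λ τ τ≤ → cong (⟦ strip? ν τ ⟧ *_) (kostka-cons M τ≤ β a α)) ⟩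
    ∑[ τ ∈ 𝒫 ] ⟦ strip? ν τ ⟧ * (∑[ σ ∈ 𝒫 ] ⟦ adds? M β a σ ⟧ * kostka τ σ α)
      ≡⟨ ∑-exchange 𝒫 𝒫 (λ τ → ⟦ strip? ν τ ⟧) (λ σ → ⟦ adds? M β a σ ⟧) (λ τ σ → kostka τ σ α) ⟩
    ∑[ σ ∈ 𝒫 ] ⟦ adds? M β a σ ⟧ * (∑[ τ ∈ 𝒫 ] ⟦ strip? ν τ ⟧ * kostka τ σ α)
      ≡⟨ ∑-cong-All (partitions≤-sound M) (λ σ σ≤ → ⟦⟧-*-cong (adds? M β a σ) λ (_ , e) →
           kostka-down ν≤ α σ≤ (≤-trans (≤-reflexive (trans (cong (_+ sum α) e) (+-assoc (sum β) a (sum α)))) h)) ⟩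
    ∑[ σ ∈ 𝒫 ] ⟦ adds? M β a σ ⟧ * (∑[ γ ∈ 𝒫 ] ⟦ strip? γ σ ⟧ * S γ)
      ≡⟨ ∑-assoc 𝒫 𝒫 (λ σ → ⟦ adds? M β a σ ⟧) (λ σ γ → ⟦ strip? γ σ ⟧) S ⟩
    ∑[ γ ∈ 𝒫 ] (∑[ σ ∈ 𝒫 ] ⟦ adds? M β a σ ⟧ * ⟦ strip? γ σ ⟧) * S γ
      ≡⟨ ∑-cong 𝒫 (λ γ → cong (_* S γ) (count γ)) ⟩
    ∑[ γ ∈ 𝒫 ] (∑[ κ ∈ 𝒫 ] ⟦ strip? κ β ⟧ * ⟦ strip? κ γ ×-dec sum γ ≤? sum κ + a ⟧) * S γ
      ≡⟨ ∑-assoc 𝒫 𝒫 (λ κ → ⟦ strip? κ β ⟧) (λ κ γ → ⟦ strip? κ γ ×-dec sum γ ≤? sum κ + a ⟧) S ⟨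
    ∑[ κ ∈ 𝒫 ] ⟦ strip? κ β ⟧ * (∑[ γ ∈ 𝒫 ] ⟦ strip? κ γ ×-dec sum γ ≤? sum κ + a ⟧ * S γ)
      ≡⟨ ∑-cong 𝒫 (λ κ → cong (⟦ strip? κ β ⟧ *_) (sym (first κ))) ⟩
    ∑[ κ ∈ 𝒫 ] ⟦ strip? κ β ⟧ * (∑[ δ ∈ below (a ∷ α) ] kostka ν κ δ) ∎
    where
    open ≡-Reasoning
    S : List ℕ → ℕ
    S γ = ∑[ δ ∈ below α ] kostka ν γ δ
    count : ∀ γ → ∑[ σ ∈ 𝒫 ] ⟦ adds? M β a σ ⟧ * ⟦ strip? γ σ ⟧ ≡
                  ∑[ κ ∈ 𝒫 ] ⟦ strip? κ β ⟧ * ⟦ strip? κ γ ×-dec sum γ ≤? sum κ + a ⟧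
    count γ = begin
      ∑[ σ ∈ 𝒫 ] ⟦ adds? M β a σ ⟧ * ⟦ strip? γ σ ⟧
        ≡⟨ ∑-cong 𝒫 (λ σ → trans (sym (⟦⟧-× (adds? M β a σ) (strip? γ σ)))
             (⟦⟧-cong (adds? M β a σ ×-dec strip? γ σ) (strip? β σ ×-dec strip? γ σ ×-dec sum σ ≟ sum β + a)
               (λ ((x , y) , z) → x , z , y) (λ (x , z , y) → (x , y) , z))) ⟩
      ∑[ σ ∈ 𝒫 ] ⟦ strip? β σ ×-dec strip? γ σ ×-dec sum σ ≟ sum β + a ⟧
        ≡⟨ square-count β γ (≤-trans (+-monoʳ-≤ (sum β) (m≤m+n a (sum α))) h) ⟩
      ∑[ κ ∈ 𝒫 ] ⟦ strip? κ β ×-dec strip? κ γ ×-dec sum β + sum γ ≤? sum κ + (sum β + a) ⟧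
        ≡⟨ ∑-cong 𝒫 (λ κ → trans
             (⟦⟧-cong (strip? κ β ×-dec strip? κ γ ×-dec sum β + sum γ ≤? sum κ + (sum β + a))
               (strip? κ β ×-dec strip? κ γ ×-dec sum γ ≤? sum κ + a)
               (λ (x , y , z) → x , y , +-cancelˡ-≤ (sum β) _ _ (≤-trans z (≤-reflexive (move (sum κ) (sum β) a))))
               (λ (x , y , z) → x , y , ≤-trans (+-monoʳ-≤ (sum β) z) (≤-reflexive (sym (move (sum κ) (sum β) a)))))
             (⟦⟧-× (strip? κ β) (strip? κ γ ×-dec sum γ ≤? sum κ + a))) ⟩
      ∑[ κ ∈ 𝒫 ] ⟦ strip? κ β ⟧ * ⟦ strip? κ γ ×-dec sum γ ≤? sum κ + a ⟧ ∎
      where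
      move : ∀ k b a → k + (b + a) ≡ b + (k + a)
      move = solve-∀
    first : ∀ κ → ∑[ δ ∈ below (a ∷ α) ] kostka ν κ δ ≡
                  ∑[ γ ∈ 𝒫 ] ⟦ strip? κ γ ×-dec sum γ ≤? sum κ + a ⟧ * S γ
    first κ = begin
      ∑[ δ ∈ below (a ∷ α) ] kostka ν κ δ
        ≡⟨ ∑-below a α (kostka ν κ) ⟩
      ∑[ d ∈ upTo (suc a) ] ∑[ δ ∈ below α ] kostka ν κ (d ∷ δ)
        ≡⟨ ∑-cong (upTo (suc a)) (λ d → ∑-cong (below α) λ δ → kostka-cons M ν≤ κ d δ) ⟩
      ∑[ d ∈ upTo (suc a) ] ∑[ δ ∈ below α ] ∑[ γ ∈ 𝒫 ] ⟦ adds? M κ d γ ⟧ * kostka ν γ δ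
        ≡⟨ ∑-cong (upTo (suc a)) (λ d → trans (∑-swap (below α) 𝒫 _)
             (∑-cong 𝒫 λ γ → ∑-*ˡ ⟦ adds? M κ d γ ⟧ (below α) (kostka ν γ))) ⟩
      ∑[ d ∈ upTo (suc a) ] ∑[ γ ∈ 𝒫 ] ⟦ adds? M κ d γ ⟧ * S γ
        ≡⟨ ∑-swap (upTo (suc a)) 𝒫 _ ⟩
      ∑[ γ ∈ 𝒫 ] ∑[ d ∈ upTo (suc a) ] ⟦ adds? M κ d γ ⟧ * S γ
        ≡⟨ ∑-cong 𝒫 (λ γ → trans (∑-*ʳ (S γ) (upTo (suc a)) (λ d → ⟦ adds? M κ d γ ⟧))
             (cong (_* S γ) (∑-sizes κ γ a))) ⟩
      ∑[ γ ∈ 𝒫 ] ⟦ strip? κ γ ×-dec sum γ ≤? sum κ + a ⟧ * S γ ∎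

  lr≢0⇒size : ∀ {β λ′ ν} → Bounded M λ′ → Bounded M ν → lr M β λ′ ν ≢ 0 → sum β + sum λ′ ≡ sum ν
  lr≢0⇒size {β} {λ′} {ν} λ≤ ν≤ ne with sum β + sum λ′ ≟ sum ν
  ... | yes e = e
  ... | no ¬e = ⊥-elim (ne (lr-size M λ≤ (proj₂ ν≤) (proj₁ ν≤) β ¬e))

  module _ {ν : List ℕ} (ν≤ : Bounded M ν) where

    -- On both sides nonzero terms have total size |ν|, so prescribing the size a of the strip
    -- multiplies `lr-pieri` by one common indicator.
    lr-pieri-size : ∀ {λ′ β} → Bounded M λ′ → Bounded M β → ∀ a →
      ∑[ σ ∈ 𝒫 ] ⟦ adds? M λ′ a σ ⟧ * lr M β σ ν ≡ ∑[ τ ∈ 𝒫 ] ⟦ adds? M β a τ ⟧ * lr M τ λ′ ν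
    lr-pieri-size {λ′} {β} λ≤ β≤ a = begin
      ∑[ σ ∈ 𝒫 ] ⟦ adds? M λ′ a σ ⟧ * lr M β σ ν
        ≡⟨ ∑-cong-All (partitions≤-sound M) (λ σ σ≤ → ⟦⟧-*-split
             (adds? M λ′ a σ) (sum β + (sum λ′ + a) ≟ sum ν) (strip? λ′ σ) (lr M β σ ν)
             (λ ne (s , e) → trans (cong (λ z → sum β + z) (sym e)) (lr≢0⇒size σ≤ ν≤ ne) , s)
             (λ ne (e , s) → s , +-cancelˡ-≡ (sum β) _ _ (trans (lr≢0⇒size σ≤ ν≤ ne) (sym e)))) ⟩
      ∑[ σ ∈ 𝒫 ] ⟦ sum β + (sum λ′ + a) ≟ sum ν ⟧ * (⟦ strip? λ′ σ ⟧ * lr M β σ ν)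
        ≡⟨ ∑-*ˡ ⟦ sum β + (sum λ′ + a) ≟ sum ν ⟧ 𝒫 _ ⟩
      ⟦ sum β + (sum λ′ + a) ≟ sum ν ⟧ * (∑[ σ ∈ 𝒫 ] ⟦ strip? λ′ σ ⟧ * lr M β σ ν)
        ≡⟨ cong₂ _*_ (⟦⟧-cong (sum β + (sum λ′ + a) ≟ sum ν) (sum λ′ + (sum β + a) ≟ sum ν)
             (trans (move (sum λ′) (sum β) a)) (trans (move (sum β) (sum λ′) a)))
             (lr-pieri M λ≤ (proj₂ ν≤) β≤) ⟩
      ⟦ sum λ′ + (sum β + a) ≟ sum ν ⟧ * (∑[ τ ∈ 𝒫 ] ⟦ strip? β τ ⟧ * lr M τ λ′ ν)
        ≡⟨ ∑-*ˡ ⟦ sum λ′ + (sum β + a) ≟ sum ν ⟧ 𝒫 _ ⟨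
      ∑[ τ ∈ 𝒫 ] ⟦ sum λ′ + (sum β + a) ≟ sum ν ⟧ * (⟦ strip? β τ ⟧ * lr M τ λ′ ν)
        ≡⟨ ∑-cong 𝒫 (λ τ → ⟦⟧-*-split
             (adds? M β a τ) (sum λ′ + (sum β + a) ≟ sum ν) (strip? β τ) (lr M τ λ′ ν)
             (λ ne (s , e) → trans (cong (λ z → sum λ′ + z) (sym e)) (trans (+-comm (sum λ′) _) (lr≢0⇒size λ≤ ν≤ ne)) , s)
             (λ ne (e , s) → s , +-cancelˡ-≡ (sum λ′) _ _ (trans (+-comm (sum λ′) _) (trans (lr≢0⇒size λ≤ ν≤ ne) (sym e))))) ⟨
      ∑[ τ ∈ 𝒫 ] ⟦ adds? M β a τ ⟧ * lr M τ λ′ ν ∎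
      where
      open ≡-Reasoning
      move : ∀ k b a → k + (b + a) ≡ b + (k + a)
      move = solve-∀

    -- Expands s_λ h_α through the Schur expansion of h_α: `lr-pieri-size` transfers the strips one
    -- by one from λ′ to the tableau shape. The strip added first to λ′ is the last one of τ, which
    -- explains the reversed content in `rkostka`.
    kostka-lr : ∀ α {λ′} → Bounded M λ′ → kostka ν λ′ α ≡ ∑[ τ ∈ 𝒫 ] rkostka τ α * lr M τ λ′ ν
    kostka-lr [] {λ′} λ≤ = sym (begin
      ∑[ τ ∈ 𝒫 ] ⟦ [] ≟ᴸ τ ⟧ * lr M τ λ′ ν
        ≡⟨ ∑-cong 𝒫 (λ τ → cong (_* lr M τ λ′ ν) (⟦⟧-cong ([] ≟ᴸ τ) (τ ≟ᴸ []) sym sym)) ⟩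
      ∑[ τ ∈ 𝒫 ] ⟦ τ ≟ᴸ [] ⟧ * lr M τ λ′ ν
        ≡⟨ ∑-single _≟ᴸ_ (λ τ → lr M τ λ′ ν) (partitions≤-complete {M} ([]-partition , z≤n)) ⟩
      lr M [] λ′ ν
        ≡⟨ lr-[] M λ≤ (proj₂ ν≤) (proj₁ ν≤) ⟩
      ⟦ λ′ ≟ᴸ ν ⟧ ∎)
      where open ≡-Reasoning
    kostka-lr (a ∷ α) {λ′} λ≤ = begin
      kostka ν λ′ (a ∷ α)
        ≡⟨ kostka-cons M ν≤ λ′ a α ⟩
      ∑[ σ ∈ 𝒫 ] ⟦ adds? M λ′ a σ ⟧ * kostka ν σ α
        ≡⟨ ∑-cong-All (partitions≤-sound M) (λ σ σ≤ → cong (⟦ adds? M λ′ a σ ⟧ *_) (kostka-lr α σ≤)) ⟩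
      ∑[ σ ∈ 𝒫 ] ⟦ adds? M λ′ a σ ⟧ * (∑[ β ∈ 𝒫 ] rkostka β α * lr M β σ ν)
        ≡⟨ ∑-exchange 𝒫 𝒫 (λ σ → ⟦ adds? M λ′ a σ ⟧) (λ β → rkostka β α) (λ σ β → lr M β σ ν) ⟩
      ∑[ β ∈ 𝒫 ] rkostka β α * (∑[ σ ∈ 𝒫 ] ⟦ adds? M λ′ a σ ⟧ * lr M β σ ν)
        ≡⟨ ∑-cong-All (partitions≤-sound M) (λ β β≤ → cong (rkostka β α *_) (lr-pieri-size λ≤ β≤ a)) ⟩
      ∑[ β ∈ 𝒫 ] rkostka β α * (∑[ τ ∈ 𝒫 ] ⟦ adds? M β a τ ⟧ * lr M τ λ′ ν)
        ≡⟨ ∑-assoc 𝒫 𝒫 (λ β → rkostka β α) (λ β τ → ⟦ adds? M β a τ ⟧) (λ τ → lr M τ λ′ ν) ⟩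
      ∑[ τ ∈ 𝒫 ] (∑[ β ∈ 𝒫 ] rkostka β α * ⟦ adds? M β a τ ⟧) * lr M τ λ′ ν
        ≡⟨ ∑-cong-All (partitions≤-sound M) (λ τ τ≤ → cong (_* lr M τ λ′ ν) (rkostka-cons M τ≤ a α)) ⟨
      ∑[ τ ∈ 𝒫 ] rkostka τ (a ∷ α) * lr M τ λ′ ν ∎
      where open ≡-Reasoning

-- The coproduct rule

module _ (M : ℕ) where

  private 𝒫 = partitions≤ M

  ∑-rkostka : ∀ α → sum α ≤ M → (f : List ℕ → ℕ) →
              ∑[ τ ∈ partitions (sum α) ] f τ * rkostka τ α ≡ ∑[ τ ∈ 𝒫 ] rkostka τ α * f τ
  ∑-rkostka α h f = begin
    ∑[ τ ∈ partitions (sum α) ] f τ * rkostka τ α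
      ≡⟨ ∑-partitions h _ ⟩
    ∑[ τ ∈ 𝒫 ] ⟦ sum τ ≟ sum α ⟧ * (f τ * rkostka τ α)
      ≡⟨ ∑-cong 𝒫 (λ τ → only τ (sum τ ≟ sum α)) ⟩
    ∑[ τ ∈ 𝒫 ] rkostka τ α * f τ ∎
    where
    open ≡-Reasoning
    only : ∀ τ (e? : Dec (sum τ ≡ sum α)) → ⟦ e? ⟧ * (f τ * rkostka τ α) ≡ rkostka τ α * f τ
    only τ (yes _) = trans (+-identityʳ _) (*-comm (f τ) _)
    only τ (no ne) = sym (cong (_* f τ) (rkostka-size τ α (ne ∘ sym)))

  -- This is `kostka-down` started at the empty partition: no box can be removed there, so skewing
  -- acts on the content alone.
  rkostka-down : ∀ {κ} → Bounded M κ → ∀ α → sum α ≤ M →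
    ∑[ τ ∈ 𝒫 ] rkostka τ α * ⟦ strip? κ τ ⟧ ≡ ∑[ δ ∈ below α ] rkostka κ δ
  rkostka-down {κ} κ≤ α h = begin
    ∑[ τ ∈ 𝒫 ] rkostka τ α * ⟦ strip? κ τ ⟧
      ≡⟨ ∑-cong 𝒫 (λ τ → *-comm (rkostka τ α) _) ⟩
    ∑[ τ ∈ 𝒫 ] ⟦ strip? κ τ ⟧ * rkostka τ α
      ≡⟨ kostka-down M κ≤ (reverse α) ([]-partition , z≤n) (≤-trans (≤-reflexive (sum-reverse α)) h) ⟩
    ∑[ γ ∈ 𝒫 ] ⟦ strip? γ [] ⟧ * (∑[ δ ∈ below (reverse α) ] kostka κ γ δ)
      ≡⟨ ∑-cong-All (partitions≤-sound M) (λ γ (γP , _) → cong (_* (∑[ δ ∈ below (reverse α) ] kostka κ γ δ))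
           (⟦⟧-cong (strip? γ []) (γ ≟ᴸ []) (λ s → sum≡0 γP (n≤0⇒n≡0 (Strip⇒sum≤ s)))
             (λ { refl → strip (λ _ → z≤n , z≤n) }))) ⟩
    ∑[ γ ∈ 𝒫 ] ⟦ γ ≟ᴸ [] ⟧ * (∑[ δ ∈ below (reverse α) ] kostka κ γ δ)
      ≡⟨ ∑-single _≟ᴸ_ (λ γ → ∑[ δ ∈ below (reverse α) ] kostka κ γ δ) (partitions≤-complete {M} ([]-partition , z≤n)) ⟩
    ∑[ δ ∈ below (reverse α) ] kostka κ [] δ
      ≡⟨ ∑-below-reverse α (kostka κ []) ⟩
    ∑[ δ ∈ below α ] rkostka κ δ ∎
    where open ≡-Reasoning

  -- h_k^⊥ (s_λ s_β) = Σ_j (h_j^⊥ s_λ) (h_{k−j}^⊥ s_β)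
  lr-coproduct : ∀ {λ′ β ν} → IsPartition λ′ → Bounded M β → Bounded M ν → sum β + sum λ′ ≤ M →
    ∑[ τ ∈ 𝒫 ] ⟦ strip? ν τ ⟧ * lr M λ′ β τ ≡
    ∑[ κ ∈ 𝒫 ] ⟦ strip? κ λ′ ⟧ * (∑[ γ ∈ 𝒫 ] ⟦ strip? γ β ⟧ * lr M κ γ ν)
  -- Both sides are regarded as functions x and y of λ′. Their sums against the Kostka numbers
  -- express H^⊥ (s_β h_α), by `kostka-down` for x and by `rkostka-down` for y; as this holds for
  -- all α, independence gives x = y.
  lr-coproduct {λ″} {β} {ν} λP β≤ ν≤ h = ℤ.+-injective
    (kostka-independent M n≤M (λ λ′ → + x λ′) (λ λ′ → + y λ′)
      (λ α → trans (sumℤ-+ x (λ λ′ → rkostka λ′ α) (partitions n))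
        (trans (cong +_ (agree α)) (sym (sumℤ-+ y (λ λ′ → rkostka λ′ α) (partitions n)))))
      λP refl)
    where
    open ≡-Reasoning
    n = sum λ″
    n≤M : n ≤ M
    n≤M = ≤-trans (m≤n+m n (sum β)) h
    x y : List ℕ → ℕ
    x λ′ = ∑[ τ ∈ 𝒫 ] ⟦ strip? ν τ ⟧ * lr M λ′ β τ
    z : List ℕ → ℕ
    z κ = ∑[ γ ∈ 𝒫 ] ⟦ strip? γ β ⟧ * lr M κ γ ν
    y λ′ = ∑[ κ ∈ 𝒫 ] ⟦ strip? κ λ′ ⟧ * z κ
    agree : ∀ α → ∑[ λ′ ∈ partitions n ] x λ′ * rkostka λ′ α ≡ ∑[ λ′ ∈ partitions n ] y λ′ * rkostka λ′ α
    agree α with sum α ≟ n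
    ... | no ne = ∑-cong-All (partitions-sound n) (λ { λ′ (_ , e) →
      let k≡0 = rkostka-size λ′ α (λ e′ → ne (trans e′ e)) in
      trans (cong (x λ′ *_) k≡0) (trans (*-zeroʳ (x λ′)) (sym (trans (cong (y λ′ *_) k≡0) (*-zeroʳ (y λ′))))) })
    ... | yes e = begin
      ∑[ λ′ ∈ partitions n ] x λ′ * rkostka λ′ α
        ≡⟨ cong (λ k → ∑[ λ′ ∈ partitions k ] x λ′ * rkostka λ′ α) e ⟨
      ∑[ λ′ ∈ partitions (sum α) ] x λ′ * rkostka λ′ α
        ≡⟨ ∑-rkostka α α≤M x ⟩
      ∑[ λ′ ∈ 𝒫 ] rkostka λ′ α * x λ′
        ≡⟨ ∑-exchange 𝒫 𝒫 (λ λ′ → rkostka λ′ α) (λ τ → ⟦ strip? ν τ ⟧) (λ λ′ τ → lr M λ′ β τ) ⟩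
      ∑[ τ ∈ 𝒫 ] ⟦ strip? ν τ ⟧ * (∑[ λ′ ∈ 𝒫 ] rkostka λ′ α * lr M λ′ β τ)
        ≡⟨ ∑-cong-All (partitions≤-sound M) (λ τ τ≤ → cong (⟦ strip? ν τ ⟧ *_) (kostka-lr M τ≤ α β≤)) ⟨
      ∑[ τ ∈ 𝒫 ] ⟦ strip? ν τ ⟧ * kostka τ β α
        ≡⟨ kostka-down M ν≤ α β≤ (≤-trans (≤-reflexive (cong (λ k → sum β + k) e)) h) ⟩
      ∑[ γ ∈ 𝒫 ] ⟦ strip? γ β ⟧ * (∑[ δ ∈ below α ] kostka ν γ δ)
        ≡⟨ ∑-cong-All (partitions≤-sound M) (λ γ γ≤ → cong (⟦ strip? γ β ⟧ *_)
             (trans (∑-cong (below α) λ δ → kostka-lr M ν≤ δ γ≤) (∑-swap (below α) 𝒫 _))) ⟩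
      ∑[ γ ∈ 𝒫 ] ⟦ strip? γ β ⟧ * (∑[ κ ∈ 𝒫 ] ∑[ δ ∈ below α ] rkostka κ δ * lr M κ γ ν)
        ≡⟨ ∑-cong 𝒫 (λ γ → cong (⟦ strip? γ β ⟧ *_) (∑-cong 𝒫 λ κ → ∑-*ʳ (lr M κ γ ν) (below α) (rkostka κ))) ⟩
      ∑[ γ ∈ 𝒫 ] ⟦ strip? γ β ⟧ * (∑[ κ ∈ 𝒫 ] (∑[ δ ∈ below α ] rkostka κ δ) * lr M κ γ ν)
        ≡⟨ ∑-exchange 𝒫 𝒫 (λ γ → ⟦ strip? γ β ⟧) (λ κ → ∑[ δ ∈ below α ] rkostka κ δ) (λ γ κ → lr M κ γ ν) ⟩
      ∑[ κ ∈ 𝒫 ] (∑[ δ ∈ below α ] rkostka κ δ) * z κ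
        ≡⟨ ∑-cong-All (partitions≤-sound M) (λ κ κ≤ → cong (_* z κ) (rkostka-down κ≤ α α≤M)) ⟨
      ∑[ κ ∈ 𝒫 ] (∑[ λ′ ∈ 𝒫 ] rkostka λ′ α * ⟦ strip? κ λ′ ⟧) * z κ
        ≡⟨ ∑-assoc 𝒫 𝒫 (λ λ′ → rkostka λ′ α) (λ λ′ κ → ⟦ strip? κ λ′ ⟧) z ⟨
      ∑[ λ′ ∈ 𝒫 ] rkostka λ′ α * y λ′
        ≡⟨ ∑-rkostka α α≤M y ⟨
      ∑[ λ′ ∈ partitions (sum α) ] y λ′ * rkostka λ′ α
        ≡⟨ cong (λ k → ∑[ λ′ ∈ partitions k ] y λ′ * rkostka λ′ α) e ⟩
      ∑[ λ′ ∈ partitions n ] y λ′ * rkostka λ′ α ∎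
      where
      α≤M : sum α ≤ M
      α≤M = ≤-trans (≤-reflexive e) n≤M

-- Adding strips to and removing strips from partitions with even columns

-- Partitions all of whose columns have even length.
EvenColumns : List ℕ → Set
EvenColumns []          = ⊤
EvenColumns (x ∷ [])    = ⊥
EvenColumns (x ∷ y ∷ p) = x ≡ y × EvenColumns p

evenColumns? : ∀ p → Dec (EvenColumns p)
evenColumns? []          = yes tt
evenColumns? (x ∷ [])    = no id
evenColumns? (x ∷ y ∷ p) = x ≟ y ×-dec evenColumns? p

-- The only partitions with even columns that arise from p by adding, respectively removing, a
-- horizontal strip. For odd length the missing last row counts as 0.
grow shrink : List ℕ → List ℕ
grow []          = []
grow (x ∷ [])    = x ∷ x ∷ []
grow (x ∷ y ∷ p) = x ∷ x ∷ grow p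
shrink []          = []
shrink (x ∷ [])    = []
shrink (x ∷ y ∷ p) = y ∷ y ∷ shrink p

strip-cons : ∀ {x y κ σ} → x ≤ y → σ ! 0 ≤ x → Strip κ σ → Strip (x ∷ κ) (y ∷ σ)
strip-cons h k s = strip λ { zero → h , k ; (suc i) → at s i }

strip-tail : ∀ {x y κ σ} → Strip (x ∷ κ) (y ∷ σ) → Strip κ σ
strip-tail s = strip (at s ∘ suc)

positive-head : ∀ {x p} → IsPartition (x ∷ p) → ¬ x ≤ 0
positive-head (h ∷ _ , _) = <⇒≱ h

grow-head : ∀ p → grow p ! 0 ≡ p ! 0
grow-head []          = refl
grow-head (x ∷ [])    = refl
grow-head (x ∷ y ∷ p) = refl

shrink-head : ∀ {p} → IsPartition p → shrink p ! 0 ≤ p ! 0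
shrink-head {[]}        P = z≤n
shrink-head {x ∷ []}    P = z≤n
shrink-head {x ∷ y ∷ p} P = decreasing P 0

grow-partition : ∀ {p} → IsPartition p → IsPartition (grow p)
grow-partition {[]}        P = P
grow-partition {x ∷ []}    P@(h ∷ _ , _) = cons-partition h ≤-refl P
grow-partition {x ∷ y ∷ p} P@(h ∷ _ , _) = cons-partition h ≤-refl (cons-partition h
  (≤-trans (≤-reflexive (grow-head p)) (≤-trans (decreasing P 1) (decreasing P 0)))
  (grow-partition (tail-partition (tail-partition P))))

shrink-partition : ∀ {p} → IsPartition p → IsPartition (shrink p)
shrink-partition {[]}        P = P
shrink-partition {x ∷ []}    P = []-partition
shrink-partition {x ∷ y ∷ p} P@(_ ∷ h ∷ _ , _) = cons-partition h ≤-refl (cons-partition h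
  (≤-trans (shrink-head P₂) (decreasing P 1)) (shrink-partition P₂))
  where P₂ = tail-partition (tail-partition P)

grow-even : ∀ p → EvenColumns (grow p)
grow-even []          = tt
grow-even (x ∷ [])    = refl , tt
grow-even (x ∷ y ∷ p) = refl , grow-even p

shrink-even : ∀ p → EvenColumns (shrink p)
shrink-even []          = tt
shrink-even (x ∷ [])    = tt
shrink-even (x ∷ y ∷ p) = refl , shrink-even p

grow-strip : ∀ {p} → IsPartition p → Strip p (grow p)
grow-strip {[]}        P = strip λ _ → z≤n , z≤n
grow-strip {x ∷ []}    P = strip-cons ≤-refl ≤-refl (strip λ { zero → z≤n , z≤n ; (suc _) → z≤n , z≤n })
grow-strip {x ∷ y ∷ p} P = strip-cons ≤-refl ≤-refl (strip-cons (decreasing P 0)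
  (≤-trans (≤-reflexive (grow-head p)) (decreasing P 1)) (grow-strip (tail-partition (tail-partition P))))

shrink-strip : ∀ {p} → IsPartition p → Strip (shrink p) p
shrink-strip {[]}        P = strip λ _ → z≤n , z≤n
shrink-strip {x ∷ []}    P = strip λ { zero → z≤n , z≤n ; (suc _) → z≤n , z≤n }
shrink-strip {x ∷ y ∷ p} P = strip-cons (decreasing P 0) ≤-refl
  (strip-cons ≤-refl (decreasing P 1) (shrink-strip (tail-partition (tail-partition P))))

-- Two equal rows u, u of β are squeezed: the strip forces x ≤ u in the first of them and u ≤ x in
-- the second.
grow-unique : ∀ {γ β} → IsPartition γ → IsPartition β → EvenColumns β → Strip γ β → β ≡ grow γ
grow-unique {[]}        {[]}        γP βP e s = refl
grow-unique {[]}        {u ∷ v ∷ β} γP βP e s = ⊥-elim (positive-head (tail-partition βP) (proj₂ (at s 0)))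
grow-unique {x ∷ γ}     {[]}        γP βP e s = ⊥-elim (positive-head γP (proj₁ (at s 0)))
grow-unique {x ∷ []}    {u ∷ u ∷ β} γP βP (refl , e) s =
  cong₂ (λ u r → u ∷ u ∷ r) (≤-antisym (proj₂ (at s 0)) (proj₁ (at s 0)))
    (grow-unique []-partition (tail-partition (tail-partition βP)) e
      (strip λ i → z≤n , proj₂ (at s (suc (suc i)))))
grow-unique {x ∷ y ∷ γ} {u ∷ u ∷ β} γP βP (refl , e) s =
  cong₂ (λ u r → u ∷ u ∷ r) (≤-antisym (proj₂ (at s 0)) (proj₁ (at s 0)))
    (grow-unique (tail-partition (tail-partition γP)) (tail-partition (tail-partition βP)) e (strip-tail (strip-tail s)))

shrink-unique : ∀ {γ β} → IsPartition γ → IsPartition β → EvenColumns β → Strip β γ → β ≡ shrink γ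
shrink-unique {[]}        {[]}        γP βP e s = refl
shrink-unique {x ∷ []}    {[]}        γP βP e s = refl
shrink-unique {x ∷ y ∷ γ} {[]}        γP βP e s = ⊥-elim (positive-head (tail-partition γP) (proj₂ (at s 0)))
shrink-unique {[]}        {u ∷ v ∷ β} γP βP e s = ⊥-elim (positive-head βP (proj₁ (at s 0)))
shrink-unique {x ∷ []}    {u ∷ v ∷ β} γP βP e s = ⊥-elim (positive-head (tail-partition βP) (proj₁ (at s 1)))
shrink-unique {x ∷ y ∷ γ} {u ∷ u ∷ β} γP βP (refl , e) s =
  cong₂ (λ u r → u ∷ u ∷ r) (≤-antisym (proj₁ (at s 1)) (proj₂ (at s 0)))
    (shrink-unique (tail-partition (tail-partition γP)) (tail-partition (tail-partition βP)) e (strip-tail (strip-tail s)))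

-- As many boxes are added by `grow` as removed by `shrink`, which matches the degrees in h_i^⊥ B =
-- h_i B.
sum-grow-shrink : ∀ p → sum (grow p) + sum (shrink p) ≡ sum p + sum p
sum-grow-shrink []          = refl
sum-grow-shrink (x ∷ [])    = arith x
  where
  arith : ∀ x → x + (x + 0) + 0 ≡ x + 0 + (x + 0)
  arith = solve-∀
sum-grow-shrink (x ∷ y ∷ p) = lin-≡ (sum-grow-shrink p) (arith x y (sum (grow p)) (sum (shrink p)) (sum p))
  where
  arith : ∀ x y g s p → x + (x + g) + (y + (y + s)) + (p + p) ≡ x + (y + p) + (x + (y + p)) + (g + s)
  arith = solve-∀

∑-restrict : ∀ {s M} → s ≤ M → {P : List ℕ → Set} (P? : ∀ p → Dec (P p)) → (∀ {p} → P p → sum p ≤ s) →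
             (f : List ℕ → ℕ) → ∑[ p ∈ partitions≤ s ] ⟦ P? p ⟧ * f p ≡ ∑[ p ∈ partitions≤ M ] ⟦ P? p ⟧ * f p
∑-restrict {s} {M} s≤M P? small f = ∑-reindex _≟ᴸ_ _≟ᴸ_ (partitions≤-sound s) (partitions≤-sound M)
  partitions≤-complete partitions≤-complete P? P? id id
  (λ p (pP , h) Pp → (pP , ≤-trans h s≤M) , Pp , refl , refl)
  (λ p (pP , _) Pp → (pP , small Pp) , Pp , refl)

-- The Schur expansion of `ss`

module _ (M : ℕ) where

  private 𝒫 = partitions≤ M

  -- The coefficient of s_ν in the sum of the ss_{λ,n}.
  coeff : List ℕ → List ℕ → ℕ
  coeff λ′ ν = ∑[ β ∈ 𝒫 ] ⟦ evenColumns? β ⟧ * lr M λ′ β ν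

  coeff-size : ∀ {ν} → Bounded M ν → ∀ {λ′} → sum ν < sum λ′ → coeff λ′ ν ≡ 0
  coeff-size {ν} ν≤ {λ′} h = trans (∑-cong-All (partitions≤-sound M) (λ β β≤ → trans
    (cong (⟦ evenColumns? β ⟧ *_) (lr-size M β≤ (proj₂ ν≤) (proj₁ ν≤) λ′
      (λ e → <⇒≱ h (≤-trans (m≤m+n (sum λ′) (sum β)) (≤-reflexive e)))))
    (*-zeroʳ ⟦ evenColumns? β ⟧))) (∑-zero 𝒫 {f = λ _ → 0} (λ _ → refl))

  coeff-[] : ∀ {ρ} → IsPartition ρ → coeff ρ [] ≡ ⟦ ρ ≟ᴸ [] ⟧
  coeff-[] {[]}    P = begin
    ∑[ β ∈ 𝒫 ] ⟦ evenColumns? β ⟧ * lr M [] β []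
      ≡⟨ ∑-cong-All (partitions≤-sound M) (λ β β≤ → trans
           (cong (⟦ evenColumns? β ⟧ *_) (lr-[] M β≤ z≤n []-partition)) (*-comm ⟦ evenColumns? β ⟧ _)) ⟩
    ∑[ β ∈ 𝒫 ] ⟦ β ≟ᴸ [] ⟧ * ⟦ evenColumns? β ⟧
      ≡⟨ ∑-single _≟ᴸ_ (λ β → ⟦ evenColumns? β ⟧) (partitions≤-complete {M} ([]-partition , z≤n)) ⟩
    1 ∎
    where open ≡-Reasoning
  coeff-[] {x ∷ ρ} P@(h ∷ _ , _) = coeff-size ([]-partition , z≤n) (≤-trans h (m≤m+n x (sum ρ)))

  -- One step of an oscillating tableau: remove a horizontal strip, then add one, a boxes in total.
  hook? : ∀ a ρ σ κ → Dec (Strip κ ρ × Strip κ σ × sum ρ + sum σ ≡ sum κ + sum κ + a)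
  hook? a ρ σ κ = strip? κ ρ ×-dec strip? κ σ ×-dec sum ρ + sum σ ≟ sum κ + sum κ + a

  steps : ℕ → List ℕ → List ℕ → ℕ
  steps a ρ σ = ∑[ κ ∈ 𝒫 ] ⟦ hook? a ρ σ κ ⟧

  -- An oscillation from ρ down to κ and up to σ can be read backwards. `ssot-expansion` relies on
  -- this, because skewing walks through the tableau from its final shape.
  steps-sym : ∀ a ρ σ → steps a ρ σ ≡ steps a σ ρ
  steps-sym a ρ σ = ∑-cong 𝒫 λ κ → ⟦⟧-cong (hook? a ρ σ κ) (hook? a σ ρ κ)
    (λ (x , y , e) → y , x , trans (+-comm (sum σ) (sum ρ)) e)
    (λ (x , y , e) → y , x , trans (+-comm (sum ρ) (sum σ)) e)

  ssotCount-cons : ∀ λ′ ρ a α → sum ρ + a ≤ M →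
    ssotCount λ′ ρ (a ∷ α) ≡ ∑[ σ ∈ 𝒫 ] steps a ρ σ * ssotCount λ′ σ α
  ssotCount-cons λ′ ρ a α h = begin
    ∑[ κ ∈ downs ρ a ] inner κ
      ≡⟨ ∑-filter (λ κ → hstrip κ ρ ∧ ((sum ρ ∸ sum κ) ≤ᵇ a)) (partitions≤ (sum ρ)) inner ⟩
    ∑[ κ ∈ partitions≤ (sum ρ) ] ⟦ down? κ ⟧ * inner κ
      ≡⟨ ∑-restrict (≤-trans (m≤m+n (sum ρ) a) h) down? (Strip⇒sum≤ ∘ proj₁) inner ⟩
    ∑[ κ ∈ 𝒫 ] ⟦ down? κ ⟧ * inner κ
      ≡⟨ ∑-cong 𝒫 (λ κ → trans (⟦⟧-*-cong (down? κ) (λ (s , _) → ∑-ups M κ (r κ)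
           (≤-trans (+-mono-≤ (Strip⇒sum≤ s) (m∸n≤m a (sum ρ ∸ sum κ))) h) (λ σ → ssotCount λ′ σ α)))
           (sym (∑-*ˡ ⟦ down? κ ⟧ 𝒫 _))) ⟩
    ∑[ κ ∈ 𝒫 ] ∑[ σ ∈ 𝒫 ] ⟦ down? κ ⟧ * (⟦ adds? M κ (r κ) σ ⟧ * ssotCount λ′ σ α)
      ≡⟨ ∑-cong 𝒫 (λ κ → ∑-cong 𝒫 λ σ → trans (sym (⟦⟧-×-* (down? κ) (adds? M κ (r κ) σ) _))
           (cong (_* ssotCount λ′ σ α) (⟦⟧-cong (down? κ ×-dec adds? M κ (r κ) σ) (hook? a ρ σ κ)
             (λ ((x , l) , (y , e)) → x , y , to κ σ (Strip⇒sum≤ x) l e)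
             (λ (x , y , e) → let l = fit κ σ (Strip⇒sum≤ y) e in
               (x , l) , (y , from κ σ (Strip⇒sum≤ x) l e))))) ⟩
    ∑[ κ ∈ 𝒫 ] ∑[ σ ∈ 𝒫 ] ⟦ hook? a ρ σ κ ⟧ * ssotCount λ′ σ α
      ≡⟨ ∑-swap 𝒫 𝒫 _ ⟩
    ∑[ σ ∈ 𝒫 ] ∑[ κ ∈ 𝒫 ] ⟦ hook? a ρ σ κ ⟧ * ssotCount λ′ σ α
      ≡⟨ ∑-cong 𝒫 (λ σ → ∑-*ʳ (ssotCount λ′ σ α) 𝒫 (λ κ → ⟦ hook? a ρ σ κ ⟧)) ⟩
    ∑[ σ ∈ 𝒫 ] steps a ρ σ * ssotCount λ′ σ α ∎
    where
    open ≡-Reasoning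
    r : List ℕ → ℕ
    r κ = a ∸ (sum ρ ∸ sum κ)
    inner : List ℕ → ℕ
    inner κ = ∑[ σ ∈ ups κ (r κ) ] ssotCount λ′ σ α
    down? : ∀ κ → Dec (Strip κ ρ × sum ρ ∸ sum κ ≤ a)
    down? κ = strip? κ ρ ×-dec sum ρ ∸ sum κ ≤? a
    removed : ∀ κ → sum κ ≤ sum ρ → sum κ + (sum ρ ∸ sum κ) ≡ sum ρ
    removed κ = m+[n∸m]≡n
    added : ∀ κ → sum ρ ∸ sum κ ≤ a → sum ρ ∸ sum κ + r κ ≡ a
    added κ = m+[n∸m]≡n
    to : ∀ κ σ → sum κ ≤ sum ρ → sum ρ ∸ sum κ ≤ a → sum σ ≡ sum κ + r κ → sum ρ + sum σ ≡ sum κ + sum κ + a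
    to κ σ k l e = lin-≡ (cong₂ _+_ e (cong₂ _+_ (sym (removed κ k)) (added κ l)))
      (arith (sum κ) (sum ρ) (sum σ) (sum ρ ∸ sum κ) (r κ) a)
      where
      arith : ∀ κ ρ σ d r a → ρ + σ + (κ + r + (κ + d + a)) ≡ κ + κ + a + (σ + (ρ + (d + r)))
      arith = solve-∀
    fit : ∀ κ σ → sum κ ≤ sum σ → sum ρ + sum σ ≡ sum κ + sum κ + a → sum ρ ∸ sum κ ≤ a
    fit κ σ k e = m≤n+o⇒m∸n≤o (sum ρ) (sum κ) (lin-≤ 0 (k ⊕ ≤-reflexive e) (arith (sum κ) (sum ρ) (sum σ) a))
      where
      arith : ∀ κ ρ σ a → ρ + (σ + (κ + κ + a)) + 0 ≡ κ + a + (κ + (ρ + σ))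
      arith = solve-∀
    from : ∀ κ σ → sum κ ≤ sum ρ → sum ρ ∸ sum κ ≤ a → sum ρ + sum σ ≡ sum κ + sum κ + a → sum σ ≡ sum κ + r κ
    from κ σ k l e = lin-≡ (cong₂ _+_ e (cong₂ _+_ (removed κ k) (sym (added κ l))))
      (arith (sum κ) (sum ρ) (sum σ) (sum ρ ∸ sum κ) (r κ) a)
      where
      arith : ∀ κ ρ σ d r a → σ + (κ + κ + a + (ρ + (d + r))) ≡ κ + r + (ρ + σ + (κ + d + a))
      arith = solve-∀

  -- h_i^⊥ B = h_i B: both sides have at most one contribution, β = grow γ and β = shrink γ.
  even-count : ∀ {γ ρ κ ν a} → Bounded M γ → Bounded M ν → sum ν + a ≤ M → sum κ + sum γ ≡ sum ν →
    ∑[ β ∈ 𝒫 ] ⟦ evenColumns? β ×-dec strip? γ β ×-dec sum ρ + sum β ≟ sum ν + a ⟧ ≡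
    ∑[ β ∈ 𝒫 ] ⟦ evenColumns? β ×-dec strip? β γ ×-dec sum ρ + sum ν ≟ sum κ + sum κ + a + sum β ⟧
  even-count {γ} {ρ} {κ} {ν} {a} γ≤@(γP , γM) ν≤ h e = begin
    ∑[ β ∈ 𝒫 ] ⟦ up? β ⟧        ≡⟨ ∑-cong 𝒫 (λ β → *-identityʳ ⟦ up? β ⟧) ⟨
    ∑[ β ∈ 𝒫 ] ⟦ up? β ⟧ * 1    ≡⟨ ∑-reindex _≟ᴸ_ _≟ᴸ_ (partitions≤-sound M) (partitions≤-sound M)
      partitions≤-complete partitions≤-complete up? down? (λ _ → shrink γ) (λ _ → grow γ) to from ⟩
    ∑[ β ∈ 𝒫 ] ⟦ down? β ⟧ * 1  ≡⟨ ∑-cong 𝒫 (λ β → *-identityʳ ⟦ down? β ⟧) ⟩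
    ∑[ β ∈ 𝒫 ] ⟦ down? β ⟧      ∎
    where
    open ≡-Reasoning
    up? : ∀ β → Dec (EvenColumns β × Strip γ β × sum ρ + sum β ≡ sum ν + a)
    up? β = evenColumns? β ×-dec strip? γ β ×-dec sum ρ + sum β ≟ sum ν + a
    down? : ∀ β → Dec (EvenColumns β × Strip β γ × sum ρ + sum ν ≡ sum κ + sum κ + a + sum β)
    down? β = evenColumns? β ×-dec strip? β γ ×-dec sum ρ + sum ν ≟ sum κ + sum κ + a + sum β
    to : ∀ β → Bounded M β → EvenColumns β × Strip γ β × sum ρ + sum β ≡ sum ν + a → _
    to β (βP , _) (ev , s , z) with grow-unique γP βP ev s
    ... | refl = (shrink-partition γP , ≤-trans (Strip⇒sum≤ (shrink-strip γP)) γM) ,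
      (shrink-even γ , shrink-strip γP , lin-≡ (cong₂ _+_ z (cong₂ _+_ (sym (sum-grow-shrink γ)) (cong₂ _+_ (sym e) (sym e))))
        (arith (sum ρ) (sum ν) (sum κ) a (sum (grow γ)) (sum (shrink γ)) (sum γ))) , refl , refl
      where
      arith : ∀ ρ ν κ a g s γ → ρ + ν + (ν + a + (g + s + (κ + γ + (κ + γ)))) ≡
                                κ + κ + a + s + (ρ + g + (γ + γ + (ν + ν)))
      arith = solve-∀
    from : ∀ β → Bounded M β → EvenColumns β × Strip β γ × sum ρ + sum ν ≡ sum κ + sum κ + a + sum β → _
    from β (βP , _) (ev , s , z) with shrink-unique γP βP ev s
    ... | refl = (grow-partition γP , ≤-trans (m≤n+m _ (sum ρ)) (≤-trans (≤-reflexive size) h)) ,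
      (grow-even γ , grow-strip γP , size) , refl
      where
      arith : ∀ ρ ν κ a g s γ → ρ + g + (κ + κ + a + s + (γ + γ + (ν + ν))) ≡
                                ν + a + (ρ + ν + (g + s + (κ + γ + (κ + γ))))
      arith = solve-∀
      size : sum ρ + sum (grow γ) ≡ sum ν + a
      size = lin-≡ (cong₂ _+_ z (cong₂ _+_ (sum-grow-shrink γ) (cong₂ _+_ e e)))
        (arith (sum ρ) (sum ν) (sum κ) a (sum (grow γ)) (sum (shrink γ)) (sum γ))

  -- The coefficient of s_ν in h_a^⊥ (s_ρ B), computed in two ways. Within it, `left` distributes
  -- the skewing by `lr-coproduct`, `exchange` replaces skewing of B by multiplication, and `right`
  -- lets that multiplication act on κ by `lr-pieri`.
  coeff-step : ∀ {ρ ν a} → Bounded M ρ → Bounded M ν → sum ν + a ≤ M →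
    ∑[ σ ∈ 𝒫 ] ⟦ adds? M ν a σ ⟧ * coeff ρ σ ≡ ∑[ ρ′ ∈ 𝒫 ] steps a ρ ρ′ * coeff ρ′ ν
  coeff-step {ρ} {ν} {a} ρ≤ ν≤ h = begin
    ∑[ σ ∈ 𝒫 ] ⟦ adds? M ν a σ ⟧ * coeff ρ σ
      ≡⟨ ∑-exchange 𝒫 𝒫 (λ σ → ⟦ adds? M ν a σ ⟧) (λ β → ⟦ evenColumns? β ⟧) (λ σ β → lr M ρ β σ) ⟩
    ∑[ β ∈ 𝒫 ] ⟦ evenColumns? β ⟧ * (∑[ σ ∈ 𝒫 ] ⟦ adds? M ν a σ ⟧ * lr M ρ β σ)
      ≡⟨ ∑-cong-All (partitions≤-sound M) (λ β β≤ → trans (cong (⟦ evenColumns? β ⟧ *_) (left β β≤))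
           (sym (*-assoc ⟦ evenColumns? β ⟧ _ _))) ⟩
    ∑[ β ∈ 𝒫 ] ⟦ evenColumns? β ⟧ * ⟦ D? β ⟧ *
      (∑[ κ ∈ 𝒫 ] ⟦ strip? κ ρ ⟧ * (∑[ γ ∈ 𝒫 ] ⟦ strip? γ β ⟧ * lr M κ γ ν))
      ≡⟨ ∑-exchange 𝒫 𝒫 (λ β → ⟦ evenColumns? β ⟧ * ⟦ D? β ⟧) (λ κ → ⟦ strip? κ ρ ⟧)
           (λ β κ → ∑[ γ ∈ 𝒫 ] ⟦ strip? γ β ⟧ * lr M κ γ ν) ⟩
    ∑[ κ ∈ 𝒫 ] ⟦ strip? κ ρ ⟧ * (∑[ β ∈ 𝒫 ] ⟦ evenColumns? β ⟧ * ⟦ D? β ⟧ *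
      (∑[ γ ∈ 𝒫 ] ⟦ strip? γ β ⟧ * lr M κ γ ν))
      ≡⟨ ∑-cong-All (partitions≤-sound M) (λ κ κ≤ → cong (⟦ strip? κ ρ ⟧ *_) (middle κ κ≤)) ⟩
    ∑[ κ ∈ 𝒫 ] ⟦ strip? κ ρ ⟧ * (∑[ ρ′ ∈ 𝒫 ] ⟦ hook₂? κ ρ′ ⟧ * coeff ρ′ ν)
      ≡⟨ ∑-assoc 𝒫 𝒫 (λ κ → ⟦ strip? κ ρ ⟧) (λ κ ρ′ → ⟦ hook₂? κ ρ′ ⟧) (λ ρ′ → coeff ρ′ ν) ⟩
    ∑[ ρ′ ∈ 𝒫 ] (∑[ κ ∈ 𝒫 ] ⟦ strip? κ ρ ⟧ * ⟦ hook₂? κ ρ′ ⟧) * coeff ρ′ ν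
      ≡⟨ ∑-cong 𝒫 (λ ρ′ → cong (_* coeff ρ′ ν) (∑-cong 𝒫 λ κ → sym (⟦⟧-× (strip? κ ρ) (hook₂? κ ρ′)))) ⟩
    ∑[ ρ′ ∈ 𝒫 ] steps a ρ ρ′ * coeff ρ′ ν ∎
    where
    open ≡-Reasoning
    hook₂? : ∀ κ ρ′ → Dec (Strip κ ρ′ × sum ρ + sum ρ′ ≡ sum κ + sum κ + a)
    hook₂? κ ρ′ = strip? κ ρ′ ×-dec sum ρ + sum ρ′ ≟ sum κ + sum κ + a
    -- Given |κ| + |γ| = |ν|, this says |ρ/κ| + |β/γ| = a, and `E?` says |ρ/κ| + |γ/β| = a. Both are
    -- separate factors because the coproduct and Pieri rules in use sum over all strip sizes.
    D? : ∀ β → Dec (sum ρ + sum β ≡ sum ν + a)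
    D? β = sum ρ + sum β ≟ sum ν + a
    E? : ∀ κ β → Dec (sum ρ + sum ν ≡ sum κ + sum κ + a + sum β)
    E? κ β = sum ρ + sum ν ≟ sum κ + sum κ + a + sum β

    left : ∀ β → Bounded M β → ∑[ σ ∈ 𝒫 ] ⟦ adds? M ν a σ ⟧ * lr M ρ β σ ≡
      ⟦ D? β ⟧ * (∑[ κ ∈ 𝒫 ] ⟦ strip? κ ρ ⟧ * (∑[ γ ∈ 𝒫 ] ⟦ strip? γ β ⟧ * lr M κ γ ν))
    left β β≤ = begin
      ∑[ σ ∈ 𝒫 ] ⟦ adds? M ν a σ ⟧ * lr M ρ β σ
        ≡⟨ ∑-cong-All (partitions≤-sound M) (λ σ σ≤ → ⟦⟧-*-split (adds? M ν a σ) (D? β) (strip? ν σ) (lr M ρ β σ)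
             (λ ne (s , e) → trans (lr≢0⇒size M β≤ σ≤ ne) e , s)
             (λ ne (e , s) → s , trans (sym (lr≢0⇒size M β≤ σ≤ ne)) e)) ⟩
      ∑[ σ ∈ 𝒫 ] ⟦ D? β ⟧ * (⟦ strip? ν σ ⟧ * lr M ρ β σ)
        ≡⟨ ∑-*ˡ ⟦ D? β ⟧ 𝒫 _ ⟩
      ⟦ D? β ⟧ * (∑[ σ ∈ 𝒫 ] ⟦ strip? ν σ ⟧ * lr M ρ β σ)
        ≡⟨ ⟦⟧-*-cong (D? β) (λ e → lr-coproduct M (proj₁ ρ≤) β≤ ν≤
             (≤-trans (≤-reflexive (trans (+-comm (sum β) (sum ρ)) e)) h)) ⟩
      ⟦ D? β ⟧ * (∑[ κ ∈ 𝒫 ] ⟦ strip? κ ρ ⟧ * (∑[ γ ∈ 𝒫 ] ⟦ strip? γ β ⟧ * lr M κ γ ν)) ∎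

    merge : {A B C : Set} (A? : Dec A) (B? : Dec B) (C? : Dec C) → ⟦ A? ⟧ * ⟦ B? ⟧ * ⟦ C? ⟧ ≡ ⟦ A? ×-dec C? ×-dec B? ⟧
    merge A? B? C? = trans (*-assoc ⟦ A? ⟧ _ _) (trans
      (cong (⟦ A? ⟧ *_) (trans (*-comm ⟦ B? ⟧ _) (sym (⟦⟧-× C? B?)))) (sym (⟦⟧-× A? (C? ×-dec B?))))

    middle : ∀ κ → Bounded M κ →
      ∑[ β ∈ 𝒫 ] ⟦ evenColumns? β ⟧ * ⟦ D? β ⟧ * (∑[ γ ∈ 𝒫 ] ⟦ strip? γ β ⟧ * lr M κ γ ν) ≡
      ∑[ ρ′ ∈ 𝒫 ] ⟦ hook₂? κ ρ′ ⟧ * coeff ρ′ ν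
    middle κ κ≤ = begin
      ∑[ β ∈ 𝒫 ] ⟦ evenColumns? β ⟧ * ⟦ D? β ⟧ * (∑[ γ ∈ 𝒫 ] ⟦ strip? γ β ⟧ * lr M κ γ ν)
        ≡⟨ ∑-assoc 𝒫 𝒫 (λ β → ⟦ evenColumns? β ⟧ * ⟦ D? β ⟧) (λ β γ → ⟦ strip? γ β ⟧) (λ γ → lr M κ γ ν) ⟩
      ∑[ γ ∈ 𝒫 ] (∑[ β ∈ 𝒫 ] ⟦ evenColumns? β ⟧ * ⟦ D? β ⟧ * ⟦ strip? γ β ⟧) * lr M κ γ ν
        ≡⟨ ∑-cong-All (partitions≤-sound M) (λ γ γ≤ → exchange γ γ≤ (lr M κ γ ν ≟ 0)) ⟩
      ∑[ γ ∈ 𝒫 ] (∑[ β ∈ 𝒫 ] ⟦ evenColumns? β ⟧ * ⟦ E? κ β ⟧ * ⟦ strip? β γ ⟧) * lr M κ γ ν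
        ≡⟨ ∑-assoc 𝒫 𝒫 (λ β → ⟦ evenColumns? β ⟧ * ⟦ E? κ β ⟧) (λ β γ → ⟦ strip? β γ ⟧) (λ γ → lr M κ γ ν) ⟨
      ∑[ β ∈ 𝒫 ] ⟦ evenColumns? β ⟧ * ⟦ E? κ β ⟧ * (∑[ γ ∈ 𝒫 ] ⟦ strip? β γ ⟧ * lr M κ γ ν)
        ≡⟨ ∑-cong-All (partitions≤-sound M) (λ β β≤ → trans
             (*-assoc ⟦ evenColumns? β ⟧ _ _) (cong (⟦ evenColumns? β ⟧ *_) (right β β≤))) ⟩
      ∑[ β ∈ 𝒫 ] ⟦ evenColumns? β ⟧ * (∑[ ρ′ ∈ 𝒫 ] ⟦ hook₂? κ ρ′ ⟧ * lr M ρ′ β ν)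
        ≡⟨ ∑-exchange 𝒫 𝒫 (λ β → ⟦ evenColumns? β ⟧) (λ ρ′ → ⟦ hook₂? κ ρ′ ⟧) (λ β ρ′ → lr M ρ′ β ν) ⟩
      ∑[ ρ′ ∈ 𝒫 ] ⟦ hook₂? κ ρ′ ⟧ * coeff ρ′ ν ∎
      where
      exchange : ∀ γ → Bounded M γ → Dec (lr M κ γ ν ≡ 0) →
        (∑[ β ∈ 𝒫 ] ⟦ evenColumns? β ⟧ * ⟦ D? β ⟧ * ⟦ strip? γ β ⟧) * lr M κ γ ν ≡
        (∑[ β ∈ 𝒫 ] ⟦ evenColumns? β ⟧ * ⟦ E? κ β ⟧ * ⟦ strip? β γ ⟧) * lr M κ γ ν
      exchange γ γ≤ (yes z) rewrite z = trans (*-zeroʳ (∑[ β ∈ 𝒫 ] ⟦ evenColumns? β ⟧ * ⟦ D? β ⟧ * ⟦ strip? γ β ⟧))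
        (sym (*-zeroʳ (∑[ β ∈ 𝒫 ] ⟦ evenColumns? β ⟧ * ⟦ E? κ β ⟧ * ⟦ strip? β γ ⟧)))
      exchange γ γ≤ (no ne) = cong (_* lr M κ γ ν) (trans
        (∑-cong 𝒫 λ β → merge (evenColumns? β) (D? β) (strip? γ β)) (trans
        (even-count {γ} {ρ} {κ} {ν} {a} γ≤ ν≤ h (lr≢0⇒size M γ≤ ν≤ ne))
        (∑-cong 𝒫 λ β → sym (merge (evenColumns? β) (E? κ β) (strip? β γ)))))
      right : ∀ β → Bounded M β → ⟦ E? κ β ⟧ * (∑[ γ ∈ 𝒫 ] ⟦ strip? β γ ⟧ * lr M κ γ ν) ≡
                                  ∑[ ρ′ ∈ 𝒫 ] ⟦ hook₂? κ ρ′ ⟧ * lr M ρ′ β ν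
      right β β≤ = begin
        ⟦ E? κ β ⟧ * (∑[ γ ∈ 𝒫 ] ⟦ strip? β γ ⟧ * lr M κ γ ν)
          ≡⟨ cong (⟦ E? κ β ⟧ *_) (lr-pieri M β≤ (proj₂ ν≤) κ≤) ⟩
        ⟦ E? κ β ⟧ * (∑[ ρ′ ∈ 𝒫 ] ⟦ strip? κ ρ′ ⟧ * lr M ρ′ β ν)
          ≡⟨ ∑-*ˡ ⟦ E? κ β ⟧ 𝒫 _ ⟨
        ∑[ ρ′ ∈ 𝒫 ] ⟦ E? κ β ⟧ * (⟦ strip? κ ρ′ ⟧ * lr M ρ′ β ν)
          ≡⟨ ∑-cong 𝒫 (λ ρ′ → ⟦⟧-*-split (hook₂? κ ρ′) (E? κ β) (strip? κ ρ′) (lr M ρ′ β ν)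
               (λ ne (s , e) → lin-≡ (cong₂ _+_ e (sym (lr≢0⇒size M β≤ ν≤ ne)))
                 (arith (sum ρ) (sum ρ′) (sum κ) a (sum β) (sum ν)) , s)
               (λ ne (e , s) → s , lin-≡ (cong₂ _+_ e (lr≢0⇒size M β≤ ν≤ ne))
                 (arith′ (sum ρ) (sum ρ′) (sum κ) a (sum β) (sum ν)))) ⟨
        ∑[ ρ′ ∈ 𝒫 ] ⟦ hook₂? κ ρ′ ⟧ * lr M ρ′ β ν ∎
        where
        arith : ∀ ρ ρ′ κ a β ν → ρ + ν + (κ + κ + a + (ρ′ + β)) ≡ κ + κ + a + β + (ρ + ρ′ + ν)
        arith = solve-∀
        arith′ : ∀ ρ ρ′ κ a β ν → ρ + ρ′ + (κ + κ + a + β + ν) ≡ κ + κ + a + (ρ + ν + (ρ′ + β))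
        arith′ = solve-∀

  -- The coefficient of s_ν in h_α^⊥ (s_λ B), where `coeff-step` removes the entries of α in turn. A
  -- general ν is needed for the induction; at ν = [] only ρ = [] survives on the right, by
  -- `coeff-[]`.
  ssot-expansion : ∀ α {λ′ ν} → Bounded M λ′ → Bounded M ν → sum ν + sum α ≤ M →
    ∑[ τ ∈ 𝒫 ] kostka τ ν α * coeff λ′ τ ≡ ∑[ ρ ∈ 𝒫 ] ssotCount λ′ ρ α * coeff ρ ν
  ssot-expansion [] {λ′} {ν} λ≤ ν≤ h = begin
    ∑[ τ ∈ 𝒫 ] ⟦ ν ≟ᴸ τ ⟧ * coeff λ′ τ
      ≡⟨ ∑-cong 𝒫 (λ τ → cong (_* coeff λ′ τ) (⟦⟧-cong (ν ≟ᴸ τ) (τ ≟ᴸ ν) sym sym)) ⟩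
    ∑[ τ ∈ 𝒫 ] ⟦ τ ≟ᴸ ν ⟧ * coeff λ′ τ
      ≡⟨ ∑-single _≟ᴸ_ (coeff λ′) (partitions≤-complete ν≤) ⟩
    coeff λ′ ν
      ≡⟨ ∑-single _≟ᴸ_ (λ ρ → coeff ρ ν) (partitions≤-complete λ≤) ⟨
    ∑[ ρ ∈ 𝒫 ] ⟦ ρ ≟ᴸ λ′ ⟧ * coeff ρ ν ∎
    where open ≡-Reasoning
  ssot-expansion (a ∷ α) {λ′} {ν} λ≤ ν≤ h = begin
    ∑[ τ ∈ 𝒫 ] kostka τ ν (a ∷ α) * coeff λ′ τ
      ≡⟨ ∑-cong-All (partitions≤-sound M) (λ τ τ≤ → cong (_* coeff λ′ τ) (kostka-cons M τ≤ ν a α)) ⟩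
    ∑[ τ ∈ 𝒫 ] (∑[ σ ∈ 𝒫 ] ⟦ adds? M ν a σ ⟧ * kostka τ σ α) * coeff λ′ τ
      ≡⟨ ∑-assoc 𝒫 𝒫 (λ σ → ⟦ adds? M ν a σ ⟧) (λ σ τ → kostka τ σ α) (coeff λ′) ⟨
    ∑[ σ ∈ 𝒫 ] ⟦ adds? M ν a σ ⟧ * (∑[ τ ∈ 𝒫 ] kostka τ σ α * coeff λ′ τ)
      ≡⟨ ∑-cong-All (partitions≤-sound M) (λ σ σ≤ → ⟦⟧-*-cong (adds? M ν a σ) λ (_ , e) →
           ssot-expansion α λ≤ σ≤ (≤-trans (≤-reflexive (trans (cong (_+ sum α) e) (+-assoc (sum ν) a (sum α)))) h)) ⟩
    ∑[ σ ∈ 𝒫 ] ⟦ adds? M ν a σ ⟧ * (∑[ ρ ∈ 𝒫 ] ssotCount λ′ ρ α * coeff ρ σ)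
      ≡⟨ ∑-exchange 𝒫 𝒫 (λ σ → ⟦ adds? M ν a σ ⟧) (λ ρ → ssotCount λ′ ρ α) (λ σ ρ → coeff ρ σ) ⟩
    ∑[ ρ ∈ 𝒫 ] ssotCount λ′ ρ α * (∑[ σ ∈ 𝒫 ] ⟦ adds? M ν a σ ⟧ * coeff ρ σ)
      ≡⟨ ∑-cong-All (partitions≤-sound M) (λ ρ ρ≤ → cong (ssotCount λ′ ρ α *_)
           (coeff-step ρ≤ ν≤ (≤-trans (+-monoʳ-≤ (sum ν) (m≤m+n a (sum α))) h))) ⟩
    ∑[ ρ ∈ 𝒫 ] ssotCount λ′ ρ α * (∑[ ρ′ ∈ 𝒫 ] steps a ρ ρ′ * coeff ρ′ ν)
      ≡⟨ ∑-assoc 𝒫 𝒫 (λ ρ → ssotCount λ′ ρ α) (λ ρ ρ′ → steps a ρ ρ′) (λ ρ′ → coeff ρ′ ν) ⟩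
    ∑[ ρ′ ∈ 𝒫 ] (∑[ ρ ∈ 𝒫 ] ssotCount λ′ ρ α * steps a ρ ρ′) * coeff ρ′ ν
      ≡⟨ ∑-cong 𝒫 (λ ρ′ → fold ρ′ (sum ρ′ ≤? sum ν)) ⟩
    ∑[ ρ′ ∈ 𝒫 ] ssotCount λ′ ρ′ (a ∷ α) * coeff ρ′ ν ∎
    where
    open ≡-Reasoning
    -- For larger ρ′ the bound required by `ssotCount-cons` may fail, but then `coeff ρ′ ν` is zero.
    fold : ∀ ρ′ → Dec (sum ρ′ ≤ sum ν) →
      (∑[ ρ ∈ 𝒫 ] ssotCount λ′ ρ α * steps a ρ ρ′) * coeff ρ′ ν ≡ ssotCount λ′ ρ′ (a ∷ α) * coeff ρ′ ν
    fold ρ′ (no big) rewrite coeff-size ν≤ {ρ′} (≰⇒> big) =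
      trans (*-zeroʳ (∑[ ρ ∈ 𝒫 ] ssotCount λ′ ρ α * steps a ρ ρ′)) (sym (*-zeroʳ (ssotCount λ′ ρ′ (a ∷ α))))
    fold ρ′ (yes le) = cong (_* coeff ρ′ ν) (sym (trans
      (ssotCount-cons λ′ ρ′ a α (≤-trans (+-mono-≤ le (m≤m+n a (sum α))) h))
      (∑-cong 𝒫 λ ρ → trans (*-comm (steps a ρ′ ρ) _) (cong (ssotCount λ′ ρ α *_) (steps-sym a ρ′ ρ)))))

  ssotCount-kostka : ∀ α {λ′} → Bounded M λ′ → sum α ≤ M →
    ssotCount λ′ [] α ≡ ∑[ τ ∈ 𝒫 ] kostka τ [] α * coeff λ′ τ
  ssotCount-kostka α {λ′} λ≤ h = sym (begin
    ∑[ τ ∈ 𝒫 ] kostka τ [] α * coeff λ′ τ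
      ≡⟨ ssot-expansion α λ≤ ([]-partition , z≤n) h ⟩
    ∑[ ρ ∈ 𝒫 ] ssotCount λ′ ρ α * coeff ρ []
      ≡⟨ ∑-cong-All (partitions≤-sound M) (λ ρ (ρP , _) → trans
           (cong (ssotCount λ′ ρ α *_) (coeff-[] ρP)) (*-comm (ssotCount λ′ ρ α) _)) ⟩
    ∑[ ρ ∈ 𝒫 ] ⟦ ρ ≟ᴸ [] ⟧ * ssotCount λ′ ρ α
      ≡⟨ ∑-single _≟ᴸ_ (λ ρ → ssotCount λ′ ρ α) (partitions≤-complete {M} ([]-partition , z≤n)) ⟩
    ssotCount λ′ [] α ∎)
    where open ≡-Reasoning

-- Persistence of constituents from n to n + 2

patterns-mono : ∀ M ν ss {F G} → (∀ a b → Patterns.Levels M ν ss a b → F a b ≤ G a b) →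
                Patterns.patterns M ν ss F ≤ Patterns.patterns M ν ss G
patterns-mono M ν []       h = h [] [] (record
  { bounded₁ = []-partition , z≤n ; bounded₂ = []-partition , z≤n
  ; strip₁₂ = strip (λ i → z≤n , z≤n) ; size = refl })
patterns-mono M ν (s ∷ ss) {F} {G} h = patterns-mono M ν ss λ a b L → let open Levels L in
  ∑-mono-All (partitions≤-sound M) λ c c≤ → ⟦⟧-*-mono (st a b c) (st a b c) id
    λ (bc , e , _) → h b c (record
      { bounded₁ = bounded₂ ; bounded₂ = c≤ ; strip₁₂ = bc ; size = step-size ss b c s size e })
  where
  open Patterns M ν
  st = step? (length ss) s (previous ss)
  ∑-mono-All : {A : Set} {P : A → Set} {xs : List A} {f g : A → ℕ} →
               All P xs → (∀ x → P x → f x ≤ g x) → ∑ xs f ≤ ∑ xs g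
  ∑-mono-All []         h = z≤n
  ∑-mono-All (px ∷ pxs) h = +-mono-≤ (h _ px) (∑-mono-All pxs h)

∑-partitions≤-mono : ∀ {M M′} → M ≤ M′ → ∀ f → ∑ (partitions≤ M) f ≤ ∑ (partitions≤ M′) f
∑-partitions≤-mono {M} {M′} h f = begin
  ∑ (partitions≤ M) f
    ≡⟨ ∑-cong-All (partitions≤-sound M) (λ p (_ , p≤) →
         trans (sym (*-identityˡ (f p))) (cong (_* f p) (sym (⟦⟧-yes (sum p ≤? M) p≤)))) ⟩
  ∑[ p ∈ partitions≤ M ] ⟦ sum p ≤? M ⟧ * f p
    ≡⟨ ∑-restrict h (λ p → sum p ≤? M) id f ⟩
  ∑[ p ∈ partitions≤ M′ ] ⟦ sum p ≤? M ⟧ * f p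
    ≤⟨ ∑-mono (partitions≤ M′) (λ p → ≤-trans (⟦⟧-*-mono (sum p ≤? M) (yes tt) {f p} (λ _ → tt) (λ _ → ≤-refl))
         (≤-reflexive (+-identityʳ (f p)))) ⟩
  ∑ (partitions≤ M′) f ∎
  where open ≤-Reasoning

-- A row in which β and ν agree receives no letter, so every pattern can be continued by repeating
-- its last level. The hypothesis on the preceding row is what the lattice condition asks in this
-- case.
patterns-stay : ∀ M {β ν} i → β ! i ≡ ν ! i → β ! i ≤ Patterns.previous M ν (Patterns.rows M ν β i) →
  (F : List ℕ → ℕ) → Patterns.patterns M ν (Patterns.rows M ν β i) (λ a b → F b) ≤
                     Patterns.patterns M ν (Patterns.rows M ν β (suc i)) (λ a b → F b)
patterns-stay M {β} {ν} i e h F = patterns-mono M ν (rows β i) λ a b L → let open Levels L in begin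
  F b
    ≡⟨ *-identityˡ (F b) ⟨
  1 * F b
    ≡⟨ cong (_* F b) (⟦⟧-yes (st a b b) (Strip-refl (decreasing (proj₁ bounded₂)) ,
         cong (λ z → sum b + z) (trans e (cong (ν !_) (sym (length-rows β i)))) ,
         good λ j → +-mono-≤ h (+-monoʳ-≤ (b ∥ suc j) (psum-mono j (proj₁ ∘ at strip₁₂))))) ⟨
  ⟦ st a b b ⟧ * F b
    ≤⟨ ∑-term (λ c → ⟦ st a b c ⟧ * F c) (partitions≤-complete bounded₂) ⟩
  ∑[ c ∈ 𝒫 ] ⟦ st a b c ⟧ * F c ∎
  where
  open Patterns M ν
  open ≤-Reasoning
  st = step? (length (rows β i)) (β ! i) (previous (rows β i))

addColumn : List ℕ → List ℕ
addColumn []          = 1 ∷ 1 ∷ []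
addColumn (x ∷ [])    = suc x ∷ 1 ∷ []
addColumn (x ∷ y ∷ p) = suc x ∷ suc y ∷ p

column : ℕ → ℕ
column 0             = 1
column 1             = 1
column (suc (suc i)) = 0

addColumn-! : ∀ p i → addColumn p ! i ≡ p ! i + column i
addColumn-! []          0             = refl
addColumn-! []          1             = refl
addColumn-! []          (suc (suc i)) = refl
addColumn-! (x ∷ [])    0             = +-comm 1 x
addColumn-! (x ∷ [])    1             = refl
addColumn-! (x ∷ [])    (suc (suc i)) = refl
addColumn-! (x ∷ y ∷ p) 0             = +-comm 1 x
addColumn-! (x ∷ y ∷ p) 1             = +-comm 1 y
addColumn-! (x ∷ y ∷ p) (suc (suc i)) = sym (+-identityʳ (p ! i))

addColumn-partition : ∀ {p} → IsPartition p → IsPartition (addColumn p)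
addColumn-partition {[]}        P = cons-partition ≤-refl ≤-refl (cons-partition ≤-refl z≤n P)
addColumn-partition {x ∷ []}    P = cons-partition (s≤s z≤n) (s≤s z≤n) (cons-partition ≤-refl z≤n []-partition)
addColumn-partition {x ∷ y ∷ p} P = cons-partition (s≤s z≤n) (s≤s (decreasing P 0))
  (cons-partition (s≤s z≤n) (m≤n⇒m≤1+n (decreasing P 1)) (tail-partition (tail-partition P)))

sum-addColumn : ∀ p → sum (addColumn p) ≡ suc (suc (sum p))
sum-addColumn []          = refl
sum-addColumn (x ∷ [])    = cong suc (+-suc x 0)
sum-addColumn (x ∷ y ∷ p) = cong suc (+-suc x (y + sum p))

addColumn-even : ∀ p → EvenColumns p → EvenColumns (addColumn p)
addColumn-even []          _       = refl , tt
addColumn-even (x ∷ y ∷ p) (e , h) = cong suc e , h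

addColumn-bounded : ∀ {M p} → Bounded M p → Bounded (2 + M) (addColumn p)
addColumn-bounded {p = p} (P , h) = addColumn-partition P , ≤-trans (≤-reflexive (sum-addColumn p)) (s≤s (s≤s h))

-- The patterns counted by c^ν_{λ,β} also stay within β + (1,1) and end at ν + (1,1).
module _ (M : ℕ) {β ν : List ℕ} (β≤ : Bounded M β) (ν≤ : Bounded M ν) where
  private
    module P = Patterns M ν
    module Q = Patterns (2 + M) (addColumn ν)
    β⁺ = addColumn β

  -- Adding (1,1) never shrinks the gap between two consecutive rows, and this gap is the slack in
  -- the lattice condition. For row 0 the gap is kept by the fictitious row growing from M to 2 + M.
  previous-addColumn : ∀ i → P.previous (P.rows β i) + column i ≤ Q.previous (Q.rows β⁺ i)
  previous-addColumn 0 = ≤-trans (≤-reflexive (+-comm M 1)) (m≤n+m (1 + M) 1)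
  previous-addColumn 1 = ≤-reflexive (sym (addColumn-! β 0))
  previous-addColumn (suc (suc i)) =
    ≤-trans (+-monoʳ-≤ (β ! suc i) z≤n) (≤-reflexive (sym (addColumn-! β (suc i))))

  patterns-addColumn : ∀ i F → P.patterns (P.rows β i) F ≤ Q.patterns (Q.rows β⁺ i) F
  patterns-addColumn zero    F = ≤-refl
  patterns-addColumn (suc i) F = ≤-trans (patterns-addColumn i _) (patterns-mono (2 + M) (addColumn ν) (Q.rows β⁺ i)
    λ a b _ → ≤-trans
      (∑-mono P.𝒫 λ c → ⟦⟧-*-mono (P.step? (length (P.rows β i)) (β ! i) (P.previous (P.rows β i)) a b c)
        (Q.step? (length (Q.rows β⁺ i)) (β⁺ ! i) (Q.previous (Q.rows β⁺ i)) a b c)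
        (λ (s , e , g) → s , size b c e , wider g) (λ _ → ≤-refl))
      (∑-partitions≤-mono (m≤n+m M 2) _))
    where
    size : ∀ b c → sum c + β ! i ≡ sum b + ν ! length (P.rows β i) →
           sum c + β⁺ ! i ≡ sum b + addColumn ν ! length (Q.rows β⁺ i)
    size b c e rewrite P.length-rows β i | Q.length-rows β⁺ i | addColumn-! β i | addColumn-! ν i =
      trans (sym (+-assoc (sum c) (β ! i) (column i)))
        (trans (cong (_+ column i) e) (+-assoc (sum b) (ν ! i) (column i)))
    wider : ∀ {a b c} → Good (β ! i) (P.previous (P.rows β i)) a b c → Good (β⁺ ! i) (Q.previous (Q.rows β⁺ i)) a b c
    wider {a} {b} {c} g = good λ j → lin-≤ 0
      (Good.bound g j ⊕ previous-addColumn i ⊕ ≤-reflexive (addColumn-! β i))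
      (arith (β⁺ ! i) (β ! i) (column i) (P.previous (P.rows β i)) (Q.previous (Q.rows β⁺ i))
        (c ∥ suc j + a ∥ j) (b ∥ suc j + b ∥ j))
      where
      arith : ∀ s⁺ s k p q x y → s⁺ + x + (p + y + (q + (s + k))) + 0 ≡ q + y + (s + x + (p + k + s⁺))
      arith = solve-∀

  lr-addColumn : ∀ λ′ → lr M λ′ β ν ≤ lr (2 + M) λ′ β⁺ (addColumn ν)
  -- The larger bound 2 + M demands two more rows. There β and ν vanish, hence their enlargements
  -- agree and no letter is added.
  lr-addColumn λ′ = ≤-trans (patterns-addColumn M _) (≤-trans (stay M ≤-refl) (stay (suc M) (n≤1+n M)))
    where
    vanish : ∀ {p i} → Bounded M p → M ≤ i → p ! i ≡ 0
    vanish {p} (P , h) l = !-beyond p (≤-trans (length≤sum P) (≤-trans h l))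
    decreasing⁺ : ∀ i → β⁺ ! i ≤ Q.previous (Q.rows β⁺ i)
    decreasing⁺ zero    = ≤-trans (first≤sum β⁺) (proj₂ (addColumn-bounded β≤))
    decreasing⁺ (suc i) = decreasing (addColumn-partition (proj₁ β≤)) i
    stay : ∀ i → M ≤ i → Q.patterns (Q.rows β⁺ i) (λ a b → ⟦ b ≟ᴸ λ′ ⟧) ≤
                         Q.patterns (Q.rows β⁺ (suc i)) (λ a b → ⟦ b ≟ᴸ λ′ ⟧)
    stay i l = patterns-stay (2 + M) i (trans (addColumn-! β i) (trans
      (cong (_+ column i) (trans (vanish β≤ l) (sym (vanish ν≤ l)))) (sym (addColumn-! ν i))))
      (decreasing⁺ i) (λ b → ⟦ b ≟ᴸ λ′ ⟧)

lr⇒coeff : ∀ {M λ′ β ν} → Bounded M β → EvenColumns β → lr M λ′ β ν ≢ 0 → coeff M λ′ ν ≢ 0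
lr⇒coeff {M} {λ′} {β} {ν} β≤ ev ne e = ne (n≤0⇒n≡0 (begin
  lr M λ′ β ν                                  ≡⟨ *-identityˡ _ ⟨
  1 * lr M λ′ β ν                              ≡⟨ cong (_* lr M λ′ β ν) (⟦⟧-yes (evenColumns? β) ev) ⟨
  ⟦ evenColumns? β ⟧ * lr M λ′ β ν             ≤⟨ ∑-term (λ β → ⟦ evenColumns? β ⟧ * lr M λ′ β ν) (partitions≤-complete β≤) ⟩
  coeff M λ′ ν                                 ≡⟨ e ⟩
  0                                            ∎))
  where open ≤-Reasoning

coeff-addColumn : ∀ {M λ′ ν} → Bounded M ν → coeff M λ′ ν ≢ 0 → coeff (2 + M) λ′ (addColumn ν) ≢ 0
coeff-addColumn {M} {λ′} {ν} ν≤ ne with ∑-positive (partitions≤-sound M) ne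
... | β , β≤ , ne′ with ⟦⟧-*-≢0 (evenColumns? β) ne′
... | ev , lr≢0 = lr⇒coeff {2 + M} {λ′} {addColumn β} {addColumn ν} (addColumn-bounded β≤) (addColumn-even β ev)
  λ z → lr≢0 (n≤0⇒n≡0 (≤-trans (lr-addColumn M β≤ ν≤ λ′) (≤-reflexive z)))

-- A common constituent: β = (m,m,…,1,1) and ν = β + (1,0,1,0,…,1,0). The m boxes of ν/β lie in
-- distinct rows and columns, so c^ν_{λ,β} is the number of standard tableaux of shape λ, for every λ of size m.

stair stair⁺ : ℕ → List ℕ
stair zero     = []
stair (suc k)  = suc k ∷ suc k ∷ stair k
stair⁺ zero    = []
stair⁺ (suc k) = suc (suc k) ∷ suc k ∷ stair⁺ k

double : ℕ → ℕ
double zero    = 0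
double (suc t) = suc (suc (double t))

stair-even : ∀ m → EvenColumns (stair m)
stair-even zero    = tt
stair-even (suc k) = refl , stair-even k

stair-!₀ : ∀ m t → stair m ! double t ≡ m ∸ t
stair-!₀ zero    t       = sym (0∸n≡0 t)
stair-!₀ (suc k) zero    = refl
stair-!₀ (suc k) (suc t) = stair-!₀ k t

stair-!₁ : ∀ m t → stair m ! suc (double t) ≡ m ∸ t
stair-!₁ zero    t       = sym (0∸n≡0 t)
stair-!₁ (suc k) zero    = refl
stair-!₁ (suc k) (suc t) = stair-!₁ k t

stair⁺-!₀ : ∀ {m t} → t < m → stair⁺ m ! double t ≡ suc (m ∸ t)
stair⁺-!₀ {suc k} {zero}  _       = refl
stair⁺-!₀ {suc k} {suc t} (s≤s h) = stair⁺-!₀ h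

stair⁺-!₁ : ∀ m t → stair⁺ m ! suc (double t) ≡ m ∸ t
stair⁺-!₁ zero    t       = sym (0∸n≡0 t)
stair⁺-!₁ (suc k) zero    = refl
stair⁺-!₁ (suc k) (suc t) = stair⁺-!₁ k t

stair-head : ∀ k → stair k ! 0 ≤ suc k
stair-head zero    = z≤n
stair-head (suc k) = n≤1+n (suc k)

stair⁺-head : ∀ k → stair⁺ k ! 0 ≤ suc k
stair⁺-head zero    = z≤n
stair⁺-head (suc k) = ≤-refl

stair-partition : ∀ m → IsPartition (stair m)
stair-partition zero    = []-partition
stair-partition (suc k) = cons-partition (s≤s z≤n) ≤-refl (cons-partition (s≤s z≤n) (stair-head k) (stair-partition k))

stair⁺-partition : ∀ m → IsPartition (stair⁺ m)
stair⁺-partition zero    = []-partition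
stair⁺-partition (suc k) = cons-partition (s≤s z≤n) (n≤1+n (suc k))
  (cons-partition (s≤s z≤n) (stair⁺-head k) (stair⁺-partition k))

length-stair : ∀ m → length (stair m) ≡ double m
length-stair zero    = refl
length-stair (suc k) = cong (suc ∘ suc) (length-stair k)

length-stair⁺ : ∀ m → length (stair⁺ m) ≡ double m
length-stair⁺ zero    = refl
length-stair⁺ (suc k) = cong (suc ∘ suc) (length-stair⁺ k)

sum-stair⁺ : ∀ m → sum (stair⁺ m) ≡ m + sum (stair m)
sum-stair⁺ zero    = refl
sum-stair⁺ (suc k) = lin-≡ (sum-stair⁺ k) (arith k (sum (stair⁺ k)) (sum (stair k)))
  where
  arith : ∀ k s t → suc (suc k) + (suc k + s) + (k + t) ≡ suc k + (suc k + (suc k + t)) + s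
  arith = solve-∀

triangle : ℕ → ℕ
triangle zero    = 0
triangle (suc k) = suc k + triangle k

sum-stair : ∀ m → sum (stair m) ≡ triangle m + triangle m
sum-stair zero    = refl
sum-stair (suc k) = lin-≡ (sum-stair k) (arith k (sum (stair k)) (triangle k))
  where
  arith : ∀ k s t → suc k + (suc k + s) + (t + t) ≡ suc k + t + (suc k + t) + s
  arith = solve-∀

row : ℕ → List ℕ
row zero    = []
row (suc x) = suc x ∷ []

removeBox : List ℕ → List ℕ
removeBox []          = []
removeBox (x ∷ [])    = row (pred x)
removeBox (x ∷ y ∷ p) = x ∷ removeBox (y ∷ p)

removeBox-strip : ∀ {p} → IsPartition p → Strip (removeBox p) p
removeBox-strip {[]}                P = strip λ _ → z≤n , z≤n
removeBox-strip {zero ∷ []}         P = ⊥-elim (positive-head P z≤n)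
removeBox-strip {suc zero ∷ []}     P = strip λ _ → z≤n , z≤n
removeBox-strip {suc (suc x) ∷ []}  P = strip-cons (n≤1+n (suc x)) z≤n (strip λ _ → z≤n , z≤n)
removeBox-strip {x ∷ y ∷ p}         P = strip-cons ≤-refl (decreasing P 0) (removeBox-strip (tail-partition P))

removeBox-partition : ∀ {p} → IsPartition p → IsPartition (removeBox p)
removeBox-partition {[]}                P = P
removeBox-partition {zero ∷ []}         P = []-partition
removeBox-partition {suc zero ∷ []}     P = []-partition
removeBox-partition {suc (suc x) ∷ []}  P = cons-partition (s≤s z≤n) z≤n []-partition
removeBox-partition {x ∷ y ∷ p}         P@(h ∷ _ , _) = cons-partition h
  (≤-trans (proj₁ (at (removeBox-strip (tail-partition P)) 0)) (decreasing P 0)) (removeBox-partition (tail-partition P))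

sum-removeBox : ∀ {p s} → IsPartition p → sum p ≡ suc s → sum (removeBox p) ≡ s
sum-removeBox {zero ∷ []}         P e = ⊥-elim (positive-head P z≤n)
sum-removeBox {suc zero ∷ []}     P e = suc-injective e
sum-removeBox {suc (suc x) ∷ []}  P e = suc-injective e
sum-removeBox {x ∷ y ∷ p} {s}     P@(_ ∷ h ∷ _ , _) e = +-cancelʳ-≡ 1 _ _ (trans (begin
  x + sum (removeBox (y ∷ p)) + 1    ≡⟨ +-assoc x _ 1 ⟩
  x + (sum (removeBox (y ∷ p)) + 1)  ≡⟨ cong (λ z → x + z) (trans (+-comm _ 1) (cong suc (sum-removeBox (tail-partition P) (sym r)))) ⟩
  x + suc (pred (y + sum p))         ≡⟨ cong (λ z → x + z) r ⟩
  x + (y + sum p)                    ≡⟨ e ⟩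
  suc s                              ∎) (+-comm 1 s))
  where
  open ≡-Reasoning
  r : suc (pred (y + sum p)) ≡ y + sum p
  r = suc-pred (y + sum p) {{>-nonZero (≤-trans h (m≤m+n y (sum p)))}}

removeBoxes : ℕ → List ℕ → List ℕ
removeBoxes zero    p = p
removeBoxes (suc d) p = removeBox (removeBoxes d p)

removeBoxes-partition : ∀ d {p} → IsPartition p → IsPartition (removeBoxes d p)
removeBoxes-partition zero    P = P
removeBoxes-partition (suc d) P = removeBox-partition (removeBoxes-partition d P)

sum-removeBoxes : ∀ d {p s} → IsPartition p → sum p ≡ d + s → sum (removeBoxes d p) ≡ s
sum-removeBoxes zero    P e = e
sum-removeBoxes (suc d) {p} {s} P e = sum-removeBox (removeBoxes-partition d P)
  (sum-removeBoxes d P (trans e (sym (+-suc d s))))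

-- Subtraction-free form of: the boxes of q/p in the first j rows are at most |q/p| many. For
-- `first-step` that number is 1.
psum-sum-mono : ∀ p q → (∀ i → p ! i ≤ q ! i) → ∀ j → q ∥ j + sum p ≤ p ∥ j + sum q
psum-sum-mono p q h zero    = sum-mono p q h
psum-sum-mono []      q       h (suc j) = ≤-trans (≤-reflexive (+-identityʳ _))
  (≤-trans (psum≤sum q (suc j)) (m≤n+m (sum q) ([] ∥ suc j)))
psum-sum-mono (x ∷ p) []      h (suc j) = ⊥-elim′ (h 0)
  where
  ⊥-elim′ : x ≤ 0 → [] ∥ suc j + sum (x ∷ p) ≤ (x ∷ p) ∥ suc j + 0
  ⊥-elim′ z≤n = lin-≤ 0 (psum-sum-mono p [] (h ∘ suc) j ⊕ ≤-reflexive (psum-front ([] !_) j)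
    ⊕ ≤-reflexive (sym (psum-front ((zero ∷ p) !_) j)))
    (arith ([] ∥ suc j) (sum p) ((zero ∷ p) ∥ suc j) ([] ∥ j) (p ∥ j))
    where
    arith : ∀ a s b c d → a + s + (d + 0 + (c + b)) + 0 ≡ b + 0 + (c + s + (a + d))
    arith = solve-∀
psum-sum-mono (x ∷ p) (y ∷ q) h (suc j) = lin-≤ 0
  (psum-sum-mono p q (h ∘ suc) j ⊕ ≤-reflexive (psum-front ((y ∷ q) !_) j) ⊕ ≤-reflexive (sym (psum-front ((x ∷ p) !_) j)))
  (arith ((y ∷ q) ∥ suc j) (sum p) ((x ∷ p) ∥ suc j) (q ∥ j) (p ∥ j) x y (sum q))
  where
  arith : ∀ a s b c d x y t → a + (x + s) + (d + t + (y + c + b)) + 0 ≡ b + (y + t) + (c + s + (a + (x + d)))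
  arith = solve-∀

module _ {m : ℕ} {λ′ : List ℕ} (λP : IsPartition λ′) (size : sum λ′ ≡ m) where
  private
    M = sum (stair⁺ m)
    β = stair m
    ν = stair⁺ m
    open Patterns M ν
    -- The shapes of one standard tableau of shape λ′, with t boxes at time t: the boxes of λ′ are
    -- taken off from the end of the last row.
    τ : ℕ → List ℕ
    τ t = removeBoxes (m ∸ t) λ′

    m≤M : m ≤ M
    m≤M = ≤-trans (m≤m+n m (sum β)) (≤-reflexive (sym (sum-stair⁺ m)))

    τ-partition : ∀ t → IsPartition (τ t)
    τ-partition t = removeBoxes-partition (m ∸ t) λP

    sum-τ : ∀ {t} → t ≤ m → sum (τ t) ≡ t
    sum-τ {t} h = sum-removeBoxes (m ∸ t) λP (trans size (sym (m∸n+n≡m h)))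

    τ≤ : ∀ {t} → t ≤ m → Bounded M (τ t)
    τ≤ {t} h = τ-partition t , ≤-trans (≤-reflexive (sum-τ h)) (≤-trans h m≤M)

    τ-strip : ∀ {t} → t < m → Strip (τ t) (τ (suc t))
    τ-strip {t} h = subst (λ d → Strip (removeBoxes d λ′) (τ (suc t))) (sym (+-∸-assoc 1 h)) (removeBox-strip (τ-partition (suc t)))

    m∸t : ∀ {t} → t < m → suc (m ∸ suc t) ≡ m ∸ t
    m∸t h = sym (+-∸-assoc 1 h)

    -- The letter for row 2t occurs once, in the new box of τ (t + 1). The position of that box is
    -- irrelevant to the lattice condition, because the preceding row of β, or M for t = 0, already
    -- reaches ν ! 2t.
    first-step : ∀ {t} → t < m →
      Step (double t) (β ! double t) (previous (rows β (double t))) (τ t) (τ t) (τ (suc t))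
    first-step {t} h = τ-strip h , sizes , good λ j → lin-≤ 0
      (prev t h ⊕ psum-sum-mono (τ t) (τ (suc t)) (proj₁ ∘ at (τ-strip h)) (suc j)
        ⊕ ≤-reflexive sizes)
      (arith (β ! double t) (ν ! double t) (previous (rows β (double t))) (τ (suc t) ∥ suc j) (τ t ∥ suc j)
        (τ t ∥ j) (sum (τ t)) (sum (τ (suc t))))
      where
      arith : ∀ b n p x y z s s′ → b + (x + z) + (p + (y + s′ + (s + n))) + 0 ≡ p + (y + z) + (n + (x + s + (s′ + b)))
      arith = solve-∀
      sizes : sum (τ (suc t)) + β ! double t ≡ sum (τ t) + ν ! double t
      sizes = begin
        sum (τ (suc t)) + β ! double t  ≡⟨ cong₂ _+_ (sum-τ h) (stair-!₀ m t) ⟩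
        suc t + (m ∸ t)                 ≡⟨ +-suc t (m ∸ t) ⟨
        t + suc (m ∸ t)                 ≡⟨ cong₂ _+_ (sum-τ (<⇒≤ h)) (stair⁺-!₀ h) ⟨
        sum (τ t) + ν ! double t        ∎
        where open ≡-Reasoning
      prev : ∀ t → t < m → ν ! double t ≤ previous (rows β (double t))
      prev zero    h = first≤sum ν
      prev (suc t) h = ≤-reflexive (trans (stair⁺-!₀ h) (trans (m∸t (<⇒≤ h)) (sym (stair-!₁ m t))))

    second-step : ∀ {t} → t < m →
      Step (suc (double t)) (β ! suc (double t)) (β ! double t) (τ t) (τ (suc t)) (τ (suc t))
    second-step {t} h = Strip-refl (decreasing (τ-partition (suc t))) ,
      cong (λ z → sum (τ (suc t)) + z) (trans (stair-!₁ m t) (sym (stair⁺-!₁ m t))) ,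
      good λ j → +-mono-≤ (≤-reflexive (trans (stair-!₁ m t) (sym (stair-!₀ m t))))
        (+-monoʳ-≤ (τ (suc t) ∥ suc j) (psum-mono j (proj₁ ∘ at (τ-strip h))))

    step-≤ : ∀ i {a b c} → Bounded M c → Step i (β ! i) (previous (rows β i)) a b c → (F : List ℕ → List ℕ → ℕ) →
      F b c ≤ ∑[ c ∈ 𝒫 ] ⟦ step? (length (rows β i)) (β ! i) (previous (rows β i)) a b c ⟧ * F b c
    step-≤ i {a} {b} {c} c≤ s F rewrite length-rows β i = begin
      F b c            ≡⟨ *-identityˡ (F b c) ⟨
      1 * F b c        ≡⟨ cong (_* F b c) (⟦⟧-yes (st c) s) ⟨
      ⟦ st c ⟧ * F b c ≤⟨ ∑-term (λ c → ⟦ st c ⟧ * F b c) (partitions≤-complete c≤) ⟩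
      ∑[ c ∈ 𝒫 ] ⟦ st c ⟧ * F b c ∎
      where
      open ≤-Reasoning
      st = step? i (β ! i) (previous (rows β i)) a b

    -- Keeps the single term of the sum that belongs to the chain τ. Its last two levels coincide
    -- because the odd rows of β and ν agree and receive no letter.
    standard : ∀ t → t ≤ m → ∀ F → F (τ t) (τ t) ≤ patterns (rows β (double t)) F
    standard zero    h F = ≤-reflexive (cong₂ F τ₀ τ₀)
      where
      τ₀ : τ 0 ≡ []
      τ₀ = sum≡0 (τ-partition 0) (sum-τ z≤n)
    standard (suc t) h F = ≤-trans (step-≤ (suc (double t)) (τ≤ h) (second-step h) F)
      (≤-trans (step-≤ (double t) (τ≤ h) (first-step h) (next (suc (double t)) F))
        (standard t (<⇒≤ h) (next (double t) (next (suc (double t)) F))))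
      where
      next : ℕ → (List ℕ → List ℕ → ℕ) → List ℕ → List ℕ → ℕ
      next i F a b = ∑[ c ∈ 𝒫 ] ⟦ step? (length (rows β i)) (β ! i) (previous (rows β i)) a b c ⟧ * F b c

    stays : ∀ k → patterns (rows β (double m)) (λ a b → ⟦ b ≟ᴸ λ′ ⟧) ≤
                  patterns (rows β (k + double m)) (λ a b → ⟦ b ≟ᴸ λ′ ⟧)
    stays zero    = ≤-refl
    stays (suc k) = ≤-trans (stays k) (patterns-stay M (k + double m) (trans β≡0 (sym ν≡0))
      (≤-trans (≤-reflexive β≡0) z≤n) (λ b → ⟦ b ≟ᴸ λ′ ⟧))
      where
      β≡0 : β ! (k + double m) ≡ 0
      β≡0 = !-beyond β (≤-trans (≤-reflexive (length-stair m)) (m≤n+m (double m) k))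
      ν≡0 : ν ! (k + double m) ≡ 0
      ν≡0 = !-beyond ν (≤-trans (≤-reflexive (length-stair⁺ m)) (m≤n+m (double m) k))

  stair-constituent : coeff (sum (stair⁺ m)) λ′ (stair⁺ m) ≢ 0
  stair-constituent = lr⇒coeff {M} {λ′} {β} {ν}
    (stair-partition m , ≤-trans (m≤n+m (sum β) m) (≤-reflexive (sym (sum-stair⁺ m)))) (stair-even m)
    (λ e → 1+n≰n (begin
      1                                                        ≡⟨ ⟦⟧-yes (τ m ≟ᴸ λ′) (cong (λ d → removeBoxes d λ′) (n∸n≡0 m)) ⟨
      ⟦ τ m ≟ᴸ λ′ ⟧                                            ≤⟨ standard m ≤-refl _ ⟩
      patterns (rows β (double m)) (λ a b → ⟦ b ≟ᴸ λ′ ⟧)       ≤⟨ stays (M ∸ double m) ⟩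
      patterns (rows β (M ∸ double m + double m)) (λ a b → ⟦ b ≟ᴸ λ′ ⟧)
        ≡⟨ cong (λ i → patterns (rows β i) (λ a b → ⟦ b ≟ᴸ λ′ ⟧)) (m∸n+n≡m
             (≤-trans (≤-reflexive (sym (length-stair⁺ m))) (length≤sum (stair⁺-partition m)))) ⟩
      lr M λ′ β ν                                              ≡⟨ e ⟩
      0                                                        ∎))
    where open ≤-Reasoning

-- Inner products and the threshold

-- ⟨ ss_{λ,n} , ss_{μ,n} ⟩
pairing : ℕ → List ℕ → List ℕ → ℕ
pairing n λ′ μ = ∑[ ν ∈ partitions n ] coeff n λ′ ν * coeff n μ ν

ss-expansion : ∀ {n λ′} → Bounded n λ′ → SchurExpansion n (ss λ′ n) (λ ν → + coeff n λ′ ν)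
ss-expansion {n} {λ′} λ≤ α with sum α ≡ᵇ n in eq
-- `∑-rkostka` is stated for reversed contents, so it is applied to the reverse of α, and the double
-- reversal is then cancelled.
... | true  = sym (trans (sumℤ-+ (coeff n λ′) (λ ν → kostka ν [] α) (partitions n)) (cong +_ (begin
  ∑[ ν ∈ partitions n ] coeff n λ′ ν * kostka ν [] α
    ≡⟨ cong (λ k → ∑[ ν ∈ partitions k ] coeff n λ′ ν * kostka ν [] α) size ⟨
  ∑[ ν ∈ partitions (sum (reverse α)) ] coeff n λ′ ν * kostka ν [] α
    ≡⟨ ∑-cong (partitions (sum (reverse α))) (λ ν → cong (λ γ → coeff n λ′ ν * kostka ν [] γ) (reverse-involutive α)) ⟨
  ∑[ ν ∈ partitions (sum (reverse α)) ] coeff n λ′ ν * rkostka ν (reverse α)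
    ≡⟨ ∑-rkostka n (reverse α) (≤-reflexive size) (coeff n λ′) ⟩
  ∑[ ν ∈ partitions≤ n ] rkostka ν (reverse α) * coeff n λ′ ν
    ≡⟨ ∑-cong (partitions≤ n) (λ ν → cong (λ γ → kostka ν [] γ * coeff n λ′ ν) (reverse-involutive α)) ⟩
  ∑[ ν ∈ partitions≤ n ] kostka ν [] α * coeff n λ′ ν
    ≡⟨ ssotCount-kostka n α λ≤ (≤-reflexive (trans (sym (sum-reverse α)) size)) ⟨
  ssotCount λ′ [] α ∎)))
  where
  open ≡-Reasoning
  size : sum (reverse α) ≡ n
  size = trans (sum-reverse α) (≡ᵇ⇒≡ (sum α) n (subst T (sym eq) tt))
... | false = sym (trans (sumℤ-+ (coeff n λ′) (λ ν → kostka ν [] α) (partitions n)) (cong +_ (trans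
  (∑-cong-All (partitions-sound n) (λ ν (_ , e) → trans (cong (coeff n λ′ ν *_)
    (kostka-size ν α [] λ e′ → subst T eq (≡⇒≡ᵇ (sum α) n (trans e′ e)))) (*-zeroʳ (coeff n λ′ ν))))
  (∑-zero (partitions n) {f = λ _ → 0} (λ _ → refl)))))

HallIP-pairing : ∀ {n λ′ μ} → Bounded n λ′ → Bounded n μ → HallIP n (ss λ′ n) (ss μ n) (+ pairing n λ′ μ)
HallIP-pairing {n} {λ′} {μ} λ≤ μ≤ = (λ ν → + coeff n λ′ ν) , (λ ν → + coeff n μ ν) ,
  ss-expansion λ≤ , ss-expansion μ≤ , sym (sumℤ-+ (coeff n λ′) (coeff n μ) (partitions n))

-- `HallIP` only asserts that some Schur expansions give the value r; linear independence shows that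
-- the expansions, and with them r, are determined.
HallIP-unique : ∀ {n λ′ μ r} → Bounded n λ′ → Bounded n μ → HallIP n (ss λ′ n) (ss μ n) r → r ≡ + pairing n λ′ μ
HallIP-unique {n} {λ′} {μ} λ≤ μ≤ (c , d , C , D , e) = trans e (trans
  (cong sumℤ (map-cong-local (All.map (λ (νP , s) → cong₂ _*ℤ_ (same λ≤ c C νP s) (same μ≤ d D νP s)) (partitions-sound n))))
  (sumℤ-+ (coeff n λ′) (coeff n μ) (partitions n)))
  where
  same : ∀ {κ} → Bounded n κ → ∀ x → SchurExpansion n (ss κ n) x →
         ∀ {ν} → IsPartition ν → sum ν ≡ n → x ν ≡ + coeff n κ ν
  same {κ} κ≤ x X = kostka-independent n ≤-refl x (λ ν → + coeff n κ ν)
    (λ α → trans (sym (X (reverse α))) (ss-expansion κ≤ (reverse α)))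

-- All terms are natural numbers, so positivity means a common constituent s_ν; then ν + (1,1)
-- indexes a common constituent two degrees higher.
pairing-addColumn : ∀ n λ′ μ → 0 < pairing n λ′ μ → 0 < pairing (2 + n) λ′ μ
pairing-addColumn n λ′ μ h with ∑-positive (partitions-sound n) (<⇒≢ h ∘ sym)
... | ν , (νP , refl) , ne = n≢0⇒n>0 λ e → nonzero (n≤0⇒n≡0 (≤-trans
    (∑-term (λ ν → coeff (2 + n) λ′ ν * coeff (2 + n) μ ν)
      (partitions-complete (addColumn-partition νP) (sum-addColumn ν)))
    (≤-reflexive e)))
  where
  nonzero : coeff (2 + n) λ′ (addColumn ν) * coeff (2 + n) μ (addColumn ν) ≢ 0
  nonzero e with m*n≡0⇒m≡0∨n≡0 (coeff (2 + n) λ′ (addColumn ν)) e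
  ... | inj₁ z = coeff-addColumn (νP , ≤-refl) (λ z′ → ne (cong (_* coeff n μ ν) z′)) z
  ... | inj₂ z = coeff-addColumn (νP , ≤-refl) (λ z′ → ne (trans (cong (coeff n λ′ ν *_) z′) (*-zeroʳ (coeff n λ′ ν)))) z

pairing-stair : ∀ {m λ′ μ} → IsPartition λ′ → IsPartition μ → sum λ′ ≡ m → sum μ ≡ m →
                0 < pairing (sum (stair⁺ m)) λ′ μ
pairing-stair {m} {λ′} {μ} λP μP λm μm = n≢0⇒n>0 λ e → nonzero (n≤0⇒n≡0 (≤-trans
    (∑-term (λ ν → coeff M λ′ ν * coeff M μ ν) (partitions-complete (stair⁺-partition m) refl)) (≤-reflexive e)))
  where
  M = sum (stair⁺ m)
  nonzero : coeff M λ′ (stair⁺ m) * coeff M μ (stair⁺ m) ≢ 0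
  nonzero e with m*n≡0⇒m≡0∨n≡0 (coeff M λ′ (stair⁺ m)) e
  ... | inj₁ z = stair-constituent λP λm z
  ... | inj₂ z = stair-constituent μP μm z

least : {P : ℕ → Set} → (∀ k → Dec (P k)) → ∀ K → P K → ∃ λ k → P k × (∀ j → j < k → ¬ P j)
least P? K PK with P? 0
least P? K       PK | yes P0 = 0 , P0 , λ j ()
least P? zero    PK | no ¬P0 = ⊥-elim (¬P0 PK)
least P? (suc K) PK | no ¬P0 = let (k , Pk , below) = least (P? ∘ suc) K PK in
  suc k , Pk , λ { zero _ → ¬P0 ; (suc j) (s≤s h) → below j h }

theorem4p12 : (m : ℕ) (λ′ μ : List ℕ) →
    IsPartition λ′ → IsPartition μ → ∣ λ′ ∣ₚ ≡ m → ∣ μ ∣ₚ ≡ m →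
    ∃! _≡_ (λ n₀ → InN m n₀ ×
    (∀ n → InN m n → n < n₀ → HallIP n (ss λ′ n) (ss μ n) (+ 0)) ×
    (∀ n → InN m n → n₀ ≤ n →
    Σ ℤ (λ r → (+ 0 <ℤ r) × HallIP n (ss λ′ n) (ss μ n) r)))
theorem4p12 m λ′ μ λP μP λm μm =
  n₀ , ((k₀ , refl) , vanishing , positivity) , λ {n} → unique n
  where
  size : ℕ → ℕ
  size k = m + (k + k)

  Positive : ℕ → Set
  Positive k = 0 < pairing (size k) λ′ μ

  size-suc : ∀ k → 2 + size k ≡ size (suc k)
  size-suc = arith m
    where
    arith : ∀ m k → 2 + (m + (k + k)) ≡ m + (suc k + suc k)
    arith = solve-∀

  minimum : ∃ λ k → Positive k × (∀ j → j < k → ¬ Positive j)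
  -- The search ends at the latest at k = `triangle m`, because `stair⁺ m` has m + 2 · `triangle m`
  -- boxes.
  minimum = least (λ k → 0 <? pairing (size k) λ′ μ) (triangle m)
    (subst (λ n → 0 < pairing n λ′ μ) (trans (sum-stair⁺ m) (cong (λ s → m + s) (sum-stair m)))
      (pairing-stair λP μP λm μm))

  k₀ = proj₁ minimum
  n₀ = size k₀

  upward : ∀ d → Positive (d + k₀)
  upward zero    = proj₁ (proj₂ minimum)
  upward (suc d) = subst (λ n → 0 < pairing n λ′ μ) (size-suc (d + k₀)) (pairing-addColumn (size (d + k₀)) λ′ μ (upward d))

  above : ∀ k → k₀ ≤ k → Positive k
  above k h = subst Positive (m∸n+n≡m h) (upward (k ∸ k₀))

  below₀ : ∀ k → k < k₀ → pairing (size k) λ′ μ ≡ 0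
  below₀ k h = n≤0⇒n≡0 (≮⇒≥ (proj₂ (proj₂ minimum) k h))

  size-cancel-< : ∀ j k → size j < size k → j < k
  size-cancel-< j k h = ≰⇒> λ k≤j → <⇒≱ h (+-monoʳ-≤ m (+-mono-≤ k≤j k≤j))

  bounded : ∀ {p} → IsPartition p → sum p ≡ m → ∀ k → Bounded (size k) p
  bounded P e k = P , ≤-trans (≤-reflexive e) (m≤m+n m (k + k))

  vanishing : ∀ n → InN m n → n < n₀ → HallIP n (ss λ′ n) (ss μ n) (+ 0)
  vanishing n (k , refl) h = subst (HallIP n (ss λ′ n) (ss μ n)) (cong +_ (below₀ k (size-cancel-< k k₀ h)))
    (HallIP-pairing (bounded λP λm k) (bounded μP μm k))

  positivity : ∀ n → InN m n → n₀ ≤ n → Σ ℤ (λ r → (+ 0 <ℤ r) × HallIP n (ss λ′ n) (ss μ n) r)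
  positivity n (k , refl) h = + pairing n λ′ μ ,
    +<+ (above k (≮⇒≥ λ k<k₀ → <⇒≱ (+-monoʳ-< m (+-mono-< k<k₀ k<k₀)) h)) ,
    HallIP-pairing (bounded λP λm k) (bounded μP μm k)

  unique : ∀ n → InN m n × (∀ n′ → InN m n′ → n′ < n → HallIP n′ (ss λ′ n′) (ss μ n′) (+ 0)) ×
    (∀ n′ → InN m n′ → n ≤ n′ → Σ ℤ (λ r → (+ 0 <ℤ r) × HallIP n′ (ss λ′ n′) (ss μ n′) r)) → n₀ ≡ n
  unique n ((k , refl) , zeros , positives) with <-cmp n₀ n
  ... | tri≈ _ e _ = e
  ... | tri< h _ _ = ⊥-elim (<⇒≢ (proj₁ (proj₂ minimum)) (ℤ.+-injective
    (HallIP-unique (bounded λP λm k₀) (bounded μP μm k₀) (zeros n₀ (k₀ , refl) h))))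
  ... | tri> _ _ h with positives n (k , refl) ≤-refl
  ... | r , r>0 , ip = ⊥-elim (ℤ.<-irrefl refl (subst (+ 0 <ℤ_)
    (trans (HallIP-unique (bounded λP λm k) (bounded μP μm k) ip) (cong +_ (below₀ k (size-cancel-< k k₀ h)))) r>0))
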